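{- For every $n\geq 5$ there exists a periodic triangulation of $\mathbb{Z}^n$ that is not regular.
   Context: A periodic triangulation of $\mathbb{Z}^n$ is a collection $\mathcal{T}$ of $n$-dimensional simplices in $\mathbb{R}^n$ whose set of vertices is $\mathbb{Z}^n$, which cover $\mathbb{R}^n$, such that the intersection of any two simplices of $\mathcal{T}$ is a (possibly empty) face of both, and such that $\mathcal{T}+v=\mathcal{T}$ for every $v\in\mathbb{Z}^n$. A triangulation $\mathcal{T}$ of $\mathbb{Z}^n$ is regular if there exists a function $f:\mathbb{Z}^n\to\mathbb{R}$ (not assumed to have any periodicity) such that the points $(x,f(x))$, $x\in\mathbb{Z}^n$, are vertices of the convex polyhedron $H(f)=\mathrm{conv}\{(x,f(x)) : x\in\mathbb{Z}^n\}\subset\mathbb{R}^{n+1}$, and the simplices of $\mathcal{T}$ are the orthogonal projections onto $\mathbb{R}^n$ of the facets of $H(f)$. -}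

module Defs where

open import Level using (0ℓ)
open import Data.Nat.Base as ℕ using (ℕ; zero; suc)
import Data.Nat.Properties as ℕₚ
open import Data.Integer.Base as ℤ using (ℤ)
open import Data.Rational.Base as ℚ using (ℚ; 0ℚ; 1ℚ; ½; ∣_∣)
import Data.Rational.Properties as ℚₚ
open import Data.Rational.Solver using (module +-*-Solver)
open import Data.Fin.Base using (Fin)
open import Data.Fin.Subset as Subset using (Subset)
open import Data.Product.Base using (Σ; ∃; ∃-syntax; _×_; _,_)
open import Data.Sum.Base using (inj₁; inj₂)
open import Data.Vec.Base as Vec using (Vec; lookup)
open import Data.Vec.Functional as Vector using (Vector)
open import Relation.Nullary.Negation.Core using (¬_)
open import Relation.Unary using (Pred; _∈_; _∩_; _≐_)
open import Relation.Binary.PropositionalEquality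
  using (_≡_; refl; sym; cong; cong₂; subst; module ≡-Reasoning)

-- ℝ is the setoid of Cauchy sequences of rationals, with _≈_ as equality.

module Reals where

  IsCauchy : (ℕ → ℚ) → Set
  IsCauchy x = ∀ ε → 0ℚ ℚ.< ε →
    ∃[ N ] ∀ m n → N ℕ.≤ m → N ℕ.≤ n → ∣ x m ℚ.- x n ∣ ℚ.< ε

  record ℝ : Set where
    constructor mkℝ
    field
      seq    : ℕ → ℚ
      cauchy : IsCauchy seq

  open ℝ public

  infix 4 _≈_ _≤_

  _≈_ : ℝ → ℝ → Set
  x ≈ y = ∀ ε → 0ℚ ℚ.< ε →
    ∃[ N ] ∀ n → N ℕ.≤ n → ∣ seq x n ℚ.- seq y n ∣ ℚ.< ε

  _≤_ : ℝ → ℝ → Set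
  x ≤ y = ∀ ε → 0ℚ ℚ.< ε →
    ∃[ N ] ∀ n → N ℕ.≤ n → seq x n ℚ.< seq y n ℚ.+ ε

  abstract
    half-pos : ∀ {ε} → 0ℚ ℚ.< ε → 0ℚ ℚ.< ½ ℚ.* ε
    half-pos {ε} ε>0 = subst (ℚ._< ½ ℚ.* ε) (ℚₚ.*-zeroʳ ½) (ℚₚ.*-monoʳ-<-pos ½ ε>0)

    halves : ∀ ε → ½ ℚ.* ε ℚ.+ ½ ℚ.* ε ≡ ε
    halves = solve 1 (λ e → con ½ :* e :+ con ½ :* e := e) refl
      where open +-*-Solver

    const-cauchy : ∀ q → IsCauchy (λ _ → q)
    const-cauchy q ε ε>0 =
      0 , λ _ _ _ _ → subst (λ d → ∣ d ∣ ℚ.< ε) (sym (ℚₚ.+-inverseʳ q)) ε>0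

    +-cauchy : ∀ x y → IsCauchy x → IsCauchy y → IsCauchy (λ n → x n ℚ.+ y n)
    +-cauchy x y cx cy ε ε>0 with cx (½ ℚ.* ε) (half-pos ε>0) | cy (½ ℚ.* ε) (half-pos ε>0)
    ... | M , hx | N , hy = M ℕ.⊔ N , λ m n m≥ n≥ → begin-strict
        ∣ (x m ℚ.+ y m) ℚ.- (x n ℚ.+ y n) ∣
          ≡⟨ cong ∣_∣ (regroup (x m) (y m) (x n) (y n)) ⟩
        ∣ (x m ℚ.- x n) ℚ.+ (y m ℚ.- y n) ∣
          ≤⟨ ℚₚ.∣p+q∣≤∣p∣+∣q∣ (x m ℚ.- x n) (y m ℚ.- y n) ⟩
        ∣ x m ℚ.- x n ∣ ℚ.+ ∣ y m ℚ.- y n ∣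
          <⟨ ℚₚ.+-mono-< (hx m n (ℕₚ.m⊔n≤o⇒m≤o M N m≥) (ℕₚ.m⊔n≤o⇒m≤o M N n≥))
                         (hy m n (ℕₚ.m⊔n≤o⇒n≤o M N m≥) (ℕₚ.m⊔n≤o⇒n≤o M N n≥)) ⟩
        ½ ℚ.* ε ℚ.+ ½ ℚ.* ε
          ≡⟨ halves ε ⟩
        ε ∎
      where
      open ℚₚ.≤-Reasoning
      regroup : ∀ a b c d → (a ℚ.+ b) ℚ.- (c ℚ.+ d) ≡ (a ℚ.- c) ℚ.+ (b ℚ.- d)
      regroup = solve 4 (λ a b c d → (a :+ b) :- (c :+ d) := (a :- c) :+ (b :- d)) refl
        where open +-*-Solver

    0≤∣_∣ : ∀ p → 0ℚ ℚ.≤ ∣ p ∣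
    0≤∣ p ∣ = ℚₚ.nonNegative⁻¹ ∣ p ∣ {{ℚₚ.∣-∣-nonNeg p}}

    prefix : (ℕ → ℚ) → ℕ → ℚ
    prefix x zero    = ∣ x 0 ∣
    prefix x (suc n) = prefix x n ℚ.+ ∣ x (suc n) ∣

    0≤prefix : ∀ x n → 0ℚ ℚ.≤ prefix x n
    0≤prefix x zero    = 0≤∣ x 0 ∣
    0≤prefix x (suc n) = ℚₚ.+-mono-≤ (0≤prefix x n) 0≤∣ x (suc n) ∣

    last≤prefix : ∀ x n → ∣ x n ∣ ℚ.≤ prefix x n
    last≤prefix x zero    = ℚₚ.≤-refl
    last≤prefix x (suc n) = subst (ℚ._≤ prefix x (suc n)) (ℚₚ.+-identityˡ ∣ x (suc n) ∣)
      (ℚₚ.+-monoˡ-≤ ∣ x (suc n) ∣ (0≤prefix x n))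

    term≤prefix : ∀ x {m n} → m ℕ.≤′ n → ∣ x m ∣ ℚ.≤ prefix x n
    term≤prefix x {m} ℕ.≤′-refl = last≤prefix x m
    term≤prefix x {m} {suc n} (ℕ.≤′-step m≤n) =
      subst (ℚ._≤ prefix x (suc n)) (ℚₚ.+-identityʳ ∣ x m ∣)
        (ℚₚ.+-mono-≤ (term≤prefix x m≤n) 0≤∣ x (suc n) ∣)

    bounded : ∀ x → IsCauchy x → ∃[ B ] 0ℚ ℚ.< B × (∀ n → ∣ x n ∣ ℚ.≤ B)
    bounded x cx with cx 1ℚ (ℚₚ.positive⁻¹ 1ℚ)
    ... | N , h = 1ℚ ℚ.+ prefix x N , B>0 , bound
      where
      open ℚₚ.≤-Reasoning
      B>0 : 0ℚ ℚ.< 1ℚ ℚ.+ prefix x N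
      B>0 = ℚₚ.+-mono-<-≤ (ℚₚ.positive⁻¹ 1ℚ) (0≤prefix x N)
      split : ∀ a b → a ≡ (a ℚ.- b) ℚ.+ b
      split = solve 2 (λ a b → a := (a :- b) :+ b) refl
        where open +-*-Solver
      bound : ∀ n → ∣ x n ∣ ℚ.≤ 1ℚ ℚ.+ prefix x N
      bound n with ℕₚ.≤-total n N
      ... | inj₁ n≤N = begin
        ∣ x n ∣              ≡⟨ ℚₚ.+-identityˡ ∣ x n ∣ ⟨
        0ℚ ℚ.+ ∣ x n ∣       ≤⟨ ℚₚ.+-mono-≤ (ℚₚ.<⇒≤ (ℚₚ.positive⁻¹ 1ℚ))
                                            (term≤prefix x (ℕₚ.≤⇒≤′ n≤N)) ⟩
        1ℚ ℚ.+ prefix x N    ∎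
      ... | inj₂ N≤n = begin
        ∣ x n ∣                        ≡⟨ cong ∣_∣ (split (x n) (x N)) ⟩
        ∣ (x n ℚ.- x N) ℚ.+ x N ∣      ≤⟨ ℚₚ.∣p+q∣≤∣p∣+∣q∣ (x n ℚ.- x N) (x N) ⟩
        ∣ x n ℚ.- x N ∣ ℚ.+ ∣ x N ∣    ≤⟨ ℚₚ.+-mono-≤ (ℚₚ.<⇒≤ (h n N N≤n ℕₚ.≤-refl))
                                                      (last≤prefix x N) ⟩
        1ℚ ℚ.+ prefix x N              ∎

    scale : ∀ B ε → 0ℚ ℚ.< B → 0ℚ ℚ.< ε → ∃[ δ ] 0ℚ ℚ.< δ × B ℚ.* δ ≡ ε
    scale B ε B>0 ε>0 = 1/B ℚ.* ε , δ>0 , (begin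
        B ℚ.* (1/B ℚ.* ε)    ≡⟨ ℚₚ.*-assoc B 1/B ε ⟨
        (B ℚ.* 1/B) ℚ.* ε    ≡⟨ cong (ℚ._* ε) (ℚₚ.*-inverseʳ B) ⟩
        1ℚ ℚ.* ε             ≡⟨ ℚₚ.*-identityˡ ε ⟩
        ε                    ∎)
      where
      open ≡-Reasoning
      instance
        B-pos : ℚ.Positive B
        B-pos = ℚ.positive B>0
        B-nz : ℚ.NonZero B
        B-nz = ℚₚ.pos⇒nonZero B
      1/B : ℚ
      1/B = ℚ.1/ B
      instance
        1/B-pos : ℚ.Positive 1/B
        1/B-pos = ℚₚ.1/pos⇒pos B
      δ>0 : 0ℚ ℚ.< 1/B ℚ.* ε
      δ>0 = subst (ℚ._< 1/B ℚ.* ε) (ℚₚ.*-zeroʳ 1/B) (ℚₚ.*-monoʳ-<-pos 1/B ε>0)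

    *-bound : ∀ p q {B δ} → 0ℚ ℚ.< B → ∣ p ∣ ℚ.≤ B → ∣ q ∣ ℚ.< δ →
              ∣ p ℚ.* q ∣ ℚ.< B ℚ.* δ
    *-bound p q {B} {δ} B>0 p≤B q<δ = begin-strict
      ∣ p ℚ.* q ∣        ≡⟨ ℚₚ.∣p*q∣≡∣p∣*∣q∣ p q ⟩
      ∣ p ∣ ℚ.* ∣ q ∣    ≤⟨ ℚₚ.*-monoʳ-≤-nonNeg ∣ q ∣ {{ℚₚ.∣-∣-nonNeg q}} p≤B ⟩
      B ℚ.* ∣ q ∣        <⟨ ℚₚ.*-monoʳ-<-pos B {{ℚ.positive B>0}} q<δ ⟩
      B ℚ.* δ            ∎
      where open ℚₚ.≤-Reasoning

    *-cauchy : ∀ x y → IsCauchy x → IsCauchy y → IsCauchy (λ n → x n ℚ.* y n)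
    *-cauchy x y cx cy ε ε>0
      with bounded x cx | bounded y cy
    ... | A , A>0 , x≤A | B , B>0 , y≤B
      with scale A (½ ℚ.* ε) A>0 (half-pos ε>0) | scale B (½ ℚ.* ε) B>0 (half-pos ε>0)
    ... | α , α>0 , Aα | β , β>0 , Bβ
      with cx β β>0 | cy α α>0
    ... | M , hx | N , hy = M ℕ.⊔ N , λ m n m≥ n≥ → begin-strict
        ∣ x m ℚ.* y m ℚ.- x n ℚ.* y n ∣
          ≡⟨ cong ∣_∣ (regroup (x m) (y m) (x n) (y n)) ⟩
        ∣ x m ℚ.* (y m ℚ.- y n) ℚ.+ y n ℚ.* (x m ℚ.- x n) ∣
          ≤⟨ ℚₚ.∣p+q∣≤∣p∣+∣q∣ (x m ℚ.* (y m ℚ.- y n)) (y n ℚ.* (x m ℚ.- x n)) ⟩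
        ∣ x m ℚ.* (y m ℚ.- y n) ∣ ℚ.+ ∣ y n ℚ.* (x m ℚ.- x n) ∣
          <⟨ ℚₚ.+-mono-<
               (*-bound (x m) (y m ℚ.- y n) A>0 (x≤A m) (hy m n (ℕₚ.m⊔n≤o⇒n≤o M N m≥) (ℕₚ.m⊔n≤o⇒n≤o M N n≥)))
               (*-bound (y n) (x m ℚ.- x n) B>0 (y≤B n) (hx m n (ℕₚ.m⊔n≤o⇒m≤o M N m≥) (ℕₚ.m⊔n≤o⇒m≤o M N n≥))) ⟩
        A ℚ.* α ℚ.+ B ℚ.* β
          ≡⟨ cong₂ ℚ._+_ Aα Bβ ⟩
        ½ ℚ.* ε ℚ.+ ½ ℚ.* ε
          ≡⟨ halves ε ⟩
        ε ∎
      where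
      open ℚₚ.≤-Reasoning
      regroup : ∀ a b c d → a ℚ.* b ℚ.- c ℚ.* d ≡ a ℚ.* (b ℚ.- d) ℚ.+ d ℚ.* (a ℚ.- c)
      regroup = solve 4 (λ a b c d →
        a :* b :- c :* d := a :* (b :- d) :+ d :* (a :- c)) refl
        where open +-*-Solver

  fromℚ : ℚ → ℝ
  fromℚ q = mkℝ (λ _ → q) (const-cauchy q)

  fromℤ : ℤ → ℝ
  fromℤ z = fromℚ (z ℚ./ 1)

  0ℝ 1ℝ : ℝ
  0ℝ = fromℚ 0ℚ
  1ℝ = fromℚ 1ℚ

  infixl 6 _+_
  infixl 7 _*_

  _+_ : ℝ → ℝ → ℝ
  x + y = mkℝ (λ n → seq x n ℚ.+ seq y n) (+-cauchy (seq x) (seq y) (cauchy x) (cauchy y))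

  _*_ : ℝ → ℝ → ℝ
  x * y = mkℝ (λ n → seq x n ℚ.* seq y n) (*-cauchy (seq x) (seq y) (cauchy x) (cauchy y))

  sum : ∀ {k} → Vector ℝ k → ℝ
  sum = Vector.foldr _+_ 0ℝ

open Reals

Point : ℕ → Set
Point m = Vector ℝ m

infix 4 _≋_

_≋_ : ∀ {m} → Point m → Point m → Set
p ≋ q = ∀ i → p i ≈ q i

⟨_,_⟩ : ∀ {m} → Point m → Point m → ℝ
⟨ a , p ⟩ = sum (λ i → a i * p i)

combination : ∀ {m k} → Vector ℝ k → Vector (Point m) k → Point m
combination c p i = sum (λ j → c j * p j i)

conv : ∀ {m} → Pred (Point m) 0ℓ → Pred (Point m) 0ℓ
conv S x = ∃[ k ] Σ (Vector ℝ k) λ c → Σ (Vector (Point _) k) λ p →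
  (∀ j → p j ∈ S) × (∀ j → 0ℝ ≤ c j) × sum c ≈ 1ℝ × x ≋ combination c p

AffinelyIndependent : ∀ {m k} → Vector (Point m) k → Set
AffinelyIndependent {k = k} p = (c : Vector ℝ k) →
  sum c ≈ 0ℝ → combination c p ≋ (λ _ → 0ℝ) → ∀ j → c j ≈ 0ℝ

ContainsIndependent : ∀ {m} → Pred (Point m) 0ℓ → ℕ → Set
ContainsIndependent S k = Σ (Vector (Point _) k) λ p →
  AffinelyIndependent p × (∀ j → p j ∈ S)

-- d is the dimension of the affine hull of S.
HasDimension : ∀ {m} → Pred (Point m) 0ℓ → ℕ → Set
HasDimension S d = ContainsIndependent S (suc d) × ¬ ContainsIndependent S (suc (suc d))

-- a = 0 is allowed, so P and ∅ count among the faces of P.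
IsFace : ∀ {m} → Pred (Point m) 0ℓ → Pred (Point m) 0ℓ → Set
IsFace {m} P F = Σ (Point m) λ a → Σ ℝ λ b →
  (∀ y → y ∈ P → ⟨ a , y ⟩ ≤ b) × F ≐ (P ∩ λ y → ⟨ a , y ⟩ ≈ b)

IsVertex : ∀ {m} → Pred (Point m) 0ℓ → Point m → Set
IsVertex P v = IsFace P (_≋ v)

IsFacet : ∀ {m} → Pred (Point m) 0ℓ → Pred (Point m) 0ℓ → Set
IsFacet P F = IsFace P F × ∃[ d ] HasDimension P (suc d) × HasDimension F d

LatticePoint : ℕ → Set
LatticePoint n = Vec ℤ n

toPoint : ∀ {n} → LatticePoint n → Point n
toPoint v i = fromℤ (lookup v i)

-- Vertices of a triangulation of ℤⁿ lie in ℤⁿ; the type builds this in.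
VertexTuple : ℕ → Set
VertexTuple n = Vec (LatticePoint n) (suc n)

vertex : ∀ {n} → VertexTuple n → Fin (suc n) → Point n
vertex σ i = toPoint (lookup σ i)

hull : ∀ {n} → VertexTuple n → Pred (Point n) 0ℓ
hull σ = conv (λ p → ∃[ i ] p ≋ vertex σ i)

IsFaceOfSimplex : ∀ {n} → VertexTuple n → Pred (Point n) 0ℓ → Set
IsFaceOfSimplex {n} σ F = Σ (Subset (suc n)) λ s →
  F ≐ conv (λ p → ∃[ i ] i Subset.∈ s × p ≋ vertex σ i)

translate : ∀ {n} → LatticePoint n → VertexTuple n → VertexTuple n
translate v = Vec.map (λ w → Vec.zipWith ℤ._+_ w v)

-- Simplices are compared as subsets of ℝⁿ: a simplex may belong to the
-- collection under several orderings of its vertices.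
record PeriodicTriangulation (n : ℕ) : Set₁ where
  field
    simplices   : Pred (VertexTuple n) 0ℓ
    independent : ∀ σ → σ ∈ simplices → AffinelyIndependent (vertex σ)
    vertices    : ∀ v → ∃[ σ ] σ ∈ simplices × (∃[ i ] lookup σ i ≡ v)
    covers      : ∀ x → ∃[ σ ] σ ∈ simplices × x ∈ hull σ
    face-to-face : ∀ σ τ → σ ∈ simplices → τ ∈ simplices →
      IsFaceOfSimplex σ (hull σ ∩ hull τ) × IsFaceOfSimplex τ (hull σ ∩ hull τ)
    periodic-⊆  : ∀ v σ → σ ∈ simplices →
      ∃[ τ ] τ ∈ simplices × hull (translate v σ) ≐ hull τ
    periodic-⊇  : ∀ v τ → τ ∈ simplices →
      ∃[ σ ] σ ∈ simplices × hull (translate v σ) ≐ hull τ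

-- The point (x , h) of ℝⁿ⁺¹; the height is stored as the first coordinate, so
-- that Vector.tail is the orthogonal projection onto ℝⁿ.
lift : ∀ {n} → Point n → ℝ → Point (suc n)
lift x h = h Vector.∷ x

project : ∀ {n} → Pred (Point (suc n)) 0ℓ → Pred (Point n) 0ℓ
project F x = ∃[ p ] p ∈ F × Vector.tail p ≋ x

H : ∀ {n} → (LatticePoint n → ℝ) → Pred (Point (suc n)) 0ℓ
H f = conv (λ p → ∃[ x ] p ≋ lift (toPoint x) (f x))

Regular : ∀ {n} → PeriodicTriangulation n → Set₁
Regular {n} T = Σ (LatticePoint n → ℝ) λ f →
    (∀ x → IsVertex (H f) (lift (toPoint x) (f x)))
  × (∀ σ → σ ∈ simplices → ∃[ F ] IsFacet (H f) F × hull σ ≐ project F)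
  × (∀ F → IsFacet (H f) F → ∃[ σ ] σ ∈ simplices × hull σ ≐ project F)
  where open PeriodicTriangulation T

{-# OPTIONS --safe #-}
module Submission where

-- If p₁ ⊏ p₂ ⊏ p₃ ⊏ p₁ are the oriented edges of a periodic triangulation K, the
-- vertices of every simplex being totally ordered by ⊏, then the staircase
-- triangulation of K × ℤ contains the edges from (pᵢ , 0) to (pᵢ₊₁ , 1). A regular
-- triangulation with lifting function f would satisfy
--   f (pᵢ , 0) + f (pᵢ₊₁ , 1) < f (pᵢ₊₁ , 0) + f (pᵢ , 1)
-- on the three parallelograms, and these inequalities add up to 0 < 0.
-- Such a cyclic orientation exists in dimension 4: K refines the Delaunay tiling of
-- the lattice of 3 × 3 integer matrices with zero line sums, whose cells are simplices
-- and Birkhoff polytopes, and the pᵢ are the even permutation matrices, which do not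
-- span a triangle of K. Further products with ℤ reach every dimension above 5.
--
-- Simplices fit together because weights are unique: a point is the barycentre of at
-- most one measure that is carried by the vertices of a simplex.

-- A cycle of edges cannot lie inside one simplex, whose vertices must be sortable, so K needs three
-- pairwise adjacent vertices without a common simplex. The Birkhoff polytope provides them: its
-- even and its odd permutation matrices have the same sum, so the two triangles cross in a point
-- and cannot both be present. Breaking the even triangle keeps its three sides. Since f is
-- arbitrary, H(f) could have facets on its upper as well as on its lower side, and on an upper
-- facet the parallelogram inequality is reversed. The inequalities add up only after the two kinds
-- have been shown not to coexist; this rests on the facets bounding f over the whole lattice, where
-- a bounded linear functional vanishes. What is special about the cells is a finite integer
-- computation: vertices, barycentric coordinates and slabs are integer data. Its results reach the
-- ordered domain through affine forms, whose integral against a measure depends only on the total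
-- and the barycentre.

open import Level using (0ℓ)
open import Algebra.Bundles using (CommutativeRing)
open import Axiom.ExcludedMiddle using (ExcludedMiddle)
open import Data.Bool.Base using (true; if_then_else_)
open import Data.Empty using (⊥)
open import Data.Fin using (#_)
open import Data.Fin.Base using (Fin; zero; suc; fromℕ; _↑ˡ_)
import Data.Fin.Properties as Finₚ
open import Data.Fin.Subset as Subset using (Subset)
open import Data.Integer.Base as ℤ using (ℤ; +_; -[1+_]; 0ℤ; 1ℤ; -1ℤ)
import Data.Integer.Properties as ℤₚ
open import Data.Integer.Solver using (module +-*-Solver)
open import Data.List.Base as List using (List; []; _∷_)
import Data.List.Membership.DecPropositional as ListMembership
import Data.List.Relation.Unary.All as ListAll
open import Data.Nat.Base as ℕ using (ℕ; zero; suc; _≥_)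
import Data.Nat.Properties as ℕₚ
open import Data.Product.Base using (Σ; ∃-syntax; _×_; _,_; proj₁; proj₂; swap)
open import Data.Sum.Base as Sum using (_⊎_; inj₁; inj₂)
open import Data.Vec.Base as Vec using (Vec; []; _∷_; lookup)
import Data.Vec.Properties as Vecₚ
import Data.Vec.Functional as Vector
open import Data.Vec.Functional using (Vector)
import Data.Vec.Membership.DecPropositional as DecMembership
open import Data.Vec.Membership.Propositional using (_∈_; _∉_)
open import Data.Vec.Membership.Propositional.Properties using (∈-map⁺; ∈-lookup)
open import Data.Vec.Relation.Unary.All as All using (All; []; _∷_)
import Data.Vec.Relation.Unary.All.Properties as Allₚ
open import Data.Vec.Relation.Unary.AllPairs using (AllPairs; []; _∷_; allPairs?)
open import Data.Vec.Relation.Unary.Any as Any using (here; there)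
open import Data.Vec.Relation.Unary.Any.Properties using (lookup-index)
open import Function.Base using (_∘_)
open import Relation.Binary.Core using (Rel)
open import Relation.Binary.PropositionalEquality as ≡ using (_≡_; _≢_)
open import Relation.Nullary using (¬_; Dec; yes; no; does; contradiction)
open import Relation.Nullary.Decidable using (from-yes; _×-dec_; _⊎-dec_; _→-dec_; ¬?; dec-true)
open import Relation.Unary using (Pred; _∩_; _≐_)
open import Defs using (LatticePoint; VertexTuple; translate; PeriodicTriangulation; Regular)

-- The embedding of ℤ is a field, and not defined from the ring, so that an
-- instance can supply the one its points are built from.
record OrderedDomain : Set₁ where
  field
    commutativeRing : CommutativeRing 0ℓ 0ℓ
  open CommutativeRing commutativeRing public
  infix 4 _≤_ _≟_
  field
    _≤_          : Rel Carrier 0ℓ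
    ≤-reflexive  : ∀ {x y} → x ≈ y → x ≤ y
    ≤-trans      : ∀ {x y z} → x ≤ y → y ≤ z → x ≤ z
    ≤-antisym    : ∀ {x y} → x ≤ y → y ≤ x → x ≈ y
    ≤-total      : ∀ x y → x ≤ y ⊎ y ≤ x
    _≟_          : ∀ x y → Dec (x ≈ y)
    +-mono-≤     : ∀ {x y u v} → x ≤ y → u ≤ v → x + u ≤ y + v
    *-nonNeg     : ∀ {x y} → 0# ≤ x → 0# ≤ y → 0# ≤ x * y
    zero-product : ∀ {x y} → x * y ≈ 0# → x ≈ 0# ⊎ y ≈ 0#
    1≉0          : ¬ 1# ≈ 0#
    ι            : ℤ → Carrier
    ι-+          : ∀ i j → ι (i ℤ.+ j) ≈ ι i + ι j
    ι-*          : ∀ i j → ι (i ℤ.* j) ≈ ι i * ι j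
    ι-1          : ι 1ℤ ≈ 1#
    archimedean  : ∀ x {y} → ¬ y ≤ 0# → ∃[ n ] x ≤ ι (+ n) * y

-- The Cauchy reals as an ordered domain

module RealField (em : ExcludedMiddle 0ℓ) where
  import Data.Rational.Properties as ℚₚ
  import Data.Rational.Unnormalised.Base as ℚᵘ
  import Data.Rational.Unnormalised.Properties as ℚᵘₚ
  open import Axiom.DoubleNegationElimination using (em⇒dne)
  open import Data.Rational.Base as ℚ using (ℚ; 0ℚ; 1ℚ; ½; ∣_∣)
  open import Data.Rational.Solver using () renaming (module +-*-Solver to ℚ-Solver)
  open ≡ using (refl; sym; trans; cong; cong₂; subst; subst₂)
  open Defs.Reals
  open ℚ-Solver using (solve; _:=_; _:+_; _:-_; _:*_; :-_; con)

  dne : ∀ {P : Set} → ¬ ¬ P → P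
  dne = em⇒dne em

  ¬∀⇒∃¬ : ∀ {A : Set} {P : A → Set} → ¬ (∀ x → P x) → ∃[ x ] ¬ P x
  ¬∀⇒∃¬ ¬∀ = dne λ ¬∃ → ¬∀ λ x → dne λ ¬p → ¬∃ (x , ¬p)

  Eventually : (ℕ → Set) → Set
  Eventually P = ∃[ N ] ∀ n → N ℕ.≤ n → P n

  always : ∀ {P} → (∀ n → P n) → Eventually P
  always h = 0 , λ n _ → h n

  eventually₂ : ∀ {P Q R} → Eventually P → Eventually Q → (∀ n → P n → Q n → R n) → Eventually R
  eventually₂ (M , h) (N , k) f = M ℕ.⊔ N , λ n ≥ →
    f n (h n (ℕₚ.m⊔n≤o⇒m≤o M N ≥)) (k n (ℕₚ.m⊔n≤o⇒n≤o M N ≥))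

  eventually₁ : ∀ {P R} → Eventually P → (∀ n → P n → R n) → Eventually R
  eventually₁ (M , h) f = M , λ n ≥ → f n (h n ≥)

  pointwise-≈ : ∀ {x y} → (∀ n → seq x n ≡ seq y n) → x ≈ y
  pointwise-≈ {x} {y} h ε ε>0 = always λ n → subst (ℚ._< ε)
    (sym (cong ∣_∣ (trans (cong (ℚ._- seq y n) (h n)) (ℚₚ.+-inverseʳ (seq y n))))) ε>0

  p≤∣p∣ : ∀ p → p ℚ.≤ ∣ p ∣
  p≤∣p∣ p with ℚₚ.≤-total 0ℚ p
  ... | inj₁ 0≤p = ℚₚ.≤-reflexive (sym (ℚₚ.0≤p⇒∣p∣≡p 0≤p))
  ... | inj₂ p≤0 = ℚₚ.≤-trans p≤0 0≤∣ p ∣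

  ∣p∣<ε⇒p<ε : ∀ {p ε} → ∣ p ∣ ℚ.< ε → p ℚ.< ε
  ∣p∣<ε⇒p<ε {p} = ℚₚ.≤-<-trans (p≤∣p∣ p)

  ∣p-q∣<ε⇒p<q+ε : ∀ {p q ε} → ∣ p ℚ.- q ∣ ℚ.< ε → p ℚ.< q ℚ.+ ε
  ∣p-q∣<ε⇒p<q+ε {p} {q} {ε} h = subst (ℚ._< q ℚ.+ ε)
    (solve 2 (λ p q → q :+ (p :- q) := p) refl p q) (ℚₚ.+-monoʳ-< q (∣p∣<ε⇒p<ε h))

  p<q+ε⇒p-q<ε : ∀ {p q ε} → p ℚ.< q ℚ.+ ε → p ℚ.- q ℚ.< ε
  p<q+ε⇒p-q<ε {p} {q} {ε} h = subst (p ℚ.- q ℚ.<_)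
    (solve 2 (λ q ε → (q :+ ε) :- q := ε) refl q ε) (ℚₚ.+-monoˡ-< (ℚ.- q) h)

  ∣p-q∣≡∣q-p∣ : ∀ p q → ∣ p ℚ.- q ∣ ≡ ∣ q ℚ.- p ∣
  ∣p-q∣≡∣q-p∣ p q = trans (sym (ℚₚ.∣-p∣≡∣p∣ (p ℚ.- q)))
    (cong ∣_∣ (solve 2 (λ p q → :- (p :- q) := q :- p) refl p q))

  squeeze : ∀ {p q ε} → p ℚ.< q ℚ.+ ε → q ℚ.< p ℚ.+ ε → ∣ p ℚ.- q ∣ ℚ.< ε
  squeeze {p} {q} {ε} a b with ℚₚ.∣p∣≡p∨∣p∣≡-p (p ℚ.- q)
  ... | inj₁ e = subst (ℚ._< ε) (sym e) (p<q+ε⇒p-q<ε a)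
  ... | inj₂ e = subst (ℚ._< ε) (trans (solve 2 (λ p q → q :- p := :- (p :- q)) refl p q) (sym e)) (p<q+ε⇒p-q<ε b)

  ≈⇒≤ : ∀ {x y} → x ≈ y → x ≤ y
  ≈⇒≤ h ε ε>0 = eventually₁ (h ε ε>0) (λ n → ∣p-q∣<ε⇒p<q+ε)

  ≤-antisymʳ : ∀ {x y} → x ≤ y → y ≤ x → x ≈ y
  ≤-antisymʳ h k ε ε>0 = eventually₂ (h ε ε>0) (k ε ε>0) (λ n → squeeze)

  ≈-symʳ : ∀ {x y} → x ≈ y → y ≈ x
  ≈-symʳ {x} {y} h ε ε>0 = eventually₁ (h ε ε>0) (λ n → subst (ℚ._< ε) (∣p-q∣≡∣q-p∣ (seq x n) (seq y n)))

  +-halves : ∀ p ε → (p ℚ.+ ½ ℚ.* ε) ℚ.+ ½ ℚ.* ε ≡ p ℚ.+ ε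
  +-halves p ε = trans (ℚₚ.+-assoc p (½ ℚ.* ε) (½ ℚ.* ε)) (cong (p ℚ.+_) (halves ε))

  ≤-transʳ : ∀ {x y z} → x ≤ y → y ≤ z → x ≤ z
  ≤-transʳ {x} {y} {z} h k ε ε>0 = eventually₂ (h _ (half-pos ε>0)) (k _ (half-pos ε>0)) (λ n a b → subst (seq x n ℚ.<_) (+-halves (seq z n) ε) (ℚₚ.<-trans a (ℚₚ.+-monoˡ-< (½ ℚ.* ε) b)))

  ≈-transʳ : ∀ {x y z} → x ≈ y → y ≈ z → x ≈ z
  ≈-transʳ {x} {y} {z} h k = ≤-antisymʳ {x} {z}
    (≤-transʳ {x} {y} {z} (≈⇒≤ {x} {y} h) (≈⇒≤ {y} {z} k))
    (≤-transʳ {z} {y} {x} (≈⇒≤ {z} {y} (≈-symʳ {y} {z} k)) (≈⇒≤ {y} {x} (≈-symʳ {x} {y} h)))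

  +-mono-≤ʳ : ∀ {x y u v} → x ≤ y → u ≤ v → x + u ≤ y + v
  +-mono-≤ʳ {x} {y} {u} {v} h k ε ε>0 = eventually₂ (h _ (half-pos ε>0)) (k _ (half-pos ε>0)) (λ n a b → subst (seq (x + u) n ℚ.<_)
      (trans (solve 3 (λ y v e → (y :+ e) :+ (v :+ e) := (y :+ v) :+ (e :+ e)) refl (seq y n) (seq v n) (½ ℚ.* ε))
        (cong ((seq y n ℚ.+ seq v n) ℚ.+_) (halves ε)))
      (ℚₚ.+-mono-< a b))

  +-congʳ′ : ∀ {x y u v} → x ≈ y → u ≈ v → x + u ≈ y + v
  +-congʳ′ {x} {y} {u} {v} h k = ≤-antisymʳ {x + u} {y + v}
    (+-mono-≤ʳ {x} {y} {u} {v} (≈⇒≤ {x} {y} h) (≈⇒≤ {u} {v} k))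
    (+-mono-≤ʳ {y} {x} {v} {u} (≈⇒≤ {y} {x} (≈-symʳ {x} {y} h)) (≈⇒≤ {v} {u} (≈-symʳ {u} {v} k)))

  -- A single bound serves a product: |x| ≤ B turns |y| < ε / B into |xy| < ε.
  *-null : ∀ x y → y ≈ 0ℝ → x * y ≈ 0ℝ
  *-null x y h ε ε>0 with bounded (seq x) (cauchy x)
  ... | B , B>0 , x≤B with scale B ε B>0 ε>0
  ...   | δ , δ>0 , Bδ≡ε = eventually₁ (h δ δ>0) (λ n a → subst₂ (λ d e → ∣ d ∣ ℚ.< e) (sym (ℚₚ.+-identityʳ (seq x n ℚ.* seq y n))) Bδ≡ε
      (*-bound (seq x n) (seq y n) B>0 (x≤B n) (subst (λ d → ∣ d ∣ ℚ.< δ) (ℚₚ.+-identityʳ (seq y n)) a)))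

  infix 8 -_
  -- Defined as a product, so that the Cauchy property comes from `_*_`.
  -_ : ℝ → ℝ
  - x = fromℚ (ℚ.- 1ℚ) * x

  sub-null : ∀ x y → x ≈ y → x + - y ≈ 0ℝ
  sub-null x y h ε ε>0 = eventually₁ (h ε ε>0) (λ n → subst (λ d → ∣ d ∣ ℚ.< ε)
    (solve 2 (λ x y → x :- y := (x :+ con (ℚ.- 1ℚ) :* y) :- con 0ℚ) refl (seq x n) (seq y n)))

  null-sub : ∀ x y → x + - y ≈ 0ℝ → x ≈ y
  null-sub x y h ε ε>0 = eventually₁ (h ε ε>0) (λ n → subst (λ d → ∣ d ∣ ℚ.< ε)
    (solve 2 (λ x y → (x :+ con (ℚ.- 1ℚ) :* y) :- con 0ℚ := x :- y) refl (seq x n) (seq y n)))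

  *-commʳ : ∀ x y → x * y ≈ y * x
  *-commʳ x y = pointwise-≈ {x * y} {y * x} λ n → ℚₚ.*-comm (seq x n) (seq y n)

  *-congˡʳ : ∀ x {y z} → y ≈ z → x * y ≈ x * z
  *-congˡʳ x {y} {z} h = null-sub (x * y) (x * z) (≈-transʳ {x * y + - (x * z)} {x * (y + - z)} {0ℝ}
    (pointwise-≈ {x * y + - (x * z)} {x * (y + - z)} λ n →
      solve 3 (λ x y z → x :* y :+ con (ℚ.- 1ℚ) :* (x :* z) := x :* (y :+ con (ℚ.- 1ℚ) :* z)) refl
        (seq x n) (seq y n) (seq z n))
    (*-null x (y + - z) (sub-null y z h)))

  *-congʳ : ∀ {x y u v} → x ≈ y → u ≈ v → x * u ≈ y * v
  *-congʳ {x} {y} {u} {v} h k = ≈-transʳ {x * u} {x * v} {y * v} (*-congˡʳ x {u} {v} k)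
    (≈-transʳ {x * v} {v * x} {y * v} (*-commʳ x v)
      (≈-transʳ {v * x} {v * y} {y * v} (*-congˡʳ v {x} {y} h) (*-commʳ v y)))

  ℝ-commutativeRing : CommutativeRing 0ℓ 0ℓ
  ℝ-commutativeRing = record
    { Carrier = ℝ ; _≈_ = _≈_ ; _+_ = _+_ ; _*_ = _*_ ; -_ = -_ ; 0# = 0ℝ ; 1# = 1ℝ
    ; isCommutativeRing = record
      { isRing = record
        { +-isAbelianGroup = record
          { isGroup = record
            { isMonoid = record
              { isSemigroup = record
                { isMagma = record
                  { isEquivalence = record
                    { refl = λ {x} → pointwise-≈ {x} {x} λ _ → refl
                    ; sym = λ {x} {y} → ≈-symʳ {x} {y}
                    ; trans = λ {x} {y} {z} → ≈-transʳ {x} {y} {z} }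
                  ; ∙-cong = λ {x} {y} {u} {v} → +-congʳ′ {x} {y} {u} {v} }
                ; assoc = λ x y z → pointwise-≈ {(x + y) + z} {x + (y + z)}
                    λ n → ℚₚ.+-assoc (seq x n) (seq y n) (seq z n) }
              ; identity = (λ x → pointwise-≈ {0ℝ + x} {x} λ n → ℚₚ.+-identityˡ (seq x n))
                         , (λ x → pointwise-≈ {x + 0ℝ} {x} λ n → ℚₚ.+-identityʳ (seq x n)) }
            ; inverse = (λ x → pointwise-≈ { - x + x} {0ℝ} λ n →
                           solve 1 (λ x → con (ℚ.- 1ℚ) :* x :+ x := con 0ℚ) refl (seq x n))
                      , (λ x → pointwise-≈ {x + - x} {0ℝ} λ n →
                           solve 1 (λ x → x :+ con (ℚ.- 1ℚ) :* x := con 0ℚ) refl (seq x n))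
            ; ⁻¹-cong = λ {x} {y} → *-congˡʳ (fromℚ (ℚ.- 1ℚ)) {x} {y} }
          ; comm = λ x y → pointwise-≈ {x + y} {y + x} λ n → ℚₚ.+-comm (seq x n) (seq y n) }
        ; *-cong = λ {x} {y} {u} {v} → *-congʳ {x} {y} {u} {v}
        ; *-assoc = λ x y z → pointwise-≈ {(x * y) * z} {x * (y * z)}
            λ n → ℚₚ.*-assoc (seq x n) (seq y n) (seq z n)
        ; *-identity = (λ x → pointwise-≈ {1ℝ * x} {x} λ n → ℚₚ.*-identityˡ (seq x n))
                     , (λ x → pointwise-≈ {x * 1ℝ} {x} λ n → ℚₚ.*-identityʳ (seq x n))
        ; distrib = (λ x y z → pointwise-≈ {x * (y + z)} {x * y + x * z}
                       λ n → ℚₚ.*-distribˡ-+ (seq x n) (seq y n) (seq z n))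
                  , (λ x y z → pointwise-≈ {(y + z) * x} {y * x + z * x}
                       λ n → ℚₚ.*-distribʳ-+ (seq x n) (seq y n) (seq z n)) }
      ; *-comm = *-commʳ } }

  ≤-Gap : ℝ → ℝ → Set
  ≤-Gap y x = ∃[ δ ] 0ℚ ℚ.< δ × Eventually λ n → seq y n ℚ.+ δ ℚ.< seq x n

  -- Failure of `≤` gives only some late index m with y + ε ≤ x. Beyond the moduli of both sequences
  -- for ε/4 each of them moves by less than ε/4, so half of the gap survives at every later index.
  ≰⇒gap : ∀ x y → ¬ x ≤ y → ≤-Gap y x
  ≰⇒gap x y x≰y with ¬∀⇒∃¬ x≰y
  ... | ε , ¬h with ¬∀⇒∃¬ ¬h
  ...   | ε>0 , ¬h′ = δ , half-pos ε>0 , gap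
    where
    δ = ½ ℚ.* ε
    η = ½ ℚ.* δ
    X = cauchy x η (half-pos (half-pos ε>0))
    Y = cauchy y η (half-pos (half-pos ε>0))
    M = proj₁ X ℕ.⊔ proj₁ Y
    jump = ¬∀⇒∃¬ λ h → ¬h′ (M , h)
    m = proj₁ jump
    far = ¬∀⇒∃¬ (proj₂ jump)
    m≥M = proj₁ far
    yₘ+ε≤xₘ : seq y m ℚ.+ ε ℚ.≤ seq x m
    yₘ+ε≤xₘ = ℚₚ.≮⇒≥ (proj₂ far)
    gap : Eventually λ n → seq y n ℚ.+ δ ℚ.< seq x n
    gap = M , λ n n≥M → begin-strict
      seq y n ℚ.+ δ                       <⟨ ℚₚ.+-monoˡ-< δ (∣p-q∣<ε⇒p<q+ε {seq y n} {seq y m} (proj₂ Y n m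
                                               (ℕₚ.m⊔n≤o⇒n≤o (proj₁ X) _ n≥M) (ℕₚ.m⊔n≤o⇒n≤o (proj₁ X) _ m≥M))) ⟩
      (seq y m ℚ.+ η) ℚ.+ δ               ≡⟨ trans (cong (λ d → (seq y m ℚ.+ η) ℚ.+ d) (sym (halves δ)))
                                               (solve 2 (λ y e → (y :+ e) :+ (e :+ e) := ((y :+ (e :+ e)) :+ (e :+ e)) :- e) refl (seq y m) η) ⟩
      ((seq y m ℚ.+ (η ℚ.+ η)) ℚ.+ (η ℚ.+ η)) ℚ.- η
                                          ≡⟨ cong (λ d → ((seq y m ℚ.+ d) ℚ.+ d) ℚ.- η) (halves δ) ⟩
      ((seq y m ℚ.+ δ) ℚ.+ δ) ℚ.- η       ≡⟨ cong (ℚ._- η) (+-halves (seq y m) ε) ⟩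
      (seq y m ℚ.+ ε) ℚ.- η               ≤⟨ ℚₚ.+-monoˡ-≤ (ℚ.- η) yₘ+ε≤xₘ ⟩
      seq x m ℚ.- η                       <⟨ p<q+ε⇒p-q<ε′ {seq x m} {seq x n} (∣p-q∣<ε⇒p<q+ε {seq x m} {seq x n} (proj₂ X m n
                                               (ℕₚ.m⊔n≤o⇒m≤o _ (proj₁ Y) m≥M) (ℕₚ.m⊔n≤o⇒m≤o _ (proj₁ Y) n≥M))) ⟩
      seq x n                             ∎
      where
      open ℚₚ.≤-Reasoning
      p<q+ε⇒p-q<ε′ : ∀ {p q ε} → p ℚ.< q ℚ.+ ε → p ℚ.- ε ℚ.< q
      p<q+ε⇒p-q<ε′ {p} {q} {ε} h = subst (p ℚ.- ε ℚ.<_)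
        (solve 2 (λ q ε → (q :+ ε) :- ε := q) refl q ε) (ℚₚ.+-monoˡ-< (ℚ.- ε) h)

  p<p+ε : ∀ p {ε} → 0ℚ ℚ.< ε → p ℚ.< p ℚ.+ ε
  p<p+ε p {ε} ε>0 = subst (ℚ._< p ℚ.+ ε) (ℚₚ.+-identityʳ p) (ℚₚ.+-monoʳ-< p ε>0)

  ≤-totalʳ : ∀ x y → x ≤ y ⊎ y ≤ x
  ≤-totalʳ x y with em {x ≤ y}
  ... | yes x≤y = inj₁ x≤y
  ... | no  x≰y = inj₂ (gap⇒≤ (≰⇒gap x y x≰y))
    where
    gap⇒≤ : ≤-Gap y x → y ≤ x
    gap⇒≤ (δ , δ>0 , gap) ε ε>0 = eventually₁ gap λ n yₙ+δ<xₙ →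
      ℚₚ.<-trans (p<p+ε (seq y n) δ>0) (ℚₚ.<-trans yₙ+δ<xₙ (p<p+ε (seq x n) ε>0))

  -- For p ≥ 0 the error of q is amplified by p ≤ B, and for -δ < p < 0 the
  -- factor q ≤ B is amplified by δ.
  almost-nonNeg : ∀ {p q B δ} → 0ℚ ℚ.< B → 0ℚ ℚ.< δ → p ℚ.≤ B → q ℚ.≤ B →
                  0ℚ ℚ.< p ℚ.+ δ → 0ℚ ℚ.< q ℚ.+ δ → 0ℚ ℚ.≤ p ℚ.* q ℚ.+ B ℚ.* δ
  almost-nonNeg {p} {q} {B} {δ} B>0 δ>0 p≤B q≤B p+δ>0 q+δ>0 with ℚₚ.≤-total 0ℚ p
  ... | inj₁ 0≤p = begin
      0ℚ                        ≡⟨ ℚₚ.*-zeroʳ p ⟨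
      p ℚ.* 0ℚ                  ≤⟨ ℚₚ.*-monoˡ-≤-nonNeg p {{ℚ.nonNegative 0≤p}} (ℚₚ.<⇒≤ q+δ>0) ⟩
      p ℚ.* (q ℚ.+ δ)           ≡⟨ ℚₚ.*-distribˡ-+ p q δ ⟩
      p ℚ.* q ℚ.+ p ℚ.* δ       ≤⟨ ℚₚ.+-monoʳ-≤ (p ℚ.* q) (ℚₚ.*-monoʳ-≤-nonNeg δ {{ℚ.nonNegative (ℚₚ.<⇒≤ δ>0)}} p≤B) ⟩
      p ℚ.* q ℚ.+ B ℚ.* δ       ∎
    where open ℚₚ.≤-Reasoning
  ... | inj₂ p≤0 = begin
      0ℚ                        ≡⟨ ℚₚ.*-zeroʳ B ⟨
      B ℚ.* 0ℚ                  ≤⟨ ℚₚ.*-monoˡ-≤-nonNeg B {{ℚ.nonNegative (ℚₚ.<⇒≤ B>0)}} (ℚₚ.<⇒≤ p+δ>0) ⟩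
      B ℚ.* (p ℚ.+ δ)           ≡⟨ solve 3 (λ B p δ → B :* (p :+ δ) := p :* B :+ B :* δ) refl B p δ ⟩
      p ℚ.* B ℚ.+ B ℚ.* δ       ≤⟨ ℚₚ.+-monoˡ-≤ (B ℚ.* δ) (ℚₚ.*-monoˡ-≤-nonPos p {{ℚ.nonPositive p≤0}} q≤B) ⟩
      p ℚ.* q ℚ.+ B ℚ.* δ       ∎
    where open ℚₚ.≤-Reasoning

  *-nonNegʳ : ∀ x y → 0ℝ ≤ x → 0ℝ ≤ y → 0ℝ ≤ x * y
  *-nonNegʳ x y 0≤x 0≤y ε ε>0 with bounded (seq x) (cauchy x) | bounded (seq y) (cauchy y)
  ... | A , A>0 , x≤A | B , B>0 , y≤B with scale (A ℚ.+ B) (½ ℚ.* ε) (ℚₚ.+-mono-< A>0 B>0) (half-pos ε>0)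
  ...   | δ , δ>0 , e = eventually₂ (0≤x δ δ>0) (0≤y δ δ>0) (λ n a b → begin-strict
      0ℚ                                               ≤⟨ almost-nonNeg (ℚₚ.+-mono-< A>0 B>0) δ>0
        (ℚₚ.≤-trans (≤A n) (subst (ℚ._≤ A ℚ.+ B) (ℚₚ.+-identityʳ A) (ℚₚ.+-monoʳ-≤ A (ℚₚ.<⇒≤ B>0))))
        (ℚₚ.≤-trans (≤B n) (subst (ℚ._≤ A ℚ.+ B) (ℚₚ.+-identityˡ B) (ℚₚ.+-monoˡ-≤ B (ℚₚ.<⇒≤ A>0)))) a b ⟩
      seq x n ℚ.* seq y n ℚ.+ (A ℚ.+ B) ℚ.* δ          ≡⟨ cong (seq x n ℚ.* seq y n ℚ.+_) e ⟩
      seq x n ℚ.* seq y n ℚ.+ ½ ℚ.* ε                  <⟨ p<p+ε (seq x n ℚ.* seq y n ℚ.+ ½ ℚ.* ε) (half-pos ε>0) ⟩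
      seq x n ℚ.* seq y n ℚ.+ ½ ℚ.* ε ℚ.+ ½ ℚ.* ε      ≡⟨ +-halves (seq x n ℚ.* seq y n) ε ⟩
      seq x n ℚ.* seq y n ℚ.+ ε                        ∎)
    where
    open ℚₚ.≤-Reasoning
    ≤A : ∀ n → seq x n ℚ.≤ A
    ≤A n = ℚₚ.≤-trans (p≤∣p∣ (seq x n)) (x≤A n)
    ≤B : ∀ n → seq y n ℚ.≤ B
    ≤B n = ℚₚ.≤-trans (p≤∣p∣ (seq y n)) (y≤B n)

  -- Eventually x stays above some δ > 0, so a bound δε on the product is a bound ε on y.
  positive-cancel : ∀ x y → ¬ x ≤ 0ℝ → x * y ≈ 0ℝ → y ≈ 0ℝ
  positive-cancel x y x≰0 xy≈0 ε ε>0 = cancel (≰⇒gap x 0ℝ x≰0)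
    where
    open ℚₚ.≤-Reasoning
    cancel : ≤-Gap 0ℝ x → Eventually λ n → ∣ seq y n ℚ.- 0ℚ ∣ ℚ.< ε
    cancel (δ , δ>0 , gap) = eventually₂ gap (xy≈0 (δ ℚ.* ε) (subst (ℚ._< δ ℚ.* ε) (ℚₚ.*-zeroʳ δ)
        (ℚₚ.*-monoʳ-<-pos δ {{ℚ.positive δ>0}} ε>0))) (λ n 0+δ<x ∣xy∣<δε →
      ℚₚ.*-cancelˡ-<-nonNeg δ {{ℚ.nonNegative (ℚₚ.<⇒≤ δ>0)}} (begin-strict
      δ ℚ.* ∣ seq y n ℚ.- 0ℚ ∣           ≡⟨ cong (λ d → δ ℚ.* ∣ d ∣) (ℚₚ.+-identityʳ (seq y n)) ⟩
      δ ℚ.* ∣ seq y n ∣                  ≤⟨ ℚₚ.*-monoʳ-≤-nonNeg ∣ seq y n ∣ {{ℚₚ.∣-∣-nonNeg (seq y n)}}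
                                              (ℚₚ.<⇒≤ (subst (ℚ._< seq x n) (ℚₚ.+-identityˡ δ) 0+δ<x)) ⟩
      seq x n ℚ.* ∣ seq y n ∣            ≤⟨ ℚₚ.*-monoʳ-≤-nonNeg ∣ seq y n ∣ {{ℚₚ.∣-∣-nonNeg (seq y n)}} (p≤∣p∣ (seq x n)) ⟩
      ∣ seq x n ∣ ℚ.* ∣ seq y n ∣        ≡⟨ ℚₚ.∣p*q∣≡∣p∣*∣q∣ (seq x n) (seq y n) ⟨
      ∣ seq x n ℚ.* seq y n ∣            ≡⟨ cong ∣_∣ (ℚₚ.+-identityʳ (seq x n ℚ.* seq y n)) ⟨
      ∣ seq x n ℚ.* seq y n ℚ.- 0ℚ ∣     <⟨ ∣xy∣<δε ⟩
      δ ℚ.* ε                            ∎))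

  open CommutativeRing ℝ-commutativeRing using () renaming (trans to ≈-trans)

  zero-productʳ : ∀ x y → x * y ≈ 0ℝ → x ≈ 0ℝ ⊎ y ≈ 0ℝ
  zero-productʳ x y xy≈0 with em {x ≤ 0ℝ} | em {0ℝ ≤ x}
  ... | no x≰0  | _       = inj₂ (positive-cancel x y x≰0 xy≈0)
  ... | yes x≤0 | yes 0≤x = inj₁ (≤-antisymʳ {x} {0ℝ} x≤0 0≤x)
  ... | yes x≤0 | no 0≰x  = inj₂ (positive-cancel (- x) y -x≰0
      (≈-trans {(- x) * y} {(- 1ℝ) * (x * y)} {0ℝ}
        (pointwise-≈ {(- x) * y} {(- 1ℝ) * (x * y)} λ n →
          solve 2 (λ x y → (con (ℚ.- 1ℚ) :* x) :* y := (con (ℚ.- 1ℚ) :* con 1ℚ) :* (x :* y)) refl (seq x n) (seq y n))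
        (*-null (- 1ℝ) (x * y) xy≈0)))
    where
    -x≰0 : ¬ - x ≤ 0ℝ
    -x≰0 h = 0≰x λ ε ε>0 → eventually₁ (h ε ε>0) (λ n a → begin-strict
      0ℚ                                            ≡⟨ ℚₚ.+-inverseʳ (seq (- x) n) ⟨
      seq (- x) n ℚ.- seq (- x) n                   <⟨ ℚₚ.+-monoˡ-< (ℚ.- seq (- x) n) a ⟩
      (0ℚ ℚ.+ ε) ℚ.- seq (- x) n                    ≡⟨ solve 2 (λ x ε → (con 0ℚ :+ ε) :- con (ℚ.- 1ℚ) :* x := x :+ ε) refl (seq x n) ε ⟩
      seq x n ℚ.+ ε                                 ∎)
      where open ℚₚ.≤-Reasoning

  /1-+ : ∀ i j → (i ℤ.+ j) ℚ./ 1 ≡ i ℚ./ 1 ℚ.+ j ℚ./ 1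
  /1-+ i j = ℚₚ.toℚᵘ-injective (ℚᵘₚ.≃-trans (ℚₚ.toℚᵘ-fromℚᵘ (ℚᵘ.mkℚᵘ (i ℤ.+ j) 0)) (ℚᵘₚ.≃-sym
    (ℚᵘₚ.≃-trans (ℚₚ.toℚᵘ-homo-+ (i ℚ./ 1) (j ℚ./ 1))
      (ℚᵘₚ.≃-trans (ℚᵘₚ.+-cong (ℚₚ.toℚᵘ-fromℚᵘ (ℚᵘ.mkℚᵘ i 0)) (ℚₚ.toℚᵘ-fromℚᵘ (ℚᵘ.mkℚᵘ j 0)))
        (ℚᵘ.*≡* (cong (ℤ._* + 1) (cong₂ ℤ._+_ (ℤₚ.*-identityʳ i) (ℤₚ.*-identityʳ j))))))))

  /1-* : ∀ i j → (i ℤ.* j) ℚ./ 1 ≡ (i ℚ./ 1) ℚ.* (j ℚ./ 1)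
  /1-* i j = ℚₚ.toℚᵘ-injective (ℚᵘₚ.≃-trans (ℚₚ.toℚᵘ-fromℚᵘ (ℚᵘ.mkℚᵘ (i ℤ.* j) 0)) (ℚᵘₚ.≃-sym
    (ℚᵘₚ.≃-trans (ℚₚ.toℚᵘ-homo-* (i ℚ./ 1) (j ℚ./ 1))
      (ℚᵘₚ.*-cong (ℚₚ.toℚᵘ-fromℚᵘ (ℚᵘ.mkℚᵘ i 0)) (ℚₚ.toℚᵘ-fromℚᵘ (ℚᵘ.mkℚᵘ j 0))))))

  ceiling : ∀ q → ∃[ n ] q ℚ.≤ + n ℚ./ 1
  ceiling q@record{} = ℤ.∣ ℚ.↥ q ∣ , ℚₚ.toℚᵘ-cancel-≤ (ℚᵘₚ.≤-respʳ-≃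
    (ℚᵘₚ.≃-sym (ℚₚ.toℚᵘ-fromℚᵘ (ℚᵘ.mkℚᵘ (+ ℤ.∣ ℚ.↥ q ∣) 0))) (ℚᵘ.*≤* bound))
    where
    ≤∣∣ : ∀ i → i ℤ.≤ + ℤ.∣ i ∣
    ≤∣∣ (+ n)    = ℤₚ.≤-refl
    ≤∣∣ -[1+ n ] = ℤ.-≤+
    bound : ℚ.↥ q ℤ.* + 1 ℤ.≤ + ℤ.∣ ℚ.↥ q ∣ ℤ.* ℚ.↧ q
    bound = ℤₚ.≤-trans (ℤₚ.≤-reflexive (ℤₚ.*-identityʳ (ℚ.↥ q))) (ℤₚ.≤-trans (≤∣∣ (ℚ.↥ q))
      (subst (ℤ._≤ + ℤ.∣ ℚ.↥ q ∣ ℤ.* ℚ.↧ q) (ℤₚ.*-identityʳ (+ ℤ.∣ ℚ.↥ q ∣))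
        (ℤₚ.*-monoˡ-≤-nonNeg (+ ℤ.∣ ℚ.↥ q ∣) (ℤ.+≤+ (ℕ.s≤s ℕ.z≤n)))))

  -- The sequence of x is bounded by some B and that of y eventually exceeds some δ > 0, so any
  -- integer above B/δ serves.
  archimedeanʳ : ∀ x y → ¬ y ≤ 0ℝ → ∃[ n ] x ≤ fromℤ (+ n) * y
  archimedeanʳ x y y≰0 = multiple (≰⇒gap y 0ℝ y≰0) (bounded (seq x) (cauchy x))
    where
    open ℚₚ.≤-Reasoning
    multiple : ≤-Gap 0ℝ y → (∃[ B ] 0ℚ ℚ.< B × (∀ m → ∣ seq x m ∣ ℚ.≤ B)) → ∃[ n ] x ≤ fromℤ (+ n) * y
    multiple (δ , δ>0 , gap) (B , B>0 , x≤B) with scale δ B δ>0 B>0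
    ... | q , q>0 , δq≡B with ceiling q
    ...   | n , q≤n = n , λ ε ε>0 → eventually₁ gap (λ m 0+δ<y → begin-strict
      seq x m                              ≤⟨ p≤∣p∣ (seq x m) ⟩
      ∣ seq x m ∣                          ≤⟨ x≤B m ⟩
      B                                    ≡⟨ δq≡B ⟨
      δ ℚ.* q                              ≡⟨ ℚₚ.*-comm δ q ⟩
      q ℚ.* δ                              ≤⟨ ℚₚ.*-monoˡ-≤-nonNeg q {{ℚ.nonNegative (ℚₚ.<⇒≤ q>0)}} (ℚₚ.<⇒≤ (δ<y m 0+δ<y)) ⟩
      q ℚ.* seq y m                        ≤⟨ ℚₚ.*-monoʳ-≤-nonNeg (seq y m)
                                                {{ℚ.nonNegative (ℚₚ.<⇒≤ (ℚₚ.<-trans δ>0 (δ<y m 0+δ<y)))}} q≤n ⟩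
      (+ n ℚ./ 1) ℚ.* seq y m              <⟨ p<p+ε ((+ n ℚ./ 1) ℚ.* seq y m) ε>0 ⟩
      (+ n ℚ./ 1) ℚ.* seq y m ℚ.+ ε        ∎)
      where
      δ<y : ∀ m → 0ℚ ℚ.+ δ ℚ.< seq y m → δ ℚ.< seq y m
      δ<y m = subst (ℚ._< seq y m) (ℚₚ.+-identityˡ δ)

  ℝ-orderedDomain : OrderedDomain
  ℝ-orderedDomain = record
    { commutativeRing = ℝ-commutativeRing
    ; _≤_ = _≤_
    ; ≤-reflexive = λ {x} {y} → ≈⇒≤ {x} {y}
    ; ≤-trans = λ {x} {y} {z} → ≤-transʳ {x} {y} {z}
    ; ≤-antisym = λ {x} {y} → ≤-antisymʳ {x} {y}
    ; ≤-total = ≤-totalʳ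
    ; _≟_ = λ _ _ → em
    ; +-mono-≤ = λ {x} {y} {u} {v} → +-mono-≤ʳ {x} {y} {u} {v}
    ; *-nonNeg = λ {x} {y} → *-nonNegʳ x y
    ; zero-product = λ {x} {y} → zero-productʳ x y
    ; 1≉0 = λ h → let N , k = h ½ (ℚₚ.positive⁻¹ ½) in ℚₚ.<-asym (k N ℕₚ.≤-refl) (ℚ.*<* (ℤ.+<+ (ℕ.s≤s (ℕ.s≤s ℕ.z≤n))))
    ; ι = fromℤ
    ; ι-+ = λ i j → pointwise-≈ {fromℤ (i ℤ.+ j)} {fromℤ i + fromℤ j} λ _ → /1-+ i j
    ; ι-* = λ i j → pointwise-≈ {fromℤ (i ℤ.* j)} {fromℤ i * fromℤ j} λ _ → /1-* i j
    ; ι-1 = pointwise-≈ {fromℤ (+ 1)} {1ℝ} λ _ → refl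
    ; archimedean = λ x {y} → archimedeanʳ x y
    }

-- Integer affine forms, translations and staircases

module Lattice where
  open ≡ using (refl; sym; trans; cong; cong₂; subst)
  open +-*-Solver using (solve; _:=_; _:+_; _:-_; _:*_; :-_; con)

  private
    variable
      k n : ℕ

  infix 4 _≟ₚ_
  _≟ₚ_ : (p q : LatticePoint n) → Dec (p ≡ q)
  _≟ₚ_ = Vecₚ.≡-dec ℤₚ._≟_

  open module DecMem {n} = DecMembership (_≟ₚ_ {n}) public using (_∈?_)

  dot : Vec ℤ n → Vec ℤ n → ℤ
  dot []       []       = 0ℤ
  dot (a ∷ as) (x ∷ xs) = a ℤ.* x ℤ.+ dot as xs

  -- An integer affine form is a vector: the constant term, then the linear
  -- coefficients. It is evaluated at p as the dot product with 1 ∷ p.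
  Form : ℕ → Set
  Form n = Vec ℤ (suc n)

  eval : Form n → LatticePoint n → ℤ
  eval f p = dot f (1ℤ ∷ p)

  eval-+ : ∀ d c (a : Vec ℤ n) p → eval ((c ℤ.+ d) ∷ a) p ≡ eval (c ∷ a) p ℤ.+ d
  eval-+ d c a p = solve 3 (λ c d x → (c :+ d) :* con 1ℤ :+ x := (c :* con 1ℤ :+ x) :+ d) refl c d (dot a p)

  negate : Vec ℤ n → Vec ℤ n
  negate p = Vec.map ℤ.-_ p

  dot-neg : ∀ (a x : Vec ℤ n) → dot (negate a) x ≡ ℤ.- dot a x
  dot-neg []       []       = refl
  dot-neg (a ∷ as) (x ∷ xs) = trans (cong (λ d → ℤ.- a ℤ.* x ℤ.+ d) (dot-neg as xs))
    (solve 3 (λ a x d → :- a :* x :+ :- d := :- (a :* x :+ d)) refl a x (dot as xs))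

  dot-0 : ∀ (x : Vec ℤ n) → dot (Vec.replicate n 0ℤ) x ≡ 0ℤ
  dot-0 []       = refl
  dot-0 (x ∷ xs) = trans (ℤₚ.+-identityˡ _) (dot-0 xs)

  infixl 6 _⊕_ _⊖_
  _⊕_ _⊖_ : LatticePoint n → LatticePoint n → LatticePoint n
  _⊕_ = Vec.zipWith ℤ._+_
  _⊖_ = Vec.zipWith ℤ._-_

  ⊖-⊕ : ∀ (p v : LatticePoint n) → (p ⊖ v) ⊕ v ≡ p
  ⊖-⊕ []       []       = refl
  ⊖-⊕ (p ∷ ps) (v ∷ vs) = cong₂ _∷_ (solve 2 (λ p v → (p :- v) :+ v := p) refl p v) (⊖-⊕ ps vs)

  ⊕-⊖ : ∀ (p v : LatticePoint n) → (p ⊕ v) ⊖ v ≡ p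
  ⊕-⊖ []       []       = refl
  ⊕-⊖ (p ∷ ps) (v ∷ vs) = cong₂ _∷_ (solve 2 (λ p v → (p :+ v) :- v := p) refl p v) (⊕-⊖ ps vs)

  ⊕-assoc : ∀ (p u v : LatticePoint n) → (p ⊕ u) ⊕ v ≡ p ⊕ (u ⊕ v)
  ⊕-assoc = Vecₚ.zipWith-assoc ℤₚ.+-assoc

  dot-⊕ : ∀ (a p v : LatticePoint n) → dot a (p ⊕ v) ≡ dot a p ℤ.+ dot a v
  dot-⊕ []       []       []       = refl
  dot-⊕ (a ∷ as) (p ∷ ps) (v ∷ vs) = trans (cong (λ d → a ℤ.* (p ℤ.+ v) ℤ.+ d) (dot-⊕ as ps vs))
    (solve 5 (λ a p v x y → a :* (p :+ v) :+ (x :+ y) := (a :* p :+ x) :+ (a :* v :+ y)) refl a p v (dot as ps) (dot as vs))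

  suc-neg-suc : ∀ k → ℤ.- k ≡ ℤ.suc (ℤ.- ℤ.suc k)
  suc-neg-suc = solve 1 (λ k → :- k := con 1ℤ :+ :- (con 1ℤ :+ k)) refl

  -- Staircases over a sorted simplex

  stair : ℤ → Fin k → Vec (LatticePoint n) k → Vec (LatticePoint (suc n)) (suc k)
  stair z zero    (w ∷ ws) = (z ∷ w) ∷ (ℤ.suc z ∷ w) ∷ Vec.map (ℤ.suc z ∷_) ws
  stair z (suc i) (w ∷ ws) = (z ∷ w) ∷ stair z i ws

  All-stair : ∀ {P : LatticePoint (suc n) → Set} z (i : Fin k) {ws : Vec (LatticePoint n) k} →
              All (λ w → P (z ∷ w)) ws → All (λ w → P (ℤ.suc z ∷ w)) ws → All P (stair z i ws)
  All-stair z zero    (p ∷ _)  (q ∷ qs) = p ∷ q ∷ Allₚ.map⁺ qs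
  All-stair z (suc i) (p ∷ ps) (_ ∷ qs) = p ∷ All-stair z i ps qs

  ∈-All : ∀ {A : Set} {k} (xs : Vec A k) → All (_∈ xs) xs
  ∈-All []       = []
  ∈-All (x ∷ xs) = here refl ∷ All.map there (∈-All xs)

  Between : ℤ → LatticePoint (suc n) → Set
  Between z p = z ℤ.≤ Vec.head p × Vec.head p ℤ.≤ ℤ.suc z

  stair-tail : ∀ z (i : Fin k) (ws : Vec (LatticePoint n) k) {p} → p ∈ stair z i ws → Vec.tail p ∈ ws
  stair-tail z i ws = All.lookup (All-stair {P = λ p → Vec.tail p ∈ ws} z i (∈-All ws) (∈-All ws))

  stair-Between : ∀ z (i : Fin k) (ws : Vec (LatticePoint n) k) {p} → p ∈ stair z i ws → Between z p
  stair-Between z i ws = All.lookup (All-stair {P = Between z} z i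
    (All.universal (λ _ → ℤₚ.≤-refl , ℤₚ.i≤suc[i] z) ws) (All.universal (λ _ → ℤₚ.i≤suc[i] z , ℤₚ.≤-refl) ws))

  translate-stair : ∀ y v z (i : Fin k) (ws : Vec (LatticePoint n) k) →
                    Vec.map (_⊕ (y ∷ v)) (stair z i ws) ≡ stair (z ℤ.+ y) i (Vec.map (_⊕ v) ws)
  translate-stair y v z zero (w ∷ ws) = cong₂ _∷_ refl (cong₂ _∷_ (cong (_∷ w ⊕ v) (ℤₚ.+-assoc 1ℤ z y))
    (trans (sym (Vecₚ.map-∘ (_⊕ (y ∷ v)) (ℤ.suc z ∷_) ws)) (trans
      (Vecₚ.map-cong (λ w → cong (_∷ w ⊕ v) (ℤₚ.+-assoc 1ℤ z y)) ws) (Vecₚ.map-∘ (ℤ.suc (z ℤ.+ y) ∷_) (_⊕ v) ws))))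
  translate-stair y v z (suc i) (w ∷ ws) = cong (_ ∷_) (translate-stair y v z i ws)

  suc[z]-z : ∀ z → ℤ.suc z ℤ.- z ≡ 1ℤ
  suc[z]-z z = trans (ℤₚ.+-assoc 1ℤ z (ℤ.- z)) (cong ℤ.suc (ℤₚ.+-inverseʳ z))

  z<suc[z] : ∀ z → z ℤ.< ℤ.suc z
  z<suc[z] z = ℤₚ.suc[i]≤j⇒i<j ℤₚ.≤-refl

  module _ (_⊏_ : LatticePoint n → LatticePoint n → Set) where

    -- Lexicographic with the base first: a staircase lists its vertices in this order.
    Above : LatticePoint (suc n) → LatticePoint (suc n) → Set
    Above p q = (Vec.tail p ⊏ Vec.tail q) ⊎ (Vec.tail p ≡ Vec.tail q × Vec.head p ℤ.< Vec.head q)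

    stair-sorted : ∀ z (i : Fin k) {ws} → AllPairs _⊏_ ws → AllPairs Above (stair z i ws)
    stair-sorted z zero {w ∷ ws} (h ∷ hs) = (inj₂ (refl , z<suc[z] z) ∷ Allₚ.map⁺ (All.map inj₁ h))
      ∷ Allₚ.map⁺ (All.map inj₁ h) ∷ level hs
      where
      level : ∀ {j} {ws : Vec _ j} → AllPairs _⊏_ ws → AllPairs Above (Vec.map (ℤ.suc z ∷_) ws)
      level []       = []
      level (h ∷ hs) = Allₚ.map⁺ (All.map inj₁ h) ∷ level hs
    stair-sorted z (suc i) (h ∷ hs) = All-stair z i (All.map inj₁ h) (All.map inj₁ h) ∷ stair-sorted z i hs

    -- The lower level carries the vertices up to the turn and the upper level those from the turn
    -- on. This comparability of bottom with top is what makes weights unique on staircases.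
    stair-climb : ∀ z (i : Fin k) {ws} → AllPairs _⊏_ ws → ∀ {p q} → p ∈ stair z i ws → q ∈ stair z i ws →
                  Vec.head p ℤ.< Vec.head q → Vec.tail p ≡ Vec.tail q ⊎ (Vec.tail p ⊏ Vec.tail q)
    stair-climb z i {w ∷ ws} (h ∷ hs) p∈ q∈ p<q = go i p∈ q∈
      where
      first : ∀ {v} → v ∈ (w ∷ ws) → w ≡ v ⊎ (w ⊏ v)
      first (here e)   = inj₁ (sym e)
      first (there q∈) = inj₂ (All.lookup h q∈)
      go : ∀ i → _ ∈ stair z i (w ∷ ws) → _ ∈ stair z i (w ∷ ws) → _
      go zero (here refl) q∈ = first (stair-tail z zero (w ∷ ws) q∈)
      go zero (there p∈) q∈ = contradiction p<q (ℤₚ.≤⇒≯ (ℤₚ.≤-trans (proj₂ (stair-Between z zero (w ∷ ws) q∈))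
        (ℤₚ.≤-reflexive (sym (All.lookup {P = λ p → Vec.head p ≡ ℤ.suc z} (refl ∷ Allₚ.map⁺ (All.universal (λ _ → refl) ws)) p∈)))))
      go (suc i) (here refl) q∈ = first (stair-tail z (suc i) (w ∷ ws) q∈)
      go (suc i) (there p∈) (here refl) = contradiction p<q (ℤₚ.≤⇒≯ (proj₁ (stair-Between z i ws p∈)))
      go (suc i) (there p∈) (there q∈) = stair-climb z i hs p∈ q∈ p<q

  -- Turning at the last vertex leaves all of `ws` on the lower level, so this staircase has the
  -- given simplex as a facet.
  stair-bottom : ∀ z (ws : Vec (LatticePoint n) (suc k)) {w} → w ∈ ws → z ∷ w ∈ stair z (fromℕ k) ws
  stair-bottom {k = zero}  z (w ∷ [])     (here refl) = here refl
  stair-bottom {k = suc k} z (w ∷ ws)     (here refl) = here refl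
  stair-bottom {k = suc k} z (w ∷ ws)     (there w∈)  = there (stair-bottom z ws w∈)

  stair-turn : ∀ z (ws : Vec (LatticePoint n) k) {w} (w∈ : w ∈ ws) →
               z ∷ w ∈ stair z (Any.index w∈) ws × ℤ.suc z ∷ w ∈ stair z (Any.index w∈) ws
  stair-turn z (w ∷ ws) (here refl) = here refl , there (here refl)
  stair-turn z (w ∷ ws) (there w∈)  = there (proj₁ (stair-turn z ws w∈)) , there (proj₂ (stair-turn z ws w∈))

  -- All that follows the turn at p lies on the upper level, and asymmetry rules out that q precedes
  -- p.
  stair-top : ∀ {_⊏_ : LatticePoint n → LatticePoint n → Set} → (∀ {p q} → p ⊏ q → ¬ q ⊏ p) →
              ∀ z {ws : Vec (LatticePoint n) k} → AllPairs _⊏_ ws → ∀ {p q} (p∈ : p ∈ ws) → q ∈ ws → p ⊏ q →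
              ℤ.suc z ∷ q ∈ stair z (Any.index p∈) ws
  stair-top asym z (h ∷ hs) (here refl) (here refl) p⊏q = there (here refl)
  stair-top asym z (h ∷ hs) (here refl) (there q∈)  p⊏q = there (there (∈-map⁺ (ℤ.suc z ∷_) q∈))
  stair-top asym z (h ∷ hs) (there p∈)  (here refl) p⊏q = contradiction (All.lookup h p∈) (asym p⊏q)
  stair-top asym z (h ∷ hs) (there p∈)  (there q∈)  p⊏q = there (stair-top asym z hs p∈ q∈ p⊏q)

  next : Fin 3 → Fin 3
  next zero             = suc zero
  next (suc zero)       = suc (suc zero)
  next (suc (suc zero)) = zero

-- The 24 cells in dimension 4 and their integer certificates

module Cells where
  open ≡ using (refl; sym; trans; cong; cong₂; subst)
  open Lattice

  -- A point (a , b , c , d) stands for the 3 × 3 matrix with zero line sums whose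
  -- upper left block is (a b ; c d). The hyperplanes "entry ∈ ℤ" cut the space of
  -- these matrices into 18 simplices and 2 copies of the Birkhoff polytope per unit
  -- cell. A Birkhoff polytope is the free sum of the triangles of even and of odd
  -- permutation matrices, and is cut into three simplices by omitting one even
  -- permutation at a time.

  pattern O   = + 0
  pattern I   = + 1
  pattern II  = + 2
  pattern III = + 3
  pattern N   = -[1+ 0 ]
  pattern NN  = -[1+ 1 ]
  pattern NNN = -[1+ 2 ]

  v : ℤ → ℤ → ℤ → ℤ → LatticePoint 4
  v a b c d = a ∷ b ∷ c ∷ d ∷ []

  f : ℤ → ℤ → ℤ → ℤ → ℤ → Form 4
  f k a b c d = k ∷ a ∷ b ∷ c ∷ d ∷ []

  cells : Vec (VertexTuple 4) 24
  cells =
    ((v O O O O) ∷ (v I O O O) ∷ (v O O O I) ∷ (v O I O O) ∷ (v O O I O) ∷ []) ∷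
    ((v I O O O) ∷ (v O O O I) ∷ (v I O O I) ∷ (v O I O O) ∷ (v O I I O) ∷ []) ∷
    ((v I O O O) ∷ (v O O O I) ∷ (v O O I O) ∷ (v I O O I) ∷ (v O I I O) ∷ []) ∷
    ((v I O O O) ∷ (v O O O I) ∷ (v O I O O) ∷ (v O O I O) ∷ (v O I I O) ∷ []) ∷
    ((v O O O I) ∷ (v I O O I) ∷ (v O I O O) ∷ (v O I O I) ∷ (v O I I O) ∷ []) ∷
    ((v I O O O) ∷ (v O O I O) ∷ (v I O O I) ∷ (v I O I O) ∷ (v O I I O) ∷ []) ∷
    ((v O O O I) ∷ (v O O I O) ∷ (v I O O I) ∷ (v O O I I) ∷ (v O I I O) ∷ []) ∷
    ((v O O O I) ∷ (v I O O I) ∷ (v O I O I) ∷ (v O O I I) ∷ (v O I I O) ∷ []) ∷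
    ((v I O O I) ∷ (v O I O I) ∷ (v O O I I) ∷ (v O I I O) ∷ (v O I I I) ∷ []) ∷
    ((v O O I O) ∷ (v I O O I) ∷ (v I O I O) ∷ (v O O I I) ∷ (v O I I O) ∷ []) ∷
    ((v I O O I) ∷ (v I O I O) ∷ (v O O I I) ∷ (v I O I I) ∷ (v O I I O) ∷ []) ∷
    ((v I O O I) ∷ (v O O I I) ∷ (v I O I I) ∷ (v O I I O) ∷ (v O I I I) ∷ []) ∷
    ((v I O O O) ∷ (v I O O I) ∷ (v O I O O) ∷ (v I I O O) ∷ (v O I I O) ∷ []) ∷
    ((v I O O I) ∷ (v O I O O) ∷ (v I I O O) ∷ (v O I O I) ∷ (v O I I O) ∷ []) ∷
    ((v I O O I) ∷ (v I I O O) ∷ (v O I O I) ∷ (v O I I O) ∷ (v I I O I) ∷ []) ∷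
    ((v I O O O) ∷ (v I O O I) ∷ (v I I O O) ∷ (v I O I O) ∷ (v O I I O) ∷ []) ∷
    ((v I O O I) ∷ (v I I O O) ∷ (v I O I O) ∷ (v O I I O) ∷ (v I I I O) ∷ []) ∷
    ((v I O O I) ∷ (v I I O O) ∷ (v O I I O) ∷ (v I I O I) ∷ (v I I I O) ∷ []) ∷
    ((v I O O I) ∷ (v O I O I) ∷ (v O I I O) ∷ (v I I O I) ∷ (v O I I I) ∷ []) ∷
    ((v I O O I) ∷ (v I O I O) ∷ (v I O I I) ∷ (v O I I O) ∷ (v I I I O) ∷ []) ∷
    ((v I O O I) ∷ (v I I O I) ∷ (v I O I I) ∷ (v I I I O) ∷ (v O I I I) ∷ []) ∷
    ((v I O O I) ∷ (v O I I O) ∷ (v I I O I) ∷ (v I I I O) ∷ (v O I I I) ∷ []) ∷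
    ((v I O O I) ∷ (v I O I I) ∷ (v O I I O) ∷ (v I I I O) ∷ (v O I I I) ∷ []) ∷
    ((v I I O I) ∷ (v I O I I) ∷ (v I I I O) ∷ (v O I I I) ∷ (v I I I I) ∷ []) ∷
    []

  -- Row i holds the barycentric coordinates of cell i. They have integer coefficients because every
  -- cell is unimodular.
  coordinates : Vec (Vec (Form 4) 5) 24
  coordinates =
    ((f I N N N N) ∷ (f O I O O O) ∷ (f O O O O I) ∷ (f O O I O O) ∷ (f O O O I O) ∷ []) ∷
    ((f I O N O N) ∷ (f I N N O O) ∷ (f N I I O I) ∷ (f O O I N O) ∷ (f O O O I O) ∷ []) ∷
    ((f I O O N N) ∷ (f I N O N O) ∷ (f O O N I O) ∷ (f N I O I I) ∷ (f O O I O O) ∷ []) ∷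
    ((f O I O O O) ∷ (f O O O O I) ∷ (f I N O N N) ∷ (f I N N O N) ∷ (f N I I I I) ∷ []) ∷
    ((f I N N O O) ∷ (f O I O O O) ∷ (f I O O N N) ∷ (f N O I O I) ∷ (f O O O I O) ∷ []) ∷
    ((f I O O N N) ∷ (f I N N O O) ∷ (f O O O O I) ∷ (f N I O I O) ∷ (f O O I O O) ∷ []) ∷
    ((f I N O N O) ∷ (f I O N O N) ∷ (f O I O O O) ∷ (f N O O I I) ∷ (f O O I O O) ∷ []) ∷
    ((f II N N N N) ∷ (f O I O O O) ∷ (f N O I O I) ∷ (f N O O I I) ∷ (f I O O O N) ∷ []) ∷
    ((f O I O O O) ∷ (f I N O N O) ∷ (f I N N O O) ∷ (f I O O O N) ∷ (f NN I I I I) ∷ []) ∷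
    ((f II N N N N) ∷ (f I O O N O) ∷ (f N I O I O) ∷ (f N O O I I) ∷ (f O O I O O) ∷ []) ∷
    ((f I O O N O) ∷ (f I O N O N) ∷ (f I N N O O) ∷ (f NN I I I I) ∷ (f O O I O O) ∷ []) ∷
    ((f I O O N O) ∷ (f I N N O O) ∷ (f N I O I O) ∷ (f I O O O N) ∷ (f N O I O I) ∷ []) ∷
    ((f I O N O N) ∷ (f O O O O I) ∷ (f I N O N O) ∷ (f N I I O O) ∷ (f O O O I O) ∷ []) ∷
    ((f I O N O O) ∷ (f II N N N N) ∷ (f N I I O O) ∷ (f N O I O I) ∷ (f O O O I O) ∷ []) ∷
    ((f I O N O O) ∷ (f I O O N N) ∷ (f I N O N O) ∷ (f O O O I O) ∷ (f NN I I I I) ∷ []) ∷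
    ((f II N N N N) ∷ (f O O O O I) ∷ (f N I I O O) ∷ (f N I O I O) ∷ (f I N O O O) ∷ []) ∷
    ((f O O O O I) ∷ (f I O O N N) ∷ (f I O N O N) ∷ (f I N O O O) ∷ (f NN I I I I) ∷ []) ∷
    ((f I O N O O) ∷ (f I O O N N) ∷ (f I N O O O) ∷ (f N O I O I) ∷ (f N I O I O) ∷ []) ∷
    ((f I O N O O) ∷ (f I N O N O) ∷ (f I O O O N) ∷ (f N I I O O) ∷ (f N O O I I) ∷ []) ∷
    ((f I O O N O) ∷ (f I O N O N) ∷ (f N O O I I) ∷ (f I N O O O) ∷ (f N I I O O) ∷ []) ∷
    ((f III N N N N) ∷ (f NN I I O I) ∷ (f NN I O I I) ∷ (f I O O O N) ∷ (f I N O O O) ∷ []) ∷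
    ((f I O N O O) ∷ (f II N O N N) ∷ (f O O I N O) ∷ (f N I O I O) ∷ (f N O O I I) ∷ []) ∷
    ((f I O O N O) ∷ (f O O N I O) ∷ (f II N N O N) ∷ (f N I I O O) ∷ (f N O I O I) ∷ []) ∷
    ((f I O O N O) ∷ (f I O N O O) ∷ (f I O O O N) ∷ (f I N O O O) ∷ (f NNN I I I I) ∷ []) ∷
    []

  -- The nine entries of the matrix, as functionals of its upper left block; their integer level
  -- sets form the dicing.
  entries : Vec (Vec ℤ 4) 9
  entries = v I O O O ∷ v O I O O ∷ v O O I O ∷ v O O O I ∷ v N N O O ∷ v O O N N ∷ v N O N O ∷ v O N O N ∷ v I I I I ∷ []

  cell : Fin 24 → VertexTuple 4
  cell = lookup cells

  offset : Fin 24 → Fin 9 → ℤ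
  offset i e = Vec.foldr₁ ℤ._⊓_ (Vec.map (dot (lookup entries e)) (cell i))

  -- For a simplex of the tiling the only lattice points of the box are its vertices. For a piece of
  -- a Birkhoff polytope the box is that of the whole polytope, and so has one lattice point too
  -- many.
  InBox : Fin 24 → LatticePoint 4 → Set
  InBox i p = ∀ e → offset i e ℤ.≤ dot (lookup entries e) p × dot (lookup entries e) p ℤ.≤ ℤ.suc (offset i e)

  inBox? : ∀ i p → Dec (InBox i p)
  inBox? i p = Finₚ.all? λ e →
    (offset i e ℤₚ.≤? dot (lookup entries e) p) ×-dec (dot (lookup entries e) p ℤₚ.≤? ℤ.suc (offset i e))

  abstract
    cell-inBox : ∀ i → All (InBox i) (cell i)
    cell-inBox = from-yes (Finₚ.all? λ i → All.all? (inBox? i) (cell i))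

  bit : Fin 2 → ℤ
  bit zero    = O
  bit (suc _) = I

  corner : (a b c d : Fin 2) → LatticePoint 4
  corner a b c d = v (bit a) (bit b) (bit c) (bit d)

  ∀corner? : {P : LatticePoint 4 → Set} → (∀ p → Dec (P p)) → Dec (∀ a b c d → P (corner a b c d))
  ∀corner? P? = Finₚ.all? λ a → Finₚ.all? λ b → Finₚ.all? λ c → Finₚ.all? λ d → P? (corner a b c d)

  -- From an even permutation matrix, or from the complement of one, the other two
  -- are reached by these displacements.
  cycles : Vec (LatticePoint 4 × LatticePoint 4) 6
  cycles = (v N I O N , v N O I N) ∷ (v O N I O , v I N O I) ∷ (v I O N I , v O I N O) ∷
           (v I N O I , v I O N I) ∷ (v O I N O , v N I O N) ∷ (v N O I N , v O N I O) ∷ []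

  abstract
    -- Quantified over the translates of the even triangle because it is applied to a cell whose
    -- position relative to that triangle is arbitrary.
    no-even-triangle : ∀ i → All (λ p → ∀ t → ¬ (p ⊕ proj₁ (lookup cycles t) ∈ cell i × p ⊕ proj₂ (lookup cycles t) ∈ cell i)) (cell i)
    no-even-triangle = from-yes (Finₚ.all? λ i → All.all? (λ p → Finₚ.all? λ t →
      ¬? ((p ⊕ proj₁ (lookup cycles t) ∈? cell i) ×-dec (p ⊕ proj₂ (lookup cycles t) ∈? cell i))) (cell i))

  coordinate : Fin 24 → Fin 5 → Form 4
  coordinate i = lookup (lookup coordinates i)

  δℤ : Fin 5 → Fin 5 → ℤ
  δℤ m m′ with m Finₚ.≟ m′
  ... | yes _ = I
  ... | no  _ = O

  abstract
    coordinate-vertex : ∀ i m m′ → eval (coordinate i m) (lookup (cell i) m′) ≡ δℤ m m′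
    coordinate-vertex = from-yes (Finₚ.all? λ i → Finₚ.all? λ m → Finₚ.all? λ m′ →
      eval (coordinate i m) (lookup (cell i) m′) ℤₚ.≟ δℤ m m′)

  -- Geometrically, the facet of cell i opposite to its m-th vertex cuts that vertex off from all
  -- other lattice points of the box, with p strictly on the far side.
  Separates : Fin 24 → LatticePoint 4 → Fin 5 → Set
  Separates i p m = eval (coordinate i m) p ℤ.< O ×
    (∀ a b c d → InBox i (corner a b c d) → corner a b c d ≢ lookup (cell i) m → eval (coordinate i m) (corner a b c d) ℤ.≤ O)

  separates? : ∀ i p m → Dec (Separates i p m)
  separates? i p m = (eval (coordinate i m) p ℤₚ.<? O) ×-dec ∀corner? λ q →
    inBox? i q →-dec (¬? (q ≟ₚ lookup (cell i) m) →-dec (eval (coordinate i m) q ℤₚ.≤? O))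

  -- Here p is the even permutation, or complement of one, that cell i leaves out, and m and m′ are
  -- the two that it keeps. Both must separate p because either may be absent from the cell compared
  -- with.
  Omitted : Fin 24 → LatticePoint 4 → Set
  Omitted i p = ∃[ t ] ∃[ m ] ∃[ m′ ] (lookup (cell i) m ≡ p ⊕ proj₁ (lookup cycles t) × lookup (cell i) m′ ≡ p ⊕ proj₂ (lookup cycles t))
    × Separates i p m × Separates i p m′

  omitted? : ∀ i p → Dec (Omitted i p)
  omitted? i p = Finₚ.any? λ t → Finₚ.any? λ m → Finₚ.any? λ m′ →
    ((lookup (cell i) m ≟ₚ p ⊕ proj₁ (lookup cycles t)) ×-dec (lookup (cell i) m′ ≟ₚ p ⊕ proj₂ (lookup cycles t)))
    ×-dec (separates? i p m ×-dec separates? i p m′)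

  abstract
    box-vertices : ∀ i a b c d → InBox i (corner a b c d) → corner a b c d ∈ cell i ⊎ Omitted i (corner a b c d)
    box-vertices = from-yes (Finₚ.all? λ i → ∀corner? λ p → inBox? i p →-dec ((p ∈? cell i) ⊎-dec omitted? i p))

  abstract
    -- The first four entries are the coordinates, so every box lies in the unit cube and its
    -- lattice points are corners.
    offset-unit : ∀ i (e : Fin 4) → offset i (e ↑ˡ 5) ≡ O
    offset-unit = from-yes (Finₚ.all? λ i → Finₚ.all? λ (e : Fin 4) → offset i (e ↑ˡ 5) ℤₚ.≟ O)

  -- The orientation of the edges: first by a linear functional; on its kernel, the
  -- three differences of even permutations run around a cycle.

  φ : Vec ℤ 4
  φ = v I II II I

  -- The first three run once around the even triangle; the last orients the only other edge
  -- direction of the cells on which `φ` vanishes.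
  ties : Vec (LatticePoint 4) 4
  ties = v N I O N ∷ v O N I O ∷ v I O N I ∷ v N O O I ∷ []

  Forward : LatticePoint 4 → Set
  Forward d = O ℤ.< dot φ d ⊎ d ∈ ties

  _⊏ᴷ_ : LatticePoint 4 → LatticePoint 4 → Set
  p ⊏ᴷ q = Forward (q ⊖ p)

  _⊏ᴷ?_ : ∀ p q → Dec (p ⊏ᴷ q)
  p ⊏ᴷ? q = (O ℤₚ.<? dot φ (q ⊖ p)) ⊎-dec (q ⊖ p ∈? ties)

  abstract
    cell-sorted : ∀ i → AllPairs _⊏ᴷ_ (cell i)
    cell-sorted = from-yes (Finₚ.all? λ i → allPairs? _⊏ᴷ?_ (cell i))

  ⊖-negate : ∀ {n} (p q : LatticePoint n) → p ⊖ q ≡ negate (q ⊖ p)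
  ⊖-negate []       []       = refl
  ⊖-negate (p ∷ ps) (q ∷ qs) = cong₂ _∷_ (solve 2 (λ p q → p :- q := :- (q :- p)) refl p q) (⊖-negate ps qs)
    where open +-*-Solver

  dot-negateʳ : ∀ {n} (a p : LatticePoint n) → dot a (negate p) ≡ ℤ.- dot a p
  dot-negateʳ []       []       = refl
  dot-negateʳ (a ∷ as) (p ∷ ps) = trans (cong (λ d → a ℤ.* ℤ.- p ℤ.+ d) (dot-negateʳ as ps))
    (solve 3 (λ a p d → a :* :- p :+ :- d := :- (a :* p :+ d)) refl a p (dot as ps))
    where open +-*-Solver

  forward-asym : ∀ d → Forward d → ¬ Forward (negate d)
  forward-asym d h k = go h (subst (λ x → O ℤ.< x ⊎ negate d ∈ ties) (dot-negateʳ φ d) k)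
    where
    level : All (λ u → dot φ u ≡ O) ties
    level = refl ∷ refl ∷ refl ∷ refl ∷ []
    one-way : All (λ u → ¬ negate u ∈ ties) ties
    one-way = from-yes (All.all? (λ u → ¬? (negate u ∈? ties)) ties)
    go : O ℤ.< dot φ d ⊎ d ∈ ties → O ℤ.< ℤ.- dot φ d ⊎ negate d ∈ ties → _
    go (inj₁ a) (inj₁ b) = ℤₚ.<-asym a (ℤₚ.neg-cancel-< b)
    go (inj₁ a) (inj₂ b) = ℤₚ.<-irrefl (sym (trans (sym (ℤₚ.neg-involutive (dot φ d)))
      (cong ℤ.-_ (trans (sym (dot-negateʳ φ d)) (All.lookup level b))))) a
    go (inj₂ a) (inj₁ b) = ℤₚ.<-irrefl (sym (cong ℤ.-_ (All.lookup level a))) b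
    go (inj₂ a) (inj₂ b) = All.lookup one-way a b

  ⊏ᴷ-asym : ∀ {p q} → p ⊏ᴷ q → ¬ q ⊏ᴷ p
  ⊏ᴷ-asym {p} {q} h k = forward-asym (q ⊖ p) h (subst Forward (⊖-negate p q) k)

  ⊖-translate : ∀ {n} (p q v : LatticePoint n) → (q ⊕ v) ⊖ (p ⊕ v) ≡ q ⊖ p
  ⊖-translate []       []       []       = refl
  ⊖-translate (p ∷ ps) (q ∷ qs) (v ∷ vs) = cong₂ _∷_ (solve 3 (λ p q v → (q :+ v) :- (p :+ v) := q :- p) refl p q v) (⊖-translate ps qs vs)
    where open +-*-Solver

  sorted-translate : ∀ {k} v {ws : Vec (LatticePoint 4) k} → AllPairs _⊏ᴷ_ ws → AllPairs _⊏ᴷ_ (Vec.map (_⊕ v) ws)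
  sorted-translate v []       = []
  sorted-translate v (h ∷ hs) = heads h ∷ sorted-translate v hs
    where
    heads : ∀ {k w} {ws : Vec (LatticePoint 4) k} → All (w ⊏ᴷ_) ws → All ((w ⊕ v) ⊏ᴷ_) (Vec.map (_⊕ v) ws)
    heads []                  = []
    heads {w = w} (_∷_ {x = x} h hs) = subst Forward (sym (⊖-translate w x v)) h ∷ heads hs

  -- Point location in the unit cube

  lincomb : ∀ {k l} → Vec ℤ k → Vec (Vec ℤ l) k → Vec ℤ l
  lincomb []       []       = Vec.replicate _ O
  lincomb (a ∷ as) (x ∷ xs) = Vec.map (a ℤ.*_) x ⊕ lincomb as xs

  unit : ∀ {n} → Fin n → Vec ℤ n
  unit zero    = I ∷ Vec.replicate _ O
  unit (suc i) = O ∷ unit i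

  abstract
    -- An identity of integer forms, so that it can be decided by computation and then evaluated at
    -- any point of the ordered domain.
    coordinates-sum : ∀ i → lincomb (Vec.replicate 5 I) (lookup coordinates i) ≡ unit (# 0)
    coordinates-sum = from-yes (Finₚ.all? λ i → lincomb (Vec.replicate 5 I) (lookup coordinates i) ≟ₚ unit (# 0))

  abstract
    coordinates-barycentric : ∀ i (m : Fin 4) → lincomb (Vec.map (λ p → lookup p m) (cell i)) (lookup coordinates i) ≡ unit (suc m)
    coordinates-barycentric = from-yes (Finₚ.all? λ i → Finₚ.all? λ m →
      lincomb (Vec.map (λ p → lookup p m) (cell i)) (lookup coordinates i) ≟ₚ unit (suc m))

  -- A decision tree: each split asks for the sign of a form, and each derived form
  -- is a sum of forms already known to be nonnegative.
  data Tree : Set where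
    leaf   : Fin 24 → Tree
    split  : Form 4 → Tree → Tree → Tree
    derive : List (Form 4) → Tree → Tree

  open ListMembership (_≟ₚ_ {5}) public using () renaming (_∈_ to _∈ᴸ_; _∈?_ to _∈ᴸ?_)

  total-form : List (Form 4) → Form 4
  total-form = List.foldr _⊕_ (Vec.replicate 5 O)

  -- At a leaf nonnegativity is a mere membership test, since `derive` has recorded beforehand those
  -- coordinates that are sums of known forms.
  Locates : List (Form 4) → Tree → Set
  Locates known (leaf i)      = ∀ m → coordinate i m ∈ᴸ known
  Locates known (split g l r) = Locates (g ∷ known) l × Locates (negate g ∷ known) r
  Locates known (derive gs t) = ListAll.All (_∈ᴸ known) gs × Locates (total-form gs ∷ known) t

  locates? : ∀ known t → Dec (Locates known t)
  locates? known (leaf i)      = Finₚ.all? λ m → coordinate i m ∈ᴸ? known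
  locates? known (split g l r) = locates? (g ∷ known) l ×-dec locates? (negate g ∷ known) r
  locates? known (derive gs t) = ListAll.all? (_∈ᴸ? known) gs ×-dec locates? (total-form gs ∷ known) t

  unit-cube : List (Form 4)
  unit-cube = f O I O O O ∷ f O O I O O ∷ f O O O I O ∷ f O O O O I ∷
              f I N O O O ∷ f I O N O O ∷ f I O O N O ∷ f I O O O N ∷ []

  -- The outer splits decide on which sides of the dicing hyperplanes the point lies; the innermost
  -- ones choose a piece of a Birkhoff polytope.
  location : Tree
  location =
    (split (f I N N O O)
      (split (f I O O N N)
        (split (f I N O N O)
          (split (f I O N O N)
            (split (f I N N N N)
              (leaf (# 0))
              (split (f N I I O I)
                (split (f O O I N O)
                  (leaf (# 1))
                  (derive ((f O O N I O) ∷ (f N I I O I) ∷ [])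
                    (leaf (# 2))))
                (split (f I N O N N)
                  (leaf (# 3))
                  (derive ((f N I O I I) ∷ (f I N N O N) ∷ [])
                    (leaf (# 2))))))
            (leaf (# 4)))
          (split (f I O N O N)
            (leaf (# 5))
            (leaf (# 4))))
        (split (f I N O N O)
          (split (f I O N O N)
            (leaf (# 6))
            (split (f II N N N N)
              (leaf (# 7))
              (leaf (# 8))))
          (split (f I O N O N)
            (split (f II N N N N)
              (leaf (# 9))
              (leaf (# 10)))
            (leaf (# 11)))))
      (split (f I O O N N)
        (split (f I N O N O)
          (split (f I O N O N)
            (leaf (# 12))
            (split (f II N N N N)
              (leaf (# 13))
              (leaf (# 14))))
          (split (f I O N O N)
            (split (f II N N N N)
              (leaf (# 15))
              (leaf (# 16)))
            (leaf (# 17))))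
        (split (f I N O N O)
          (split (f I O N O N)
            (leaf (# 6))
            (leaf (# 18)))
          (split (f I O N O N)
            (leaf (# 19))
            (split (f III N N N N)
              (split (f NN I I O I)
                (split (f NN I O I I)
                  (leaf (# 20))
                  (derive ((f II N O N N) ∷ (f NN I I O I) ∷ [])
                    (leaf (# 21))))
                (split (f O O N I O)
                  (leaf (# 22))
                  (derive ((f O O I N O) ∷ (f II N N O N) ∷ [])
                    (leaf (# 21)))))
              (leaf (# 23)))))))

  abstract
    location-locates : Locates unit-cube location
    location-locates = from-yes (locates? unit-cube location)

  even : Fin 3 → LatticePoint 4
  even = lookup (v I O O I ∷ v O I O O ∷ v O O I O ∷ [])

  cyclic : ∀ i → even i ⊏ᴷ even (next i)
  cyclic = from-yes (Finₚ.all? λ i → even i ⊏ᴷ? even (next i))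

  origin : LatticePoint 4
  origin = v O O O O

  -- The piece of the Birkhoff polytope that keeps `even i` and `even (next i)` and omits the third
  -- even permutation.
  even-cell : Fin 3 → Fin 24
  even-cell = lookup (# 1 ∷ # 3 ∷ # 2 ∷ [])

  even∈ : ∀ i → even i ∈ translate origin (cell (even-cell i)) × even (next i) ∈ translate origin (cell (even-cell i))
  even∈ = from-yes (Finₚ.all? λ i →
    (even i ∈? translate origin (cell (even-cell i))) ×-dec (even (next i) ∈? translate origin (cell (even-cell i))))

-- Arithmetic and finite sums in an ordered domain

module Lemmas (D : OrderedDomain) where
  open import Algebra.Solver.Ring.AlmostCommutativeRing using (fromCommutativeRing; _-Raw-AlmostCommutative⟶_)
  open import Data.Maybe.Base using (Maybe; just; nothing)
  import Algebra.Solver.Ring as RingSolver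

  open OrderedDomain D public hiding (zero)
  open import Algebra.Properties.Ring ring public
    using (-‿distribˡ-*; -‿distribʳ-*; -0#≈0#; x∙y⁻¹≈ε⇒x≈y; x+x≈x⇒x≈0; +-cancelˡ; -‿involutive; +-inverseʳ-unique)
  open import Algebra.Properties.Semiring.Sum semiring public
    using (sum; sum-cong-≋; ∑-distrib-+; ∑-comm; *-distribˡ-sum)
  open import Relation.Binary.Reasoning.Setoid setoid public

  ι-0 : ι 0ℤ ≈ 0#
  ι-0 = x+x≈x⇒x≈0 (ι 0ℤ) (sym (ι-+ 0ℤ 0ℤ))

  ι-neg : ∀ i → ι (ℤ.- i) ≈ - ι i
  ι-neg i = +-inverseʳ-unique (ι i) (ι (ℤ.- i))
    (trans (sym (ι-+ i (ℤ.- i))) (trans (reflexive (≡.cong ι (ℤₚ.+-inverseʳ i))) ι-0))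

  ι-morphism : ℤ.+-*-rawRing -Raw-AlmostCommutative⟶ fromCommutativeRing commutativeRing
  ι-morphism = record
    { ⟦_⟧ = ι ; +-homo = ι-+ ; *-homo = ι-* ; -‿homo = ι-neg ; 0-homo = ι-0 ; 1-homo = ι-1 }

  ι-≟ : ∀ i j → Maybe (ι i ≈ ι j)
  ι-≟ i j with i ℤₚ.≟ j
  ... | yes i≡j = just (reflexive (≡.cong ι i≡j))
  ... | no _    = nothing

  open RingSolver ℤ.+-*-rawRing (fromCommutativeRing commutativeRing) ι-morphism ι-≟ public
    using (solve; _:=_; _:+_; _:-_; _:*_; :-_; con)

  ≤-refl : ∀ {x} → x ≤ x
  ≤-refl = ≤-reflexive refl

  ≤-respˡ : ∀ {x y z} → x ≈ y → x ≤ z → y ≤ z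
  ≤-respˡ x≈y = ≤-trans (≤-reflexive (sym x≈y))

  ≤-respʳ : ∀ {x y z} → x ≈ y → z ≤ x → z ≤ y
  ≤-respʳ x≈y z≤x = ≤-trans z≤x (≤-reflexive x≈y)

  _≤?_ : ∀ x y → Dec (x ≤ y)
  x ≤? y with ≤-total x y
  ... | inj₁ x≤y = yes x≤y
  ... | inj₂ y≤x with x ≟ y
  ...   | yes x≈y = yes (≤-reflexive x≈y)
  ...   | no  x≉y = no λ x≤y → x≉y (≤-antisym x≤y y≤x)

  ≰⇒≥ : ∀ {x y} → ¬ x ≤ y → y ≤ x
  ≰⇒≥ {x} {y} x≰y with ≤-total x y
  ... | inj₁ x≤y = contradiction x≤y x≰y
  ... | inj₂ y≤x = y≤x

  x≤y⇒0≤y-x : ∀ {x y} → x ≤ y → 0# ≤ y - x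
  x≤y⇒0≤y-x {x} x≤y = ≤-respˡ (-‿inverseʳ x) (+-mono-≤ x≤y ≤-refl)

  0≤y-x⇒x≤y : ∀ {x y} → 0# ≤ y - x → x ≤ y
  0≤y-x⇒x≤y {x} {y} 0≤y-x = ≤-respˡ (+-identityˡ x)
    (≤-respʳ (solve 2 (λ x y → y :- x :+ x := y) refl x y) (+-mono-≤ 0≤y-x ≤-refl))

  +-nonNeg : ∀ {x y} → 0# ≤ x → 0# ≤ y → 0# ≤ x + y
  +-nonNeg 0≤x 0≤y = ≤-respˡ (+-identityˡ 0#) (+-mono-≤ 0≤x 0≤y)

  neg-mono : ∀ {x y} → x ≤ y → - y ≤ - x
  neg-mono {x} {y} x≤y = 0≤y-x⇒x≤y
    (≤-respʳ (solve 2 (λ x y → y :- x := :- x :- :- y) refl x y) (x≤y⇒0≤y-x x≤y))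

  x≤0⇒0≤-x : ∀ {x} → x ≤ 0# → 0# ≤ - x
  x≤0⇒0≤-x x≤0 = ≤-respˡ -0#≈0# (neg-mono x≤0)

  *-monoˡ-≤ : ∀ {x y z} → 0# ≤ x → y ≤ z → x * y ≤ x * z
  *-monoˡ-≤ {x} {y} {z} 0≤x y≤z = 0≤y-x⇒x≤y
    (≤-respʳ (solve 3 (λ x y z → x :* (z :- y) := x :* z :- x :* y) refl x y z)
      (*-nonNeg 0≤x (x≤y⇒0≤y-x y≤z)))

  0≤1 : 0# ≤ 1#
  0≤1 with ≤-total 0# 1#
  ... | inj₁ p = p
  ... | inj₂ p = ≤-respʳ (trans (solve 1 (λ x → (:- x) :* (:- x) := x :* x) refl 1#) (*-identityˡ 1#))
    (*-nonNeg (x≤0⇒0≤-x p) (x≤0⇒0≤-x p))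

  1≰0 : ¬ 1# ≤ 0#
  1≰0 1≤0 = 1≉0 (≤-antisym 1≤0 0≤1)

  *-cancelˡ-nonZero : ∀ {x y z} → ¬ x ≈ 0# → x * y ≈ x * z → y ≈ z
  *-cancelˡ-nonZero {x} {y} {z} x≉0 xy≈xz with zero-product {x} {y - z}
    (trans (solve 3 (λ x y z → x :* (y :- z) := x :* y :- x :* z) refl x y z)
      (trans (+-congʳ xy≈xz) (-‿inverseʳ (x * z))))
  ... | inj₁ x≈0   = contradiction x≈0 x≉0
  ... | inj₂ y-z≈0 = x∙y⁻¹≈ε⇒x≈y y z y-z≈0

  ι-suc : ∀ n → ι (+ suc n) ≈ 1# + ι (+ n)
  ι-suc n = trans (ι-+ 1ℤ (+ n)) (+-congʳ ι-1)

  ι-nonNeg : ∀ n → 0# ≤ ι (+ n)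
  ι-nonNeg zero    = ≤-reflexive (sym ι-0)
  ι-nonNeg (suc n) = ≤-respʳ (sym (ι-suc n)) (+-nonNeg 0≤1 (ι-nonNeg n))

  ι-- : ∀ i j → ι (i ℤ.- j) ≈ ι i - ι j
  ι-- i j = trans (ι-+ i (ℤ.- j)) (+-congˡ (ι-neg j))

  ι-mono : ∀ {i j} → i ℤ.≤ j → ι i ≤ ι j
  ι-mono {i} {j} i≤j with j ℤ.- i in eq | ℤₚ.i≤j⇒0≤j-i i≤j
  ... | + n | _ = 0≤y-x⇒x≤y (≤-respʳ (trans (reflexive (≡.cong ι (≡.sym eq))) (ι-- j i)) (ι-nonNeg n))

  ι-cancel-≤ : ∀ {i j} → ι i ≤ ι j → i ℤ.≤ j
  ι-cancel-≤ {i} {j} ιi≤ιj with i ℤₚ.≤? j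
  ... | yes i≤j = i≤j
  ... | no  i≰j = contradiction 1≤0 1≰0
    where
    1≤0 : 1# ≤ 0#
    1≤0 = ≤-respˡ (solve 2 (λ x y → :- x :+ (x :+ y) := y) refl (ι j) 1#)
            (≤-respʳ (-‿inverseˡ (ι j)) (+-mono-≤ (≤-refl { - ι j}) (≤-trans step ιi≤ιj)))
      where
      step : ι j + 1# ≤ ι i
      step = ≤-respˡ (trans (ι-+ 1ℤ j) (trans (+-congʳ ι-1) (+-comm 1# (ι j)))) (ι-mono (ℤₚ.i<j⇒suc[i]≤j (ℤₚ.≰⇒> i≰j)))

  ι-injective : ∀ {i j} → ι i ≈ ι j → i ≡ j
  ι-injective e = ℤₚ.≤-antisym (ι-cancel-≤ (≤-reflexive e)) (ι-cancel-≤ (≤-reflexive (sym e)))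

  -- Closed at both ends, so either neighbouring interval serves at an integer. The search climbs
  -- from -m, where m bounds - x, and must succeed within n + m steps.
  floor : ∀ x → ∃[ k ] ι k ≤ x × x ≤ ι (ℤ.suc k)
  floor x = search (n ℕ.+ m) (ℤ.- (+ m)) lower upper
    where
    search : ∀ d k → ι k ≤ x → x ≤ ι (k ℤ.+ + d) → ∃[ k ] ι k ≤ x × x ≤ ι (ℤ.suc k)
    search zero k l u = k , l , ≤-trans u (ι-mono (≡.subst (ℤ._≤ ℤ.suc k) (≡.sym (ℤₚ.+-identityʳ k)) (ℤₚ.i≤suc[i] k)))
    search (suc d) k l u with ≤-total x (ι (ℤ.suc k))
    ... | inj₁ x≤ = k , l , x≤
    ... | inj₂ ≤x = search d (ℤ.suc k) ≤x (≡.subst (λ j → x ≤ ι j) shift u)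
      where
      shift : k ℤ.+ + suc d ≡ ℤ.suc k ℤ.+ + d
      shift = ≡.trans (≡.sym (ℤₚ.+-assoc k 1ℤ (+ d))) (≡.cong (λ i → i ℤ.+ (+ d)) (ℤₚ.+-comm k 1ℤ))
    bound : ∀ y → ∃[ n ] y ≤ ι (+ n)
    bound y with archimedean y 1≰0
    ... | n , p = n , ≤-respʳ (*-identityʳ (ι (+ n))) p
    n = proj₁ (bound x)
    m = proj₁ (bound (- x))
    lower : ι (ℤ.- (+ m)) ≤ x
    lower = ≤-respˡ (sym (ι-neg (+ m))) (≤-respʳ (-‿involutive x) (neg-mono (proj₂ (bound (- x)))))
    upper : x ≤ ι (ℤ.- (+ m) ℤ.+ + (n ℕ.+ m))
    upper = ≡.subst (λ j → x ≤ ι j) e (proj₂ (bound x))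
      where
      e : + n ≡ ℤ.- (+ m) ℤ.+ + (n ℕ.+ m)
      e = ≡.sym (≡.trans (ℤₚ.+-comm (ℤ.- (+ m)) (+ (n ℕ.+ m))) (≡.trans (ℤₚ.+-assoc (+ n) (+ m) (ℤ.- (+ m)))
          (≡.trans (≡.cong (λ i → (+ n) ℤ.+ i) (ℤₚ.+-inverseʳ (+ m))) (ℤₚ.+-identityʳ (+ n)))))

  -- Finite sums

  sum-cong : ∀ {n} {f g : Vector Carrier n} → (∀ i → f i ≈ g i) → sum f ≈ sum g
  sum-cong = sum-cong-≋

  sum-0 : ∀ {n} {f : Vector Carrier n} → (∀ i → f i ≈ 0#) → sum f ≈ 0#
  sum-0 {zero}  _ = refl
  sum-0 {suc n} h = trans (+-cong (h zero) (sum-0 (h ∘ suc))) (+-identityˡ 0#)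

  sum-mono : ∀ {n} {f g : Vector Carrier n} → (∀ i → f i ≤ g i) → sum f ≤ sum g
  sum-mono {zero}  _ = ≤-refl
  sum-mono {suc n} h = +-mono-≤ (h zero) (sum-mono (h ∘ suc))

  sum-nonNeg : ∀ {n} {f : Vector Carrier n} → (∀ i → 0# ≤ f i) → 0# ≤ sum f
  sum-nonNeg {zero}  _ = ≤-refl
  sum-nonNeg {suc n} h = +-nonNeg (h zero) (sum-nonNeg (h ∘ suc))

  +-nonNeg-zero : ∀ {x y} → 0# ≤ x → 0# ≤ y → x + y ≈ 0# → x ≈ 0# × y ≈ 0#
  +-nonNeg-zero {x} {y} 0≤x 0≤y x+y≈0 =
    ≤-antisym (≤-respʳ x+y≈0 (≤-respˡ (+-identityʳ x) (+-mono-≤ ≤-refl 0≤y))) 0≤x ,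
    ≤-antisym (≤-respʳ x+y≈0 (≤-respˡ (+-identityˡ y) (+-mono-≤ 0≤x ≤-refl))) 0≤y

  sum-nonNeg-zero : ∀ {n} {f : Vector Carrier n} → (∀ i → 0# ≤ f i) → sum f ≈ 0# → ∀ i → f i ≈ 0#
  sum-nonNeg-zero h s≈0 zero    = proj₁ (+-nonNeg-zero (h zero) (sum-nonNeg (h ∘ suc)) s≈0)
  sum-nonNeg-zero h s≈0 (suc i) =
    sum-nonNeg-zero (h ∘ suc) (proj₂ (+-nonNeg-zero (h zero) (sum-nonNeg (h ∘ suc)) s≈0)) i

  sum-neg : ∀ {n} (f : Vector Carrier n) → sum (λ i → - f i) ≈ - sum f
  sum-neg {zero}  f = sym -0#≈0#
  sum-neg {suc n} f = trans (+-congˡ (sum-neg (f ∘ suc)))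
    (solve 2 (λ x y → :- x :+ :- y := :- (x :+ y)) refl (f zero) (sum (f ∘ suc)))

  sum-squeeze : ∀ {n} {f g : Vector Carrier n} → (∀ i → f i ≤ g i) → sum f ≈ sum g → ∀ i → f i ≈ g i
  sum-squeeze {f = f} {g} f≤g Σf≈Σg i = sym (x∙y⁻¹≈ε⇒x≈y (g i) (f i)
    (sum-nonNeg-zero (λ i → x≤y⇒0≤y-x (f≤g i)) Σ≈0 i))
    where
    Σ≈0 : sum (λ i → g i - f i) ≈ 0#
    Σ≈0 = trans (∑-distrib-+ g (λ i → - f i)) (trans (+-cong (sym Σf≈Σg) (sum-neg f)) (-‿inverseʳ (sum f)))

-- Finitely supported measures on the lattice

module Measures (D : OrderedDomain) where
  open Lattice
  open Lemmas D

  -- Points may repeat and weights may vanish, since that is what a convex combination supplies.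
  -- Measures are compared through `mass` and not as lists.
  record Measure (n : ℕ) : Set where
    constructor measure
    field
      {size} : ℕ
      weight : Vector Carrier size
      point  : Vector (LatticePoint n) size
      nonNeg : ∀ j → 0# ≤ weight j

  open Measure

  private
    variable
      m n : ℕ
      μ ν : Measure n

  ∫ : Measure n → (LatticePoint n → Carrier) → Carrier
  ∫ μ g = sum (λ j → weight μ j * g (point μ j))

  infix 4 _⊩_
  record _⊩_ (μ : Measure n) (P : LatticePoint n → Set) : Set where
    constructor ae
    field
      at : ∀ j → weight μ j ≈ 0# ⊎ P (point μ j)

  open _⊩_ public

  everywhere : {P : LatticePoint n → Set} (μ : Measure n) → (∀ p → P p) → μ ⊩ P
  everywhere μ h = ae λ j → inj₂ (h (point μ j))

  ⊩-map : {P Q : LatticePoint n → Set} → (∀ {p} → P p → Q p) → μ ⊩ P → μ ⊩ Q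
  ⊩-map f h = ae λ j → Sum.map₂ f (at h j)

  ⊩-zip : {P Q R : LatticePoint n → Set} → (∀ {p} → P p → Q p → R p) → μ ⊩ P → μ ⊩ Q → μ ⊩ R
  ⊩-zip {μ = μ} {P} {Q} {R} f h k = ae λ j → go j (at h j) (at k j)
    where
    go : ∀ j → weight μ j ≈ 0# ⊎ P (point μ j) → weight μ j ≈ 0# ⊎ Q (point μ j) → weight μ j ≈ 0# ⊎ R (point μ j)
    go j (inj₁ w≈0) _          = inj₁ w≈0
    go j (inj₂ _)   (inj₁ w≈0) = inj₁ w≈0
    go j (inj₂ p)   (inj₂ q)   = inj₂ (f p q)

  ⊩-∃ : {P : LatticePoint n → Set} → ¬ sum (weight μ) ≈ 0# → μ ⊩ P → ∃[ j ] P (point μ j)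
  ⊩-∃ {μ = μ} {P = P} ≉0 h = go (weight μ) (point μ) ≉0 (at h)
    where
    go : ∀ {k} (w : Vector Carrier k) (p : Vector (LatticePoint _) k) → ¬ sum w ≈ 0# → (∀ j → w j ≈ 0# ⊎ P (p j)) → ∃[ j ] P (p j)
    go {zero}  w p ≉0 h = contradiction refl ≉0
    go {suc k} w p ≉0 h with h zero
    ... | inj₂ q   = zero , q
    ... | inj₁ w≈0 with go (w ∘ suc) (p ∘ suc) (λ s≈0 → ≉0 (trans (+-cong w≈0 s≈0) (+-identityˡ 0#))) (h ∘ suc)
    ...   | j , q = suc j , q

  ∫-cong : ∀ (μ : Measure n) (g h : LatticePoint n → Carrier) → μ ⊩ (λ p → g p ≈ h p) → ∫ μ g ≈ ∫ μ h
  ∫-cong μ g h e = sum-cong λ j → case (at e j)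
    where
    case : ∀ {j} → weight μ j ≈ 0# ⊎ g (point μ j) ≈ h (point μ j) → weight μ j * g (point μ j) ≈ weight μ j * h (point μ j)
    case (inj₁ w≈0) = trans (*-congʳ w≈0) (trans (zeroˡ _) (sym (trans (*-congʳ w≈0) (zeroˡ _))))
    case (inj₂ g≈h) = *-congˡ g≈h

  ∫-nonNeg-term : ∀ (μ : Measure n) (g : LatticePoint n → Carrier) → μ ⊩ (λ p → 0# ≤ g p) → ∀ j → 0# ≤ weight μ j * g (point μ j)
  ∫-nonNeg-term μ g h j with at h j
  ... | inj₁ w≈0 = ≤-reflexive (sym (trans (*-congʳ w≈0) (zeroˡ _)))
  ... | inj₂ 0≤g = *-nonNeg (nonNeg μ j) 0≤g

  ∫-nonNeg : ∀ (μ : Measure n) (g : LatticePoint n → Carrier) → μ ⊩ (λ p → 0# ≤ g p) → 0# ≤ ∫ μ g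
  ∫-nonNeg μ g h = sum-nonNeg (∫-nonNeg-term μ g h)

  ∫-nonNeg-zero : ∀ (μ : Measure n) (g : LatticePoint n → Carrier) → μ ⊩ (λ p → 0# ≤ g p) → ∫ μ g ≈ 0# → μ ⊩ (λ p → g p ≈ 0#)
  ∫-nonNeg-zero μ g h ∫≈0 = ae λ j → zero-product (sum-nonNeg-zero (∫-nonNeg-term μ g h) ∫≈0 j)

  ∫-+ : ∀ (μ : Measure n) g h → ∫ μ (λ p → g p + h p) ≈ ∫ μ g + ∫ μ h
  ∫-+ μ g h = trans (sum-cong λ j → distribˡ (weight μ j) (g (point μ j)) (h (point μ j)))
    (∑-distrib-+ (λ j → weight μ j * g (point μ j)) (λ j → weight μ j * h (point μ j)))

  ∫-* : ∀ (μ : Measure n) c g → ∫ μ (λ p → c * g p) ≈ c * ∫ μ g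
  ∫-* μ c g = trans (sum-cong λ j → solve 3 (λ w c g → w :* (c :* g) := c :* (w :* g)) refl (weight μ j) c (g (point μ j)))
    (sym (*-distribˡ-sum c (λ j → weight μ j * g (point μ j))))

  ∫-neg : ∀ (μ : Measure n) g → ∫ μ (λ p → - g p) ≈ - ∫ μ g
  ∫-neg μ g = trans (sum-cong λ j → sym (-‿distribʳ-* (weight μ j) (g (point μ j))))
    (sum-neg (λ j → weight μ j * g (point μ j)))

  ∫-sum : ∀ {k} (μ : Measure n) (G : Fin k → LatticePoint n → Carrier) →
          ∫ μ (λ p → sum (λ i → G i p)) ≈ sum (λ i → ∫ μ (G i))
  ∫-sum μ G = trans (sum-cong λ j → *-distribˡ-sum (weight μ j) (λ i → G i (point μ j)))
    (∑-comm (λ j i → weight μ j * G i (point μ j)))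

  total : Measure n → Carrier
  total μ = ∫ μ (λ _ → 1#)

  barycentre : Measure n → Vector Carrier n
  barycentre μ i = ∫ μ (λ p → ι (lookup p i))

  infix 4 _≅_
  _≅_ : Measure n → Measure n → Set
  μ ≅ ν = total μ ≈ total ν × (∀ i → barycentre μ i ≈ barycentre ν i)

  δ : LatticePoint n → LatticePoint n → Carrier
  δ v p = if does (p ≟ₚ v) then 1# else 0#

  δ-≡ : {v p : LatticePoint n} → p ≡ v → δ v p ≈ 1#
  δ-≡ {v = v} {p} p≡v with p ≟ₚ v
  ... | yes _  = refl
  ... | no p≢v = contradiction p≡v p≢v

  δ-≢ : {v p : LatticePoint n} → p ≢ v → δ v p ≈ 0#
  δ-≢ {v = v} {p} p≢v with p ≟ₚ v
  ... | yes p≡v = contradiction p≡v p≢v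
  ... | no  _   = refl

  δ-nonNeg : ∀ (v p : LatticePoint n) → 0# ≤ δ v p
  δ-nonNeg v p with p ≟ₚ v
  ... | yes _ = 0≤1
  ... | no  _ = ≤-refl

  mass : Measure n → LatticePoint n → Carrier
  mass μ v = ∫ μ (δ v)

  mass-nonNeg : ∀ (μ : Measure n) v → 0# ≤ mass μ v
  mass-nonNeg μ v = ∫-nonNeg μ (δ v) (everywhere μ (δ-nonNeg v))

  mass-zero : ∀ (μ : Measure n) v → μ ⊩ (_≢ v) → mass μ v ≈ 0#
  mass-zero μ v h = trans (∫-cong μ (δ v) (λ _ → 0#) (⊩-map δ-≢ h))
    (sum-0 λ j → zeroʳ (weight μ j))

  mass-zero⁻¹ : ∀ (μ : Measure n) v → mass μ v ≈ 0# → μ ⊩ (_≢ v)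
  mass-zero⁻¹ μ v m≈0 = ⊩-map (λ δ≈0 p≡v → 1≉0 (trans (sym (δ-≡ p≡v)) δ≈0))
    (∫-nonNeg-zero μ (δ v) (everywhere μ (δ-nonNeg v)) m≈0)

  -- A point of ν that violates P has mass zero for μ, hence for ν, and so weight zero.
  ⊩-transport : {P : LatticePoint n → Set} (μ ν : Measure n) → (∀ p → Dec (P p)) →
                (∀ v → mass μ v ≈ mass ν v) → μ ⊩ P → ν ⊩ P
  ⊩-transport {P = P} μ ν P? μ≈ν h = ae λ j → go j (P? (point ν j))
    where
    go : ∀ j → Dec (P (point ν j)) → weight ν j ≈ 0# ⊎ P (point ν j)
    go j (yes p) = inj₂ p
    go j (no ¬p) = Sum.map₂ (λ ≢ → contradiction ≡.refl ≢) (at (mass-zero⁻¹ ν (point ν j)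
      (trans (sym (μ≈ν (point ν j))) (mass-zero μ (point ν j) (⊩-map (λ q e → ¬p (≡.subst P e q)) h)))) j)

  dirac : LatticePoint n → Measure n
  dirac v = measure {size = 1} (λ _ → 1#) (λ _ → v) (λ _ → 0≤1)

  ∫-dirac : ∀ (v : LatticePoint n) g → ∫ (dirac v) g ≈ g v
  ∫-dirac v g = trans (+-identityʳ (1# * g v)) (*-identityˡ (g v))

  push : (LatticePoint m → LatticePoint n) → Measure m → Measure n
  push h μ = measure (weight μ) (h ∘ point μ) (nonNeg μ)

  dotᴿ : Vec ℤ n → Vector Carrier n → Carrier
  dotᴿ f x = sum (λ i → ι (lookup f i) * x i)

  ι-dot : ∀ (a p : Vec ℤ n) → ι (dot a p) ≈ dotᴿ a (λ i → ι (lookup p i))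
  ι-dot []       []       = ι-0
  ι-dot (a ∷ as) (x ∷ xs) = trans (ι-+ (a ℤ.* x) (dot as xs)) (+-cong (ι-* a x) (ι-dot as xs))

  -- In homogeneous coordinates the constant term of f meets the total and the linear part meets the
  -- barycentre, so `≅` preserves the integrals of forms.
  ∫-eval : ∀ (μ : Measure n) f → ∫ μ (λ p → ι (eval f p)) ≈ dotᴿ f (total μ Vector.∷ barycentre μ)
  ∫-eval {n} μ f@(_ ∷ _) = begin
    ∫ μ (λ p → ι (eval f p))
      ≈⟨ ∫-cong μ _ _ (everywhere μ (λ p → ι-dot f (1ℤ ∷ p))) ⟩
    ∫ μ (λ p → sum (λ i → ι (lookup f i) * ι (lookup (1ℤ ∷ p) i)))
      ≈⟨ ∫-sum μ (λ i p → ι (lookup f i) * ι (lookup (1ℤ ∷ p) i)) ⟩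
    sum (λ i → ∫ μ (λ p → ι (lookup f i) * ι (lookup (1ℤ ∷ p) i)))
      ≈⟨ sum-cong (λ i → ∫-* μ (ι (lookup f i)) (λ p → ι (lookup (1ℤ ∷ p) i))) ⟩
    sum (λ i → ι (lookup f i) * ∫ μ (λ p → ι (lookup (1ℤ ∷ p) i)))
      ≈⟨ +-cong (*-congˡ (∫-cong μ (λ _ → ι 1ℤ) (λ _ → 1#) (everywhere μ λ _ → ι-1))) refl ⟩
    dotᴿ f (total μ Vector.∷ barycentre μ) ∎

  ∫-eval-≅ : ∀ (μ ν : Measure n) f → μ ≅ ν → ∫ μ (λ p → ι (eval f p)) ≈ ∫ ν (λ p → ι (eval f p))
  ∫-eval-≅ μ ν f@(_ ∷ _) (t , b) = trans (∫-eval μ f)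
    (trans (+-cong (*-congˡ t) (sum-cong λ i → *-congˡ (b i))) (sym (∫-eval ν f)))

  -- If ν lives between two consecutive levels of f, and not below level 0, then
  -- it can only balance μ, which lives below level 0, on level 0 itself.
  confine : ∀ (μ ν : Measure n) f k → μ ≅ ν → μ ⊩ (λ p → eval f p ℤ.≤ 0ℤ) →
            ν ⊩ (λ p → k ℤ.≤ eval f p × eval f p ℤ.≤ ℤ.suc k) → ν ⊩ (λ p → eval f p ℤ.≤ 0ℤ)
  confine μ ν f k μ≅ν μ≤0 ν-k with ℤ.suc k ℤₚ.≤? 0ℤ
  ... | yes 1+k≤0 = ⊩-map (λ b → ℤₚ.≤-trans (proj₂ b) 1+k≤0) ν-k
  ... | no  1+k≰0 = ⊩-map (λ e → ℤₚ.≤-reflexive (ι-injective (trans e (sym ι-0))))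
          (∫-nonNeg-zero ν F ν≥0 (≤-antisym (≤-respˡ (∫-eval-≅ μ ν f μ≅ν) ∫μ≤0) (∫-nonNeg ν F ν≥0)))
    where
    F = λ p → ι (eval f p)
    0≤k : 0ℤ ℤ.≤ k
    0≤k = ≡.subst (0ℤ ℤ.≤_) (ℤₚ.pred-suc k) (ℤₚ.i<j⇒i≤pred[j] (ℤₚ.≰⇒> 1+k≰0))
    ν≥0 : ν ⊩ (λ p → 0# ≤ F p)
    ν≥0 = ⊩-map (λ b → ≤-respˡ ι-0 (ι-mono (ℤₚ.≤-trans 0≤k (proj₁ b)))) ν-k
    ∫μ≤0 : ∫ μ F ≤ 0#
    ∫μ≤0 = ≤-respˡ (-‿involutive _) (≤-respʳ -0#≈0# (neg-mono
      (≤-respʳ (∫-neg μ F) (∫-nonNeg μ (λ p → - F p)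
        (⊩-map (λ b → x≤0⇒0≤-x (≤-respʳ ι-0 (ι-mono b))) μ≤0)))))

  Unit : Form n → LatticePoint n → Set
  Unit f p = 0ℤ ℤ.≤ eval f p × eval f p ℤ.≤ 1ℤ

  -- Two uses of `confine`: one for the form -f, which ν keeps between -(k + 1) and -k, and one for
  -- f - 1.
  confine-Unit : ∀ (μ ν : Measure n) f k → μ ≅ ν → μ ⊩ Unit f →
                 ν ⊩ (λ p → k ℤ.≤ eval f p × eval f p ℤ.≤ ℤ.suc k) → ν ⊩ Unit f
  confine-Unit μ ν f@(c ∷ a) k μ≅ν μ-unit ν-k = ⊩-zip (λ l u → l , u)
    (⊩-map (λ {p} h → ℤₚ.neg-cancel-≤ (≡.subst (ℤ._≤ 0ℤ) (dot-neg f (1ℤ ∷ p)) h))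
      (confine μ ν (negate f) (ℤ.- ℤ.suc k) μ≅ν
        (⊩-map (λ {p} b → ≡.subst (ℤ._≤ 0ℤ) (≡.sym (dot-neg f (1ℤ ∷ p))) (ℤₚ.neg-mono-≤ (proj₁ b))) μ-unit)
        (⊩-map (λ {p} b → ≡.subst (λ e → ℤ.- ℤ.suc k ℤ.≤ e × e ℤ.≤ ℤ.suc (ℤ.- ℤ.suc k)) (≡.sym (dot-neg f (1ℤ ∷ p)))
          (ℤₚ.neg-mono-≤ (proj₂ b) , ≡.subst (ℤ.- eval f p ℤ.≤_) (suc-neg-suc k) (ℤₚ.neg-mono-≤ (proj₁ b)))) ν-k)))
    (⊩-map (λ {p} h → ℤₚ.i-j≤0⇒i≤j (≡.subst (ℤ._≤ 0ℤ) (eval-+ (ℤ.- 1ℤ) c a p) h))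
      (confine μ ν (c ℤ.- 1ℤ ∷ a) (k ℤ.- 1ℤ) μ≅ν
        (⊩-map (λ {p} b → ≡.subst (ℤ._≤ 0ℤ) (≡.sym (eval-+ (ℤ.- 1ℤ) c a p)) (ℤₚ.i≤j⇒i-j≤0 (proj₂ b))) μ-unit)
        (⊩-map (λ {p} b → ≡.subst (λ e → k ℤ.- 1ℤ ℤ.≤ e × e ℤ.≤ ℤ.suc (k ℤ.- 1ℤ)) (≡.sym (eval-+ (ℤ.- 1ℤ) c a p))
          (ℤₚ.+-monoˡ-≤ (ℤ.- 1ℤ) (proj₁ b) , ≡.subst (eval f p ℤ.- 1ℤ ℤ.≤_) (ℤₚ.+-assoc 1ℤ k (ℤ.- 1ℤ)) (ℤₚ.+-monoˡ-≤ (ℤ.- 1ℤ) (proj₂ b)))) ν-k)))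

  Barycentric : ∀ {k} → Vec (LatticePoint n) k → Vector Carrier n → Set
  Barycentric {k = k} σ x = Σ (Vector Carrier k) λ c →
    (∀ i → 0# ≤ c i) × sum c ≈ 1# × (∀ m → sum (λ i → c i * ι (lookup (lookup σ i) m)) ≈ x m)

  -- A triangulation whose simplices are listed along an orientation of the edges.
  -- The orientation need not extend to an order of the lattice.
  record OrientedTriangulation (n : ℕ) : Set₁ where
    infix 4 _⊏_
    field
      Simplex  : VertexTuple n → Set
      _⊏_      : LatticePoint n → LatticePoint n → Set
      ⊏-asym   : ∀ {p q} → p ⊏ q → ¬ q ⊏ p
      sorted   : ∀ {σ} → Simplex σ → AllPairs _⊏_ σ
      periodic : ∀ v {σ} → Simplex σ → Simplex (translate v σ)
      cover    : ∀ x → ∃[ σ ] Simplex σ × Barycentric σ x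
      -- With σ = τ this yields affine independence, with different simplices the face-to-face
      -- condition.
      unique   : ∀ {σ τ} → Simplex σ → Simplex τ → ∀ μ ν → μ ⊩ (_∈ σ) → ν ⊩ (_∈ τ) →
                 μ ≅ ν → ∀ v → mass μ v ≈ mass ν v

    irreflexive : ∀ {p q} → p ⊏ q → p ≢ q
    irreflexive p⊏q ≡.refl = ⊏-asym p⊏q p⊏q

    distinct : ∀ {k} {ws : Vec (LatticePoint n) k} → AllPairs _⊏_ ws → AllPairs _≢_ ws
    distinct []       = []
    distinct (h ∷ hs) = All.map irreflexive h ∷ distinct hs

-- The staircase triangulation of a product with ℤ

module Product (D : OrderedDomain) where
  open Lattice
  open Lemmas D
  open Measures D
  open Measure

  private
    variable
      m n : ℕ

  mass-support : {P : LatticePoint n → Set} (μ : Measure n) → (∀ p → Dec (P p)) → μ ⊩ P →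
                 ∀ {v} → ¬ mass μ v ≈ 0# → P v
  mass-support μ P? h {v} ≉0 with P? v
  ... | yes Pv = Pv
  ... | no ¬Pv = contradiction (mass-zero μ v (⊩-map (λ Pp e → ¬Pv (≡.subst _ e Pp)) h)) ≉0

  sum-δ : ∀ {k} (ws : Vec (LatticePoint n) k) → AllPairs _≢_ ws → ∀ {w} → w ∈ ws → sum (λ i → δ (lookup ws i) w) ≈ 1#
  sum-δ (v ∷ vs) (v≢ ∷ vs≢) {w} (here e) = trans (+-cong (δ-≡ e) (sum-0 (zeros vs v≢))) (+-identityʳ 1#)
    where
    zeros : ∀ {k} (vs : Vec _ k) → All (v ≢_) vs → ∀ i → δ (lookup vs i) w ≈ 0#
    zeros (u ∷ us) (v≢u ∷ _) zero    = δ-≢ (λ w≡u → v≢u (≡.trans (≡.sym e) w≡u))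
    zeros (u ∷ us) (_ ∷ v≢)  (suc i) = zeros us v≢ i
  sum-δ (v ∷ vs) (v≢ ∷ vs≢) {w} (there w∈) = trans
    (+-cong (δ-≢ (λ w≡v → All.lookup v≢ w∈ (≡.sym w≡v))) (sum-δ vs vs≢ w∈)) (+-identityˡ 1#)

  δ-∷ : ∀ z (v p : LatticePoint n) → δ (z ∷ v) (z ∷ p) ≈ δ v p
  δ-∷ z v p = compare (p ≟ₚ v)
    where
    compare : Dec (p ≡ v) → δ (z ∷ v) (z ∷ p) ≈ δ v p
    compare (yes p≡v) = trans (δ-≡ {v = z ∷ v} {z ∷ p} (≡.cong (z ∷_) p≡v)) (sym (δ-≡ p≡v))
    compare (no  p≢v) = trans (δ-≢ {v = z ∷ v} {z ∷ p} (p≢v ∘ Vecₚ.∷-injectiveʳ)) (sym (δ-≢ p≢v))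

  Level : ℤ → LatticePoint (suc n) → Set
  Level z p = Vec.head p ≡ z ⊎ Vec.head p ≡ ℤ.suc z

  Between⇒Level : ∀ {z} (p : LatticePoint (suc n)) → Between z p → Level z p
  Between⇒Level {z = z} (y ∷ _) (z≤y , y≤1+z) with y ℤₚ.≟ ℤ.suc z
  ... | yes e = inj₂ e
  ... | no ≢  = inj₁ (ℤₚ.≤-antisym (≡.subst (y ℤ.≤_) (ℤₚ.pred-suc z) (ℤₚ.i<j⇒i≤pred[j] (ℤₚ.≤∧≢⇒< y≤1+z ≢))) z≤y)

  height : ℤ → Form (suc n)
  height z = ℤ.- z ∷ 1ℤ ∷ Vec.replicate _ 0ℤ

  eval-height : ∀ z (p : LatticePoint (suc n)) → eval (height z) p ≡ Vec.head p ℤ.- z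
  eval-height z (y ∷ p) = ≡.trans (≡.cong (λ d → ℤ.- z ℤ.* 1ℤ ℤ.+ (1ℤ ℤ.* y ℤ.+ d)) (dot-0 p))
    (≡.trans (≡.cong₂ ℤ._+_ (ℤₚ.*-identityʳ (ℤ.- z)) (≡.trans (ℤₚ.+-identityʳ (1ℤ ℤ.* y)) (ℤₚ.*-identityˡ y)))
      (ℤₚ.+-comm (ℤ.- z) y))

  mass-split : ∀ z (μ : Measure (suc n)) → μ ⊩ Level z → ∀ w →
               mass μ (z ∷ w) + mass μ (ℤ.suc z ∷ w) ≈ mass (push Vec.tail μ) w
  mass-split z μ h w = trans (sym (∫-+ μ (δ (z ∷ w)) (δ (ℤ.suc z ∷ w))))
    (∫-cong μ (λ p → δ (z ∷ w) p + δ (ℤ.suc z ∷ w) p) (λ p → δ w (Vec.tail p)) (⊩-map (λ {p} → split p) h))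
    where
    split : ∀ p → Level z p → δ (z ∷ w) p + δ (ℤ.suc z ∷ w) p ≈ δ w (Vec.tail p)
    split (y ∷ p) (inj₁ ≡.refl) = trans (+-cong (δ-∷ z w p)
      (δ-≢ {v = ℤ.suc z ∷ w} {p = z ∷ p} λ e → ℤₚ.<⇒≢ (z<suc[z] z) (Vecₚ.∷-injectiveˡ e))) (+-identityʳ _)
    split (y ∷ p) (inj₂ ≡.refl) = trans (+-cong
      (δ-≢ {v = z ∷ w} {p = ℤ.suc z ∷ p} λ e → ℤₚ.<⇒≢ (z<suc[z] z) (≡.sym (Vecₚ.∷-injectiveˡ e))) (δ-∷ (ℤ.suc z) w p)) (+-identityˡ _)

  -- The height form is 0 on the lower level and 1 on the upper one, so its integral is the mass on
  -- the upper level; hence `≅` fixes that mass.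
  sum-top : ∀ z {k} (ws : Vec (LatticePoint n) k) → AllPairs _≢_ ws → (μ : Measure (suc n)) →
            μ ⊩ Level z → μ ⊩ (λ p → Vec.tail p ∈ ws) →
            sum (λ i → mass μ (ℤ.suc z ∷ lookup ws i)) ≈ ∫ μ (λ p → ι (eval (height z) p))
  sum-top z ws ws≢ μ lev tail∈ = trans (sym (∫-sum μ (λ i → δ (ℤ.suc z ∷ lookup ws i))))
    (∫-cong μ (λ p → sum (λ i → δ (ℤ.suc z ∷ lookup ws i) p)) (λ p → ι (eval (height z) p))
      (⊩-zip (λ {p} → pointwise p) lev tail∈))
    where
    pointwise : ∀ p → Level z p → Vec.tail p ∈ ws → sum (λ i → δ (ℤ.suc z ∷ lookup ws i) p) ≈ ι (eval (height z) p)
    pointwise p@(y ∷ q) (inj₁ ≡.refl) _ = trans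
      (sum-0 λ i → δ-≢ {v = ℤ.suc z ∷ lookup ws i} {p = p} λ e → ℤₚ.<⇒≢ (z<suc[z] z) (Vecₚ.∷-injectiveˡ e))
      (sym (trans (reflexive (≡.cong ι (≡.trans (eval-height z p) (ℤₚ.+-inverseʳ z)))) ι-0))
    pointwise p@(y ∷ q) (inj₂ ≡.refl) q∈ = trans
      (trans (sum-cong λ i → δ-∷ (ℤ.suc z) (lookup ws i) q) (sum-δ ws ws≢ q∈))
      (sym (trans (reflexive (≡.cong ι (≡.trans (eval-height z p) (suc[z]-z z)))) ι-1))

  -- Of the total mass, r is to lie on the upper level. The vertices after the first are there
  -- already, so the first one sends up what they lack of r and keeps the rest below.
  turn-weights : ∀ {k} → Vector Carrier (suc k) → Carrier → Vector Carrier (suc (suc k))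
  turn-weights c r = sum c - r Vector.∷ r - sum (c ∘ suc) Vector.∷ (c ∘ suc)

  turn-nonNeg : ∀ {k} (c : Vector Carrier (suc k)) → (∀ i → 0# ≤ c i) → ∀ r → r ≤ sum c → sum (c ∘ suc) ≤ r →
                ∀ j → 0# ≤ turn-weights c r j
  turn-nonNeg c c≥0 r r≤Σ R≤r zero          = x≤y⇒0≤y-x r≤Σ
  turn-nonNeg c c≥0 r r≤Σ R≤r (suc zero)    = x≤y⇒0≤y-x R≤r
  turn-nonNeg c c≥0 r r≤Σ R≤r (suc (suc j)) = c≥0 (suc j)

  -- Stated for all test functions that rise by a constant e between the levels: one identity then
  -- yields the total, the height and every base coordinate.
  turn : ∀ {k} z (w : LatticePoint n) (ws : Vec (LatticePoint n) k) (c : Vector Carrier (suc k)) r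
         (g : LatticePoint (suc n) → Carrier) (h : LatticePoint n → Carrier) e →
         (∀ w → g (z ∷ w) ≈ h w) → (∀ w → g (ℤ.suc z ∷ w) ≈ h w + e) →
         sum (λ j → turn-weights c r j * g (lookup (stair z zero (w ∷ ws)) j)) ≈
         sum (λ i → c i * h (lookup (w ∷ ws) i)) + r * e
  turn z w ws c r g h e gz gsz = begin
    (sum c - r) * g (z ∷ w) + ((r - R) * g (ℤ.suc z ∷ w) + sum (λ j → c (suc j) * g (lookup (Vec.map (ℤ.suc z ∷_) ws) j)))
      ≈⟨ +-cong (*-congˡ (gz w)) (+-cong (*-congˡ (gsz w)) rest) ⟩
    (sum c - r) * h w + ((r - R) * (h w + e) + (H + R * e))
      ≈⟨ solve 6 (λ c₀ R r h e H → ((c₀ :+ R) :- r) :* h :+ ((r :- R) :* (h :+ e) :+ (H :+ R :* e)) := (c₀ :* h :+ H) :+ r :* e)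
           refl (c zero) R r (h w) e H ⟩
    (c zero * h w + H) + r * e ∎
    where
    R = sum (c ∘ suc)
    H = sum (λ i → c (suc i) * h (lookup ws i))
    rest : sum (λ j → c (suc j) * g (lookup (Vec.map (ℤ.suc z ∷_) ws) j)) ≈ H + R * e
    rest = begin
      sum (λ j → c (suc j) * g (lookup (Vec.map (ℤ.suc z ∷_) ws) j))
        ≈⟨ sum-cong (λ j → *-congˡ (trans (reflexive (≡.cong g (Vecₚ.lookup-map j (ℤ.suc z ∷_) ws))) (gsz (lookup ws j)))) ⟩
      sum (λ j → c (suc j) * (h (lookup ws j) + e))
        ≈⟨ sum-cong (λ j → trans (distribˡ (c (suc j)) (h (lookup ws j)) e) (+-congˡ (*-comm (c (suc j)) e))) ⟩
      sum (λ j → c (suc j) * h (lookup ws j) + e * c (suc j))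
        ≈⟨ ∑-distrib-+ (λ j → c (suc j) * h (lookup ws j)) (λ j → e * c (suc j)) ⟩
      H + sum (λ j → e * c (suc j))
        ≈⟨ +-congˡ (trans (sym (*-distribˡ-sum e (c ∘ suc))) (*-comm e R)) ⟩
      H + R * e ∎

  -- Filling the vertices of a simplex from its last vertex up to a total of r
  -- finds the vertex at which the staircase turns.
  stair-weights : ∀ {k} z (ws : Vec (LatticePoint n) (suc k)) (c : Vector Carrier (suc k)) → (∀ i → 0# ≤ c i) →
    ∀ r → 0# ≤ r → r ≤ sum c → Σ (Fin (suc k)) λ i → Σ (Vector Carrier (suc (suc k))) λ d → (∀ j → 0# ≤ d j) ×
    (∀ (g : LatticePoint (suc n) → Carrier) (h : LatticePoint n → Carrier) e →
      (∀ w → g (z ∷ w) ≈ h w) → (∀ w → g (ℤ.suc z ∷ w) ≈ h w + e) →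
      sum (λ j → d j * g (lookup (stair z i ws) j)) ≈ sum (λ i → c i * h (lookup ws i)) + r * e)
  stair-weights z (w ∷ []) c c≥0 r r≥0 r≤Σ = zero , turn-weights c r , turn-nonNeg c c≥0 r r≤Σ r≥0 , turn z w [] c r
  stair-weights z (w ∷ ws@(_ ∷ _)) c c≥0 r r≥0 r≤Σ with ≤-total r (sum (c ∘ suc))
  ... | inj₂ R≤r = zero , turn-weights c r , turn-nonNeg c c≥0 r r≤Σ R≤r , turn z w ws c r
  ... | inj₁ r≤R with stair-weights z ws (c ∘ suc) (c≥0 ∘ suc) r r≥0 r≤R
  ...   | i , d , d≥0 , Σd = suc i , c zero Vector.∷ d , (λ { zero → c≥0 zero ; (suc j) → d≥0 j }) ,
          λ g h e gz gsz → trans (+-cong (*-congˡ (gz w)) (Σd g h e gz gsz)) (sym (+-assoc _ _ _))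

  module _ (T : OrientedTriangulation n) where
    open OrientedTriangulation T

    private
      Stair : VertexTuple (suc n) → Set
      Stair ρ = Σ (VertexTuple n) λ σ → ∃[ z ] ∃[ i ] Simplex σ × ρ ≡ stair z i σ

      above-asym : ∀ p q → Above _⊏_ p q → ¬ Above _⊏_ q p
      above-asym _ _ (inj₁ a)       (inj₁ b)       = ⊏-asym a b
      above-asym _ _ (inj₁ a)       (inj₂ (e , _)) = irreflexive a (≡.sym e)
      above-asym _ _ (inj₂ (e , _)) (inj₁ b)       = irreflexive b (≡.sym e)
      above-asym _ _ (inj₂ (_ , a)) (inj₂ (_ , b)) = ℤₚ.<-asym a b

      periodic′ : ∀ v {ρ} → Stair ρ → Stair (translate v ρ)
      periodic′ (y ∷ v) (σ , z , i , S , ≡.refl) = translate v σ , z ℤ.+ y , i , periodic v S , translate-stair y v z i σ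

      Climbs : ℤ → Measure (suc n) → Set
      Climbs z μ = ∀ w w′ → ¬ mass μ (z ∷ w) ≈ 0# → ¬ mass μ (ℤ.suc z ∷ w′) ≈ 0# → w ≡ w′ ⊎ w ⊏ w′

      climbs : ∀ z {ρ} → Stair ρ → ∀ μ → μ ⊩ (_∈ ρ) → Climbs z μ
      climbs z (σ , z′ , i , S , ≡.refl) μ h w w′ ≉0 ≉0′ = stair-climb _⊏_ z′ i (sorted S)
        (mass-support μ (_∈? stair z′ i σ) h ≉0) (mass-support μ (_∈? stair z′ i σ) h ≉0′) (z<suc[z] z)

      -- A vertex w on which ν has more mass at the top, and a vertex w′ on which μ
      -- has more, are both met by both measures: then w ⊑ w′ ⊑ w.
      no-crossing : ∀ z μ ν → μ ⊩ Level z → ν ⊩ Level z → Climbs z μ → Climbs z ν →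
        (∀ w → mass (push Vec.tail μ) w ≈ mass (push Vec.tail ν) w) → ∀ w w′ →
        ¬ mass ν (ℤ.suc z ∷ w) ≤ mass μ (ℤ.suc z ∷ w) → mass μ (ℤ.suc z ∷ w′) ≤ mass ν (ℤ.suc z ∷ w′)
      no-crossing z μ ν lev-μ lev-ν climb-μ climb-ν base w w′ ν≰μ with mass μ (ℤ.suc z ∷ w′) ≤? mass ν (ℤ.suc z ∷ w′)
      ... | yes μ≤ν = μ≤ν
      ... | no  μ≰ν = contradiction (climb-ν w′ w (bottom ν μ lev-ν lev-μ (sym ∘ base) w′ μ≰ν) (top ν μ w ν≰μ))
          (crossing (climb-μ w w′ (bottom μ ν lev-μ lev-ν base w ν≰μ) (top μ ν w′ μ≰ν)))
        where
        top : ∀ μ ν w → ¬ mass μ (ℤ.suc z ∷ w) ≤ mass ν (ℤ.suc z ∷ w) → ¬ mass μ (ℤ.suc z ∷ w) ≈ 0#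
        top μ ν w ≰ ≈0 = ≰ (≤-respˡ (sym ≈0) (mass-nonNeg ν (ℤ.suc z ∷ w)))
        bottom : ∀ μ ν → μ ⊩ Level z → ν ⊩ Level z → (∀ w → mass (push Vec.tail μ) w ≈ mass (push Vec.tail ν) w) →
                 ∀ w → ¬ mass ν (ℤ.suc z ∷ w) ≤ mass μ (ℤ.suc z ∷ w) → ¬ mass μ (z ∷ w) ≈ 0#
        bottom μ ν lev-μ lev-ν base w ≰ ≈0 = ≰ (≤-respʳ ν-total
          (≤-respˡ (+-identityˡ _) (+-mono-≤ (mass-nonNeg ν (z ∷ w)) (≤-refl {mass ν (ℤ.suc z ∷ w)}))))
          where
          ν-total : mass ν (z ∷ w) + mass ν (ℤ.suc z ∷ w) ≈ mass μ (ℤ.suc z ∷ w)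
          ν-total = begin
            mass ν (z ∷ w) + mass ν (ℤ.suc z ∷ w)  ≈⟨ mass-split z ν lev-ν w ⟩
            mass (push Vec.tail ν) w               ≈⟨ sym (base w) ⟩
            mass (push Vec.tail μ) w               ≈⟨ sym (mass-split z μ lev-μ w) ⟩
            mass μ (z ∷ w) + mass μ (ℤ.suc z ∷ w)  ≈⟨ +-congʳ ≈0 ⟩
            0# + mass μ (ℤ.suc z ∷ w)              ≈⟨ +-identityˡ _ ⟩
            mass μ (ℤ.suc z ∷ w)                   ∎
        crossing : w ≡ w′ ⊎ w ⊏ w′ → ¬ (w′ ≡ w ⊎ w′ ⊏ w)
        crossing (inj₁ ≡.refl) _             = ν≰μ (≰⇒≥ μ≰ν)
        crossing (inj₂ w⊏w′)   (inj₁ ≡.refl) = ν≰μ (≰⇒≥ μ≰ν)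
        crossing (inj₂ w⊏w′)   (inj₂ w′⊏w)   = ⊏-asym w⊏w′ w′⊏w

      level-mass : ∀ z (μ ν : Measure (suc n)) → μ ⊩ Level z → ν ⊩ Level z → (∀ w → mass (push Vec.tail μ) w ≈ mass (push Vec.tail ν) w) →
                   (∀ w → mass μ (ℤ.suc z ∷ w) ≈ mass ν (ℤ.suc z ∷ w)) → ∀ v → mass μ v ≈ mass ν v
      level-mass z μ ν lev-μ lev-ν base top (y ∷ w) with y ℤₚ.≟ ℤ.suc z | y ℤₚ.≟ z
      ... | yes ≡.refl | _          = top w
      ... | no _       | yes ≡.refl = +-cancelˡ _ _ _ (begin
        mass μ (ℤ.suc z ∷ w) + mass μ (z ∷ w)  ≈⟨ +-comm _ _ ⟩
        mass μ (z ∷ w) + mass μ (ℤ.suc z ∷ w)  ≈⟨ mass-split z μ lev-μ w ⟩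
        mass (push Vec.tail μ) w               ≈⟨ base w ⟩
        mass (push Vec.tail ν) w               ≈⟨ sym (mass-split z ν lev-ν w) ⟩
        mass ν (z ∷ w) + mass ν (ℤ.suc z ∷ w)  ≈⟨ +-comm _ _ ⟩
        mass ν (ℤ.suc z ∷ w) + mass ν (z ∷ w)  ≈⟨ +-congʳ (sym (top w)) ⟩
        mass μ (ℤ.suc z ∷ w) + mass ν (z ∷ w)  ∎)
      ... | no y≢1+z   | no y≢z     = trans (null μ lev-μ) (sym (null ν lev-ν))
        where
        null : ∀ μ → μ ⊩ Level z → mass μ (y ∷ w) ≈ 0#
        null μ lev = mass-zero μ (y ∷ w) (⊩-map (λ { (inj₁ e) ≡.refl → y≢z e ; (inj₂ e) ≡.refl → y≢1+z e }) lev)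

      -- Uniqueness in the base fixes the mass over each vertex, and the height fixes the mass of
      -- the whole upper level. There `no-crossing` makes one of the two measures dominate the
      -- other, and with equal sums they agree.
      unique′ : ∀ {ρ ρ′} → Stair ρ → Stair ρ′ → ∀ μ ν → μ ⊩ (_∈ ρ) → ν ⊩ (_∈ ρ′) → μ ≅ ν → ∀ v → mass μ v ≈ mass ν v
      unique′ R@(σ , z , i , S , ≡.refl) R′@(σ′ , z′ , i′ , S′ , ≡.refl) μ ν μ∈ ν∈ μ≅ν@(tot , bar) =
        level-mass z μ ν lev-μ lev-ν base tops
        where
        μ∈σ : μ ⊩ (λ p → Vec.tail p ∈ σ)
        μ∈σ = ⊩-map (stair-tail z i σ) μ∈
        push-≅ : push Vec.tail μ ≅ push Vec.tail ν
        push-≅ = tot , λ m → trans (tail-bar μ m) (trans (bar (suc m)) (sym (tail-bar ν m)))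
          where
          tail-bar : ∀ κ m → barycentre (push Vec.tail κ) m ≈ barycentre κ (suc m)
          tail-bar κ m = ∫-cong κ (λ p → ι (lookup (Vec.tail p) m)) (λ p → ι (lookup p (suc m))) (everywhere κ λ { (_ ∷ _) → refl })
        base : ∀ w → mass (push Vec.tail μ) w ≈ mass (push Vec.tail ν) w
        base = unique S S′ (push Vec.tail μ) (push Vec.tail ν) (ae (at μ∈σ)) (ae (at (⊩-map (stair-tail z′ i′ σ′) ν∈))) push-≅
        ν∈σ : ν ⊩ (λ p → Vec.tail p ∈ σ)
        ν∈σ = ae (at (⊩-transport (push Vec.tail μ) (push Vec.tail ν) (_∈? σ) base (ae (at μ∈σ))))
        unit : ∀ (p : LatticePoint (suc n)) → Between z p → Unit (height z) p
        unit p (l , u) = ≡.subst (0ℤ ℤ.≤_) (≡.sym (eval-height z p)) (ℤₚ.i≤j⇒0≤j-i l) ,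
          ≡.subst₂ ℤ._≤_ (≡.sym (eval-height z p)) (suc[z]-z z) (ℤₚ.+-monoˡ-≤ (ℤ.- z) u)
        unit⁻¹ : ∀ (p : LatticePoint (suc n)) → Unit (height z) p → Between z p
        unit⁻¹ p (l , u) = ℤₚ.0≤i-j⇒j≤i (≡.subst (0ℤ ℤ.≤_) (eval-height z p) l) ,
          ≡.subst₂ ℤ._≤_ (ℤₚ.+-assoc (Vec.head p) (ℤ.- z) z ⟨≡⟩ ≡.cong (λ d → Vec.head p ℤ.+ d) (ℤₚ.+-inverseˡ z) ⟨≡⟩ ℤₚ.+-identityʳ _) ≡.refl
            (ℤₚ.+-monoˡ-≤ z (≡.subst (ℤ._≤ 1ℤ) (eval-height z p) u))
          where
          infixr 5 _⟨≡⟩_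
          _⟨≡⟩_ = ≡.trans {A = ℤ}
        lev-μ : μ ⊩ Level z
        lev-μ = ⊩-map (λ {p} p∈ → Between⇒Level p (stair-Between z i σ p∈)) μ∈
        -- The measure ν is given on the layer of z′, which may differ from z; matching μ forces it
        -- onto the levels of z.
        lev-ν : ν ⊩ Level z
        lev-ν = ⊩-map (λ {p} u → Between⇒Level p (unit⁻¹ p u)) (confine-Unit μ ν (height z) (z′ ℤ.- z) μ≅ν
          (⊩-map (λ {p} p∈ → unit p (stair-Between z i σ p∈)) μ∈) (⊩-map (λ {p} p∈ → shifted p (stair-Between z′ i′ σ′ p∈)) ν∈))
          where
          shifted : ∀ p → Between z′ p → z′ ℤ.- z ℤ.≤ eval (height z) p × eval (height z) p ℤ.≤ ℤ.suc (z′ ℤ.- z)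
          shifted p (l , u) = ≡.subst (z′ ℤ.- z ℤ.≤_) (≡.sym (eval-height z p)) (ℤₚ.+-monoˡ-≤ (ℤ.- z) l) ,
            ≡.subst₂ ℤ._≤_ (≡.sym (eval-height z p)) (ℤₚ.+-assoc 1ℤ z′ (ℤ.- z)) (ℤₚ.+-monoˡ-≤ (ℤ.- z) u)
        t : Measure (suc n) → Fin (suc n) → Carrier
        t κ j = mass κ (ℤ.suc z ∷ lookup σ j)
        Σt : sum (t μ) ≈ sum (t ν)
        Σt = trans (sum-top z σ (distinct (sorted S)) μ lev-μ μ∈σ)
          (trans (∫-eval-≅ μ ν (height z) μ≅ν) (sym (sum-top z σ (distinct (sorted S)) ν lev-ν ν∈σ)))
        on-σ : ∀ j → t μ j ≈ t ν j
        on-σ with Finₚ.all? (λ j → t μ j ≤? t ν j)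
        ... | yes μ≤ν = sum-squeeze μ≤ν Σt
        ... | no ¬μ≤ν with Finₚ.¬∀⟶∃¬ _ (λ j → t μ j ≤ t ν j) (λ j → t μ j ≤? t ν j) ¬μ≤ν
        -- One vertex where μ exceeds ν forces ν to be at most μ at all the others.
        ...   | j , μ≰ν = λ i → sym (sum-squeeze {f = t ν} {t μ} (λ j′ → no-crossing z ν μ lev-ν lev-μ (climbs z R′ ν ν∈) (climbs z R μ μ∈)
                  (sym ∘ base) (lookup σ j) (lookup σ j′) μ≰ν) (sym Σt) i)
        tops : ∀ w → mass μ (ℤ.suc z ∷ w) ≈ mass ν (ℤ.suc z ∷ w)
        tops w with w ∈? σ
        ... | yes w∈σ = ≡.subst (λ v → mass μ (ℤ.suc z ∷ v) ≈ mass ν (ℤ.suc z ∷ v)) (≡.sym (lookup-index w∈σ)) (on-σ (Any.index w∈σ))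
        ... | no  w∉σ = trans (null μ μ∈σ) (sym (null ν ν∈σ))
          where
          null : ∀ κ → κ ⊩ (λ p → Vec.tail p ∈ σ) → mass κ (ℤ.suc z ∷ w) ≈ 0#
          null κ h = mass-zero κ (ℤ.suc z ∷ w) (⊩-map (λ p∈ e → w∉σ (≡.subst (λ p → Vec.tail p ∈ σ) e p∈)) h)

      cover′ : ∀ x → ∃[ ρ ] Stair ρ × Barycentric ρ x
      cover′ x with cover (x ∘ suc) | floor (x zero)
      -- The mass to be raised is the fractional height, which lies between 0 and 1, the sum of c.
      ... | σ , S , c , c≥0 , Σc , bar | z , z≤x , x≤1+z with
        stair-weights z σ c c≥0 (x zero - ι z) (x≤y⇒0≤y-x z≤x) (≤-respʳ (sym Σc)
          (≤-respʳ (trans (+-congʳ (trans (ι-+ 1ℤ z) (+-congʳ ι-1))) (solve 2 (λ o z → (o :+ z) :- z := o) refl 1# (ι z)))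
            (+-mono-≤ x≤1+z (≤-refl { - ι z}))))
      ...   | i , d , d≥0 , Σd = stair z i σ , (σ , z , i , S , ≡.refl) , d , d≥0 , total-d , coordinates
        where
        total-d : sum d ≈ 1#
        total-d = begin
          sum d                                          ≈⟨ sum-cong (λ j → sym (*-identityʳ (d j))) ⟩
          sum (λ j → d j * 1#)                           ≈⟨ Σd (λ _ → 1#) (λ _ → 1#) 0# (λ _ → refl) (λ _ → sym (+-identityʳ 1#)) ⟩
          sum (λ i → c i * 1#) + (x zero - ι z) * 0#     ≈⟨ +-cong (sum-cong λ i → *-identityʳ (c i)) (zeroʳ _) ⟩
          sum c + 0#                                     ≈⟨ +-identityʳ _ ⟩
          sum c                                          ≈⟨ Σc ⟩
          1#                                             ∎
        coordinates : ∀ m → sum (λ j → d j * ι (lookup (lookup (stair z i σ) j) m)) ≈ x m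
        coordinates zero = begin
          sum (λ j → d j * ι (lookup (lookup (stair z i σ) j) zero))
            ≈⟨ Σd (λ p → ι (lookup p zero)) (λ _ → ι z) 1# (λ _ → refl) (λ _ → trans (ι-+ 1ℤ z) (trans (+-congʳ ι-1) (+-comm _ _))) ⟩
          sum (λ i → c i * ι z) + (x zero - ι z) * 1#
            ≈⟨ +-cong (trans (sum-cong λ i → *-comm (c i) (ι z)) (trans (sym (*-distribˡ-sum (ι z) c)) (trans (*-congˡ Σc) (*-identityʳ (ι z))))) (*-identityʳ _) ⟩
          ι z + (x zero - ι z)
            ≈⟨ solve 2 (λ z x → z :+ (x :- z) := x) refl (ι z) (x zero) ⟩
          x zero ∎
        coordinates (suc m) = begin
          sum (λ j → d j * ι (lookup (lookup (stair z i σ) j) (suc m)))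
            ≈⟨ Σd (λ p → ι (lookup p (suc m))) (λ p → ι (lookup p m)) 0# (λ _ → refl) (λ _ → sym (+-identityʳ _)) ⟩
          sum (λ i → c i * ι (lookup (lookup σ i) m)) + (x zero - ι z) * 0#
            ≈⟨ trans (+-congˡ (zeroʳ _)) (+-identityʳ _) ⟩
          sum (λ i → c i * ι (lookup (lookup σ i) m))
            ≈⟨ bar m ⟩
          x (suc m) ∎

    _×ᴸ : OrientedTriangulation (suc n)
    _×ᴸ = record
      { Simplex  = Stair
      ; _⊏_      = Above _⊏_
      ; ⊏-asym   = λ {p} {q} → above-asym p q
      ; sorted   = λ { (σ , z , i , S , ≡.refl) → stair-sorted _⊏_ z i (sorted S) }
      ; periodic = periodic′
      ; cover    = cover′
      ; unique   = unique′
      }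

-- Uniqueness and covering for the four-dimensional triangulation

module Birkhoff (D : OrderedDomain) where
  open Lattice
  open Cells
  open Lemmas D hiding (solve; _:=_; _:+_; _:-_; _:*_; :-_; con)
  open Measures D
  open Measure
  open +-*-Solver using (solve; _:=_; _:+_; _:-_; _:*_; :-_; con)

  private
    variable
      n : ℕ

  Translate : VertexTuple 4 → Set
  Translate σ = ∃[ u ] ∃[ i ] σ ≡ translate u (cell i)

  ∈-translate⁻ : ∀ u {k} (ws : Vec (LatticePoint n) k) {p} → p ∈ Vec.map (_⊕ u) ws → p ⊖ u ∈ ws
  ∈-translate⁻ u ws = All.lookup {P = λ p → p ⊖ u ∈ ws}
    (Allₚ.map⁺ (All.map (λ {w} w∈ → ≡.subst (_∈ ws) (≡.sym (⊕-⊖ w u)) w∈) (∈-All ws)))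

  ∈-translate⁺ : ∀ u {k} (ws : Vec (LatticePoint n) k) {p} → p ⊖ u ∈ ws → p ∈ Vec.map (_⊕ u) ws
  ∈-translate⁺ u ws {p} h = ≡.subst (_∈ Vec.map (_⊕ u) ws) (⊖-⊕ p u) (∈-map⁺ (_⊕ u) h)

  ⊩-∀ : ∀ {k} {P : Fin k → LatticePoint n → Set} {μ : Measure n} → (∀ e → μ ⊩ P e) → μ ⊩ (λ p → ∀ e → P e p)
  ⊩-∀ {P = P} {μ} h = ae λ j → go j (weight μ j ≟ 0#)
    where
    go : ∀ j → Dec (weight μ j ≈ 0#) → weight μ j ≈ 0# ⊎ (∀ e → P e (point μ j))
    go j (yes w≈0) = inj₁ w≈0
    go j (no  w≉0) = inj₂ λ e → Sum.[ (λ w≈0 → contradiction w≈0 w≉0) , (λ p → p) ] (at (h e) j)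

  relative : LatticePoint n → Form n → Form n
  relative u (c ∷ a) = c ℤ.- dot a u ∷ a

  eval-relative : ∀ u (f : Form n) p → eval (relative u f) p ≡ eval f (p ⊖ u)
  eval-relative u (c ∷ a) p = ≡.trans (eval-+ (ℤ.- dot a u) c a p) (≡.trans (ℤₚ.+-assoc (c ℤ.* 1ℤ) (dot a p) (ℤ.- dot a u))
    (≡.cong (λ d → c ℤ.* 1ℤ ℤ.+ d) (≡.trans (≡.cong (λ q → dot a q ℤ.- dot a u) (≡.sym (⊖-⊕ p u)))
      (≡.trans (≡.cong (ℤ._- dot a u) (dot-⊕ a (p ⊖ u) u))
        (≡.trans (ℤₚ.+-assoc (dot a (p ⊖ u)) (dot a u) (ℤ.- dot a u))
          (≡.trans (≡.cong (λ d → dot a (p ⊖ u) ℤ.+ d) (ℤₚ.+-inverseʳ (dot a u))) (ℤₚ.+-identityʳ _)))))))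

  inBox⇒corner : ∀ i q → InBox i q → ∃[ a ] ∃[ b ] ∃[ c ] ∃[ d ] q ≡ corner a b c d
  inBox⇒corner i q@(x ∷ y ∷ z ∷ w ∷ []) h =
    let a , x≡ = bits (# 0) x (solve 4 (λ x y z w → con I :* x :+ (con O :* y :+ (con O :* z :+ (con O :* w :+ con O))) := x) ≡.refl x y z w)
        b , y≡ = bits (# 1) y (solve 4 (λ x y z w → con O :* x :+ (con I :* y :+ (con O :* z :+ (con O :* w :+ con O))) := y) ≡.refl x y z w)
        c , z≡ = bits (# 2) z (solve 4 (λ x y z w → con O :* x :+ (con O :* y :+ (con I :* z :+ (con O :* w :+ con O))) := z) ≡.refl x y z w)
        d , w≡ = bits (# 3) w (solve 4 (λ x y z w → con O :* x :+ (con O :* y :+ (con O :* z :+ (con I :* w :+ con O))) := w) ≡.refl x y z w)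
    in a , b , c , d , ≡.cong₂ _∷_ x≡ (≡.cong₂ _∷_ y≡ (≡.cong₂ _∷_ z≡ (≡.cong (_∷ []) w≡)))
    where
    bit-cases : ∀ t → O ℤ.≤ t → t ℤ.≤ I → ∃[ b ] t ≡ bit b
    bit-cases (+ 0) _ _ = zero , ≡.refl
    bit-cases (+ 1) _ _ = suc zero , ≡.refl
    bit-cases (+ suc (suc n)) _ (ℤ.+≤+ (ℕ.s≤s ()))
    bits : ∀ (e : Fin 4) t → dot (lookup entries (e ↑ˡ 5)) q ≡ t → ∃[ b ] t ≡ bit b
    bits e t ≡.refl = bit-cases t (≡.subst (ℤ._≤ t) (offset-unit i e) (proj₁ (h (e ↑ˡ 5))))
      (≡.subst (λ o → t ℤ.≤ ℤ.suc o) (offset-unit i e) (proj₂ (h (e ↑ˡ 5))))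

  -- On the vertices of a cell the indicator of one vertex agrees with a barycentric coordinate,
  -- which is affine; so the mass at that vertex is an integral fixed by `≅`.
  unique-in-cell : ∀ u i (μ ν : Measure 4) → μ ⊩ (_∈ translate u (cell i)) → ν ⊩ (_∈ translate u (cell i)) →
                   μ ≅ ν → ∀ v → mass μ v ≈ mass ν v
  unique-in-cell u i μ ν μ∈ ν∈ μ≅ν v with v ⊖ u ∈? cell i
  ... | no v∉ = trans (null μ μ∈) (sym (null ν ν∈))
    where
    null : ∀ κ → κ ⊩ (_∈ translate u (cell i)) → mass κ v ≈ 0#
    null κ h = mass-zero κ v (⊩-map (λ { p∈ ≡.refl → v∉ (∈-translate⁻ u (cell i) p∈) }) h)
  ... | yes v∈ = trans (integral μ μ∈) (trans (∫-eval-≅ μ ν G μ≅ν) (sym (integral ν ν∈)))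
    where
    m = Any.index v∈
    G = relative u (coordinate i m)
    value : ∀ {p} → p ∈ translate u (cell i) → δ v p ≈ ι (eval G p)
    value {p} p∈ = trans (compare (p ≟ₚ v) (m Finₚ.≟ m′)) (reflexive (≡.cong ι (≡.sym (≡.trans (eval-relative u (coordinate i m) p)
        (≡.trans (≡.cong (eval (coordinate i m)) (lookup-index q∈)) (coordinate-vertex i m m′))))))
      where
      q∈ = ∈-translate⁻ u (cell i) p∈
      m′ = Any.index q∈
      δℤ-≡ : ∀ {a b} → a ≡ b → δℤ a b ≡ I
      δℤ-≡ {a} {b} a≡b with a Finₚ.≟ b
      ... | yes _  = ≡.refl
      ... | no a≢b = contradiction a≡b a≢b
      δℤ-≢ : ∀ {a b} → a ≢ b → δℤ a b ≡ O
      δℤ-≢ {a} {b} a≢b with a Finₚ.≟ b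
      ... | yes a≡b = contradiction a≡b a≢b
      ... | no _    = ≡.refl
      compare : Dec (p ≡ v) → Dec (m ≡ m′) → δ v p ≈ ι (δℤ m m′)
      compare (yes p≡v) (yes m≡m′) = trans (δ-≡ p≡v) (trans (sym ι-1) (reflexive (≡.cong ι (≡.sym (δℤ-≡ m≡m′)))))
      compare (no p≢v)  (no m≢m′) = trans (δ-≢ p≢v) (trans (sym ι-0) (reflexive (≡.cong ι (≡.sym (δℤ-≢ m≢m′)))))
      compare (no p≢v)  (yes m≡m′) = contradiction (≡.trans (≡.sym (⊖-⊕ p u)) (≡.trans (≡.cong (_⊕ u)
        (≡.trans (lookup-index q∈) (≡.trans (≡.cong (lookup (cell i)) (≡.sym m≡m′)) (≡.sym (lookup-index v∈))))) (⊖-⊕ v u))) p≢v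
      compare (yes p≡v) (no m≢m′) = contradiction
        (≡.trans (≡.sym (δℤ-≡ {m} ≡.refl)) (≡.trans (≡.sym (coordinate-vertex i m m)) (≡.trans (≡.cong (eval (coordinate i m))
          (≡.trans (≡.sym (lookup-index v∈)) (≡.trans (≡.cong (_⊖ u) (≡.sym p≡v)) (lookup-index q∈))))
          (≡.trans (coordinate-vertex i m m′) (δℤ-≢ m≢m′))))) λ ()
    integral : ∀ κ → κ ⊩ (_∈ translate u (cell i)) → mass κ v ≈ ∫ κ (λ p → ι (eval G p))
    integral κ h = ∫-cong κ (δ v) (λ p → ι (eval G p)) (⊩-map value h)

  -- With cell i at u and cell j at u′: the dicing confines ν to the box of cell i,
  -- and there the coordinates of cell i exclude the omitted even permutation.
  module _ (u u′ : LatticePoint 4) (i j : Fin 24) (μ ν : Measure 4)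
           (μ∈ : μ ⊩ (_∈ translate u (cell i))) (ν∈ : ν ⊩ (_∈ translate u′ (cell j))) (μ≅ν : μ ≅ ν) where

    private
      slab : Fin 9 → Form 4
      slab e = ℤ.- offset i e ∷ lookup entries e

      eval-slab : ∀ e p → eval (slab e) p ≡ dot (lookup entries e) p ℤ.- offset i e
      eval-slab e p = ≡.trans (≡.cong (ℤ._+ dot (lookup entries e) p) (ℤₚ.*-identityʳ (ℤ.- offset i e))) (ℤₚ.+-comm (ℤ.- offset i e) _)

      unit⁺ : ∀ {q} → InBox i q → ∀ e → Unit (slab e) q
      unit⁺ {q} h e = ≡.subst (O ℤ.≤_) (≡.sym (eval-slab e q)) (ℤₚ.i≤j⇒0≤j-i (proj₁ (h e))) ,
        ≡.subst₂ ℤ._≤_ (≡.sym (eval-slab e q)) (suc[z]-z (offset i e)) (ℤₚ.+-monoˡ-≤ (ℤ.- offset i e) (proj₂ (h e)))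

      unit⁻ : ∀ {q} → (∀ e → Unit (slab e) q) → InBox i q
      unit⁻ {q} h e = ℤₚ.0≤i-j⇒j≤i (≡.subst (O ℤ.≤_) (eval-slab e q) (proj₁ (h e))) ,
        ℤₚ.i-j≤0⇒i≤j (≡.subst (ℤ._≤ O) (solve 2 (λ d o → (d :- o) :- con I := d :- (con I :+ o)) ≡.refl (dot (lookup entries e) q) (offset i e))
          (ℤₚ.i≤j⇒i-j≤0 (≡.subst (ℤ._≤ I) (eval-slab e q) (proj₂ (h e)))))

      relative-unit : ∀ {f : Form 4} p → Unit f (p ⊖ u) → Unit (relative u f) p
      relative-unit {f} p = ≡.subst (λ d → O ℤ.≤ d × d ℤ.≤ I) (≡.sym (eval-relative u f p))

      -- The dicing is invariant under the lattice, so a cell at u′ also lies between consecutive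
      -- levels of the forms centred at u, as `confine-Unit` requires. The level k is that of cell j
      -- shifted by the change of centre.
      ν-slab : ∀ e {p} → p ∈ translate u′ (cell j) → let k = offset j e ℤ.+ (dot (lookup entries e) u′ ℤ.- dot (lookup entries e) u ℤ.- offset i e) in
               k ℤ.≤ eval (relative u (slab e)) p × eval (relative u (slab e)) p ℤ.≤ ℤ.suc k
      ν-slab e {p} p∈ = ≡.subst (k ℤ.≤_) (≡.sym shift) (ℤₚ.+-monoˡ-≤ c (proj₁ b)) ,
        ≡.subst₂ ℤ._≤_ (≡.sym shift) (ℤₚ.+-assoc 1ℤ (offset j e) c) (ℤₚ.+-monoˡ-≤ c (proj₂ b))
        where
        a = lookup entries e
        c = dot a u′ ℤ.- dot a u ℤ.- offset i e
        k = offset j e ℤ.+ c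
        b = All.lookup (cell-inBox j) (∈-translate⁻ u′ (cell j) p∈) e
        shift : eval (relative u (slab e)) p ≡ dot a (p ⊖ u′) ℤ.+ c
        shift = ≡.trans (solve 4 (λ o x u y → ((:- o) :- u) :* con I :+ x := x :- u :- o) ≡.refl (offset i e) (dot a p) (dot a u) O)
          (≡.trans (≡.cong (λ d → d ℤ.- dot a u ℤ.- offset i e) (≡.trans (≡.cong (dot a) (≡.sym (⊖-⊕ p u′))) (dot-⊕ a (p ⊖ u′) u′)))
            (solve 4 (λ x y u o → (x :+ y) :- u :- o := x :+ (y :- u :- o)) ≡.refl (dot a (p ⊖ u′)) (dot a u′) (dot a u) (offset i e)))

      ν-box : ν ⊩ (λ p → InBox i (p ⊖ u))
      ν-box = ⊩-map (λ {p} h → unit⁻ λ e → ≡.subst (λ d → O ℤ.≤ d × d ℤ.≤ I) (eval-relative u (slab e) p) (h e)) (⊩-∀ λ e →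
        confine-Unit μ ν (relative u (slab e)) _ μ≅ν
          (⊩-map (λ {p} p∈ → relative-unit {slab e} p (unit⁺ (All.lookup (cell-inBox i) (∈-translate⁻ u (cell i) p∈)) e)) μ∈)
          (⊩-map (ν-slab e) ν∈))

      -- The m-th coordinate of cell i is nonnegative on μ and, the m-th vertex being absent,
      -- nonpositive on ν. Equal integrals make it vanish on ν, but it is negative at q.
      excluded : ∀ q m → Separates i q m → lookup (cell i) m ⊕ u ∉ translate u′ (cell j) → ν ⊩ (_≢ q ⊕ u)
      excluded q m (neg , nonPos) m∉ = ⊩-map (λ {p} z p≡ → ℤₚ.<-irrefl (value p≡ z) neg)
        (∫-nonNeg-zero ν (λ p → - F p) ν≥0 (≤-antisym ∫≤0 (∫-nonNeg ν (λ p → - F p) ν≥0)))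
        where
        G = relative u (coordinate i m)
        F = λ p → ι (eval G p)
        value : ∀ {p} → p ≡ q ⊕ u → - F p ≈ 0# → eval (coordinate i m) q ≡ O
        value ≡.refl z = ≡.trans (≡.cong (eval (coordinate i m)) (≡.sym (⊕-⊖ q u))) (≡.trans (≡.sym (eval-relative u (coordinate i m) (q ⊕ u)))
          (ι-injective (trans (sym (-‿involutive _)) (trans (-‿cong z) (trans -0#≈0# (sym ι-0))))))
        at-corner : ∀ {p} → InBox i (p ⊖ u) → p ∈ translate u′ (cell j) → 0# ≤ - F p
        at-corner {p} box p∈ with inBox⇒corner i (p ⊖ u) box
        ... | a , b , c , d , e = x≤0⇒0≤-x (≤-respʳ ι-0 (ι-mono (≡.subst (ℤ._≤ O) (≡.trans (≡.cong (eval (coordinate i m)) (≡.sym e))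
                (≡.sym (eval-relative u (coordinate i m) p)))
              (nonPos a b c d (≡.subst (InBox i) e box) λ e′ → m∉ (≡.subst (_∈ translate u′ (cell j))
                (≡.trans (≡.sym (⊖-⊕ p u)) (≡.cong (_⊕ u) (≡.trans e e′))) p∈)))))
        ν≥0 : ν ⊩ (λ p → 0# ≤ - F p)
        ν≥0 = ⊩-zip at-corner ν-box ν∈
        μ≥0 : μ ⊩ (λ p → 0# ≤ F p)
        μ≥0 = ⊩-map (λ {p} p∈ → ≤-respˡ ι-0 (ι-mono (≡.subst (O ℤ.≤_) (≡.sym (≡.trans (eval-relative u (coordinate i m) p)
          (≡.trans (≡.cong (eval (coordinate i m)) (lookup-index (∈-translate⁻ u (cell i) p∈))) (coordinate-vertex i m _))))
            (δℤ-nonNeg m _)))) μ∈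
          where
          δℤ-nonNeg : ∀ a b → O ℤ.≤ δℤ a b
          δℤ-nonNeg a b with a Finₚ.≟ b
          ... | yes _ = ℤ.+≤+ ℕ.z≤n
          ... | no _  = ℤ.+≤+ ℕ.z≤n
        ∫≤0 : ∫ ν (λ p → - F p) ≤ 0#
        ∫≤0 = ≤-respˡ (sym (∫-neg ν F)) (≤-respʳ -0#≈0# (neg-mono (≤-respʳ (∫-eval-≅ μ ν G μ≅ν) (∫-nonNeg μ F μ≥0))))

      -- If cell j lacks one of the two other even permutations, the coordinate of that vertex
      -- excludes q; if it has both, q is no vertex of it by `no-even-triangle`.
      omitted-null : ∀ q → Omitted i q → ν ⊩ (_≢ q ⊕ u)
      omitted-null q (t , m , m′ , (e , e′) , s , s′) =
        cases (lookup (cell i) m ⊕ u ∈? translate u′ (cell j)) (lookup (cell i) m′ ⊕ u ∈? translate u′ (cell j))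
        where
        exchange : ∀ {n} (q w u u′ : LatticePoint n) → (q ⊕ w ⊕ u) ⊖ u′ ≡ (q ⊕ u) ⊖ u′ ⊕ w
        exchange []       []       []       []        = ≡.refl
        exchange (q ∷ qs) (w ∷ ws) (u ∷ us) (u′ ∷ us′) = ≡.cong₂ _∷_
          (solve 4 (λ q w u u′ → ((q :+ w) :+ u) :- u′ := ((q :+ u) :- u′) :+ w) ≡.refl q w u u′) (exchange qs ws us us′)
        displace : ∀ q w {x} → x ≡ q ⊕ w → (x ⊕ u) ⊖ u′ ≡ (q ⊕ u) ⊖ u′ ⊕ w
        displace q w ≡.refl = exchange q w u u′
        cases : Dec (lookup (cell i) m ⊕ u ∈ translate u′ (cell j)) → Dec (lookup (cell i) m′ ⊕ u ∈ translate u′ (cell j)) → ν ⊩ (_≢ q ⊕ u)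
        cases (no ∉)   _        = excluded q m s ∉
        cases (yes _)  (no ∉)   = excluded q m′ s′ ∉
        cases (yes ∈₁) (yes ∈₂) = ⊩-map (λ { p∈ ≡.refl → All.lookup (no-even-triangle j) (∈-translate⁻ u′ (cell j) p∈) t
          ( ≡.subst (_∈ cell j) (displace q (proj₁ (lookup cycles t)) e) (∈-translate⁻ u′ (cell j) ∈₁)
          , ≡.subst (_∈ cell j) (displace q (proj₂ (lookup cycles t)) e′) (∈-translate⁻ u′ (cell j) ∈₂)) }) ν∈

    ν∈cell : ν ⊩ (_∈ translate u (cell i))
    ν∈cell = ae λ l → go l (at ν-box l)
      where
      go : ∀ l → weight ν l ≈ 0# ⊎ InBox i (point ν l ⊖ u) → weight ν l ≈ 0# ⊎ point ν l ∈ translate u (cell i)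
      go l (inj₁ w≈0) = inj₁ w≈0
      go l (inj₂ box) =
        let a , b , c , d , e = inBox⇒corner i (point ν l ⊖ u) box
        in Sum.[ (λ q∈ → inj₂ (∈-translate⁺ u (cell i) (≡.subst (_∈ cell i) (≡.sym e) q∈)))
               , (λ om → Sum.map₂ (λ p≢ → contradiction (≡.trans (≡.sym (⊖-⊕ (point ν l) u)) (≡.cong (_⊕ u) e)) p≢)
                           (at (omitted-null (corner a b c d) om) l))
               ] (box-vertices i a b c d (≡.subst (InBox i) e box))

  uniqueᴷ : ∀ {σ τ} → Translate σ → Translate τ → ∀ μ ν → μ ⊩ (_∈ σ) → ν ⊩ (_∈ τ) → μ ≅ ν → ∀ v → mass μ v ≈ mass ν v
  uniqueᴷ (u , i , ≡.refl) (u′ , j , ≡.refl) μ ν μ∈ ν∈ μ≅ν =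
    unique-in-cell u i μ ν μ∈ (ν∈cell u u′ i j μ ν μ∈ ν∈ μ≅ν) μ≅ν

  -- Point location

  dotᴿ-⊕ : ∀ (a b : Vec ℤ n) x → dotᴿ (a ⊕ b) x ≈ dotᴿ a x + dotᴿ b x
  dotᴿ-⊕ a b x = trans (sum-cong λ i → trans (*-congʳ (trans (reflexive (≡.cong ι (Vecₚ.lookup-zipWith ℤ._+_ i a b))) (ι-+ _ _)))
    (distribʳ (x i) (ι (lookup a i)) (ι (lookup b i)))) (∑-distrib-+ (λ i → ι (lookup a i) * x i) (λ i → ι (lookup b i) * x i))

  dotᴿ-negate : ∀ (a : Vec ℤ n) x → dotᴿ (negate a) x ≈ - dotᴿ a x
  dotᴿ-negate a x = trans (sum-cong λ i → trans (*-congʳ (trans (reflexive (≡.cong ι (Vecₚ.lookup-map i ℤ.-_ a))) (ι-neg _)))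
    (sym (-‿distribˡ-* (ι (lookup a i)) (x i)))) (sum-neg (λ i → ι (lookup a i) * x i))

  dotᴿ-scale : ∀ k (a : Vec ℤ n) x → dotᴿ (Vec.map (k ℤ.*_) a) x ≈ ι k * dotᴿ a x
  dotᴿ-scale k a x = trans (sum-cong λ i → trans (*-congʳ (trans (reflexive (≡.cong ι (Vecₚ.lookup-map i (k ℤ.*_) a))) (ι-* k (lookup a i))))
    (*-assoc (ι k) (ι (lookup a i)) (x i))) (sym (*-distribˡ-sum (ι k) (λ i → ι (lookup a i) * x i)))

  dotᴿ-0 : ∀ (x : Vector Carrier n) → dotᴿ (Vec.replicate n O) x ≈ 0#
  dotᴿ-0 {n} x = sum-0 λ i → trans (*-congʳ (trans (reflexive (≡.cong ι (Vecₚ.lookup-replicate i O))) ι-0)) (zeroˡ (x i))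

  dotᴿ-unit : ∀ (i : Fin n) x → dotᴿ (unit i) x ≈ x i
  dotᴿ-unit zero    x = trans (+-cong (trans (*-congʳ ι-1) (*-identityˡ (x zero))) (dotᴿ-0 (x ∘ suc))) (+-identityʳ (x zero))
  dotᴿ-unit (suc i) x = trans (+-cong (trans (*-congʳ ι-0) (zeroˡ (x zero))) (dotᴿ-unit i (x ∘ suc))) (+-identityˡ (x (suc i)))

  dotᴿ-lincomb : ∀ {k} (as : Vec ℤ k) (fs : Vec (Vec ℤ n) k) x →
                 dotᴿ (lincomb as fs) x ≈ sum (λ m → ι (lookup as m) * dotᴿ (lookup fs m) x)
  dotᴿ-lincomb []       []       x = dotᴿ-0 x
  dotᴿ-lincomb (a ∷ as) (g ∷ fs) x = trans (dotᴿ-⊕ (Vec.map (a ℤ.*_) g) (lincomb as fs) x)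
    (+-cong (dotᴿ-scale a g x) (dotᴿ-lincomb as fs x))

  NonNegAt : Vector Carrier 5 → Form 4 → Set
  NonNegAt x g = 0# ≤ dotᴿ g x

  total-nonNeg : ∀ x {known} gs → ListAll.All (NonNegAt x) known → ListAll.All (_∈ᴸ known) gs → NonNegAt x (total-form gs)
  total-nonNeg x [] h ListAll.[] = ≤-reflexive (sym (dotᴿ-0 x))
  total-nonNeg x (g ∷ gs) h (g∈ ListAll.∷ gs∈) = ≤-respʳ (sym (dotᴿ-⊕ g (total-form gs) x))
    (+-nonNeg (ListAll.lookup h g∈) (total-nonNeg x gs h gs∈))

  locate : ∀ x {known} t → ListAll.All (NonNegAt x) known → Locates known t → ∃[ i ] ∀ m → NonNegAt x (coordinate i m)
  locate x (leaf i) h ok = i , λ m → ListAll.lookup h (ok m)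
  locate x (split g l r) h (okˡ , okʳ) with ≤-total 0# (dotᴿ g x)
  ... | inj₁ 0≤g = locate x l (0≤g ListAll.∷ h) okˡ
  ... | inj₂ g≤0 = locate x r (≤-respʳ (sym (dotᴿ-negate g x)) (x≤0⇒0≤-x g≤0) ListAll.∷ h) okʳ
  locate x (derive gs t) h (gs∈ , ok) = locate x t (total-nonNeg x gs h gs∈ ListAll.∷ h) ok

  unit-cube-nonNeg : ∀ (x : Vector Carrier 4) → (∀ i → 0# ≤ x i) → (∀ i → x i ≤ 1#) → ListAll.All (NonNegAt (1# Vector.∷ x)) unit-cube
  unit-cube-nonNeg x 0≤x x≤1 = lower (# 0) ListAll.∷ lower (# 1) ListAll.∷ lower (# 2) ListAll.∷ lower (# 3) ListAll.∷
    upper (# 0) ListAll.∷ upper (# 1) ListAll.∷ upper (# 2) ListAll.∷ upper (# 3) ListAll.∷ ListAll.[]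
    where
    z = 1# Vector.∷ x
    lower : ∀ i → NonNegAt z (unit (suc i))
    lower i = ≤-respʳ (sym (dotᴿ-unit (suc i) z)) (0≤x i)
    upper : ∀ i → NonNegAt z (unit zero ⊕ negate (unit (suc i)))
    upper i = ≤-respʳ (sym (trans (dotᴿ-⊕ (unit zero) (negate (unit (suc i))) z)
      (+-cong (dotᴿ-unit zero z) (trans (dotᴿ-negate (unit (suc i)) z) (-‿cong (dotᴿ-unit (suc i) z)))))) (x≤y⇒0≤y-x (x≤1 i))

  coverᴷ : ∀ x → ∃[ σ ] Translate σ × Barycentric σ x
  coverᴷ x = result (locate (1# Vector.∷ y) location
      (unit-cube-nonNeg y (λ i → x≤y⇒0≤y-x (proj₁ (proj₂ (floor (x i))))) (λ i → ≤-respʳ (top i) (+-mono-≤ (proj₂ (proj₂ (floor (x i)))) ≤-refl)))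
      location-locates)
    where
    u : LatticePoint 4
    u = Vec.tabulate (λ i → proj₁ (floor (x i)))
    y : Vector Carrier 4
    y i = x i - ι (proj₁ (floor (x i)))
    top : ∀ i → ι (ℤ.suc (proj₁ (floor (x i)))) - ι (proj₁ (floor (x i))) ≈ 1#
    top i = trans (sym (ι-- _ _)) (trans (reflexive (≡.cong ι (suc[z]-z (proj₁ (floor (x i)))))) ι-1)
    result : (∃[ i ] ∀ m → NonNegAt (1# Vector.∷ y) (coordinate i m)) → ∃[ σ ] Translate σ × Barycentric σ x
    result (i , c≥0) = translate u (cell i) , (u , i , ≡.refl) , c , c≥0 , Σc , coordinates-x
      where
      z = 1# Vector.∷ y
      c : Vector Carrier 5
      c m = dotᴿ (coordinate i m) z
      Σc : sum c ≈ 1#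
      Σc = begin
        sum c                                                   ≈⟨ sum-cong (λ m → sym (trans (*-congʳ (trans (reflexive (≡.cong ι (Vecₚ.lookup-replicate m I))) ι-1)) (*-identityˡ (c m)))) ⟩
        sum (λ m → ι (lookup (Vec.replicate 5 I) m) * c m)      ≈⟨ sym (dotᴿ-lincomb (Vec.replicate 5 I) (lookup coordinates i) z) ⟩
        dotᴿ (lincomb (Vec.replicate 5 I) (lookup coordinates i)) z  ≈⟨ reflexive (≡.cong (λ g → dotᴿ g z) (coordinates-sum i)) ⟩
        dotᴿ (unit zero) z                                      ≈⟨ dotᴿ-unit zero z ⟩
        1#                                                      ∎
      Σcp : ∀ l → sum (λ m → c m * ι (lookup (lookup (cell i) m) l)) ≈ y l
      Σcp l = begin
        sum (λ m → c m * ι (lookup (lookup (cell i) m) l))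
          ≈⟨ sum-cong (λ m → trans (*-comm (c m) (ι (lookup (lookup (cell i) m) l))) (*-congʳ (reflexive (≡.cong ι (≡.sym (Vecₚ.lookup-map m (λ p → lookup p l) (cell i))))))) ⟩
        sum (λ m → ι (lookup (Vec.map (λ p → lookup p l) (cell i)) m) * c m)
          ≈⟨ sym (dotᴿ-lincomb (Vec.map (λ p → lookup p l) (cell i)) (lookup coordinates i) z) ⟩
        dotᴿ (lincomb (Vec.map (λ p → lookup p l) (cell i)) (lookup coordinates i)) z
          ≈⟨ reflexive (≡.cong (λ g → dotᴿ g z) (coordinates-barycentric i l)) ⟩
        dotᴿ (unit (suc l)) z
          ≈⟨ dotᴿ-unit (suc l) z ⟩
        y l ∎
      entry : ∀ m l → lookup (lookup (translate u (cell i)) m) l ≡ lookup (lookup (cell i) m) l ℤ.+ proj₁ (floor (x l))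
      entry m l = ≡.trans (≡.cong (λ p → lookup p l) (Vecₚ.lookup-map m (_⊕ u) (cell i)))
        (≡.trans (Vecₚ.lookup-zipWith ℤ._+_ l (lookup (cell i) m) u) (≡.cong (λ d → lookup (lookup (cell i) m) l ℤ.+ d) (Vecₚ.lookup∘tabulate (λ i → proj₁ (floor (x i))) l)))
      coordinates-x : ∀ l → sum (λ m → c m * ι (lookup (lookup (translate u (cell i)) m) l)) ≈ x l
      coordinates-x l = begin
        sum (λ m → c m * ι (lookup (lookup (translate u (cell i)) m) l))
          ≈⟨ sum-cong (λ m → trans (*-congˡ (trans (reflexive (≡.cong ι (entry m l))) (ι-+ (lookup (lookup (cell i) m) l) k))) (trans (distribˡ (c m) (ι (lookup (lookup (cell i) m) l)) (ι k)) (+-congˡ (*-comm (c m) (ι k))))) ⟩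
        sum (λ m → c m * ι (lookup (lookup (cell i) m) l) + ι k * c m)
          ≈⟨ trans (∑-distrib-+ (λ m → c m * ι (lookup (lookup (cell i) m) l)) (λ m → ι k * c m)) (+-cong (Σcp l) (trans (sym (*-distribˡ-sum (ι k) c)) (trans (*-congˡ Σc) (*-identityʳ (ι k))))) ⟩
        (x l - ι k) + ι k
          ≈⟨ trans (+-assoc _ _ _) (trans (+-congˡ (-‿inverseˡ (ι k))) (+-identityʳ (x l))) ⟩
        x l ∎
        where k = proj₁ (floor (x l))

  translate-translate : ∀ w u {k} (ws : Vec (LatticePoint n) k) → Vec.map (_⊕ w) (Vec.map (_⊕ u) ws) ≡ Vec.map (_⊕ (u ⊕ w)) ws
  translate-translate w u ws = ≡.trans (≡.sym (Vecₚ.map-∘ (_⊕ w) (_⊕ u) ws)) (Vecₚ.map-cong (λ p → ⊕-assoc p u w) ws)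

  birkhoff : OrientedTriangulation 4
  birkhoff = record
    { Simplex  = Translate
    ; _⊏_      = _⊏ᴷ_
    ; ⊏-asym   = λ {p} {q} → ⊏ᴷ-asym {p} {q}
    ; sorted   = λ { (u , i , ≡.refl) → sorted-translate u (cell-sorted i) }
    ; periodic = λ { w (u , i , ≡.refl) → u ⊕ w , i , translate-translate w u (cell i) }
    ; cover    = coverᴷ
    ; unique   = uniqueᴷ
    }

-- From unique weights to a face-to-face triangulation

module Geometry (D : OrderedDomain) where
  open Lattice
  open Lemmas D
  open Measures D
  open Measure

  private
    variable
      k n : ℕ

  -- The geometric notions are restated over the ordered domain; at the reals they unfold to those
  -- of the theorem, so results carry over without conversion.
  Point : ℕ → Set
  Point m = Vector Carrier m

  infix 4 _≋_
  _≋_ : Point n → Point n → Set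
  p ≋ q = ∀ i → p i ≈ q i

  ⟨_,_⟩ : Point n → Point n → Carrier
  ⟨ a , p ⟩ = sum (λ i → a i * p i)

  combination : Vector Carrier k → Vector (Point n) k → Point n
  combination c p i = sum (λ j → c j * p j i)

  conv : Pred (Point n) 0ℓ → Pred (Point n) 0ℓ
  conv S x = ∃[ k ] Σ (Vector Carrier k) λ c → Σ (Vector (Point _) k) λ p →
    (∀ j → S (p j)) × (∀ j → 0# ≤ c j) × sum c ≈ 1# × x ≋ combination c p

  toPoint : LatticePoint n → Point n
  toPoint v i = ι (lookup v i)

  vertex : VertexTuple n → Fin (suc n) → Point n
  vertex σ i = toPoint (lookup σ i)

  hull : VertexTuple n → Pred (Point n) 0ℓ
  hull σ = conv (λ p → ∃[ i ] p ≋ vertex σ i)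

  conv-mono : (S T : Pred (Point n) 0ℓ) → (∀ p → S p → T p) → ∀ x → conv S x → conv T x
  conv-mono S T S⊆T x (k , c , p , p∈S , rest) = k , c , p , (λ j → S⊆T (p j) (p∈S j)) , rest

  conv-point : (S : Pred (Point n) 0ℓ) → ∀ p → S p → conv S p
  conv-point S p Sp = 1 , (λ _ → 1#) , (λ _ → p) , (λ _ → Sp) , (λ _ → 0≤1) , +-identityʳ 1# ,
    λ i → sym (trans (+-identityʳ (1# * p i)) (*-identityˡ (p i)))

  sum≈total : (μ : Measure n) → sum (weight μ) ≈ total μ
  sum≈total μ = sum-cong λ j → sym (*-identityʳ (weight μ j))

  total≉0 : (μ : Measure n) → total μ ≈ 1# → ¬ sum (weight μ) ≈ 0#
  total≉0 μ t s≈0 = 1≉0 (trans (sym t) (trans (sym (sum≈total μ)) s≈0))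

  conv-measure : (S : Pred (Point n) 0ℓ) (μ : Measure n) → μ ⊩ (S ∘ toPoint) → total μ ≈ 1# →
                 ∀ x → x ≋ barycentre μ → conv S x
  conv-measure S μ h t x x≋ = size μ , weight μ , p , (λ j → proj₁ (proj₂ (choose j))) , nonNeg μ ,
      trans (sum≈total μ) t , λ i → trans (x≋ i) (sum-cong λ j → sym (proj₂ (proj₂ (choose j)) i))
    where
    -- Points of weight zero may lie outside S, so a point of S stands in for them; one exists
    -- because the weights do not sum to zero.
    default = ⊩-∃ (total≉0 μ t) h
    pick : ∀ j → weight μ j ≈ 0# ⊎ S (toPoint (point μ j)) →
           Σ (Point _) λ q → S q × (∀ i → weight μ j * q i ≈ weight μ j * toPoint (point μ j) i)
    pick j (inj₂ s)   = toPoint (point μ j) , s , λ i → refl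
    pick j (inj₁ w≈0) = toPoint (point μ (proj₁ default)) , proj₂ default ,
      λ i → trans (*-congʳ w≈0) (trans (zeroˡ _) (sym (trans (*-congʳ w≈0) (zeroˡ _))))
    choose : ∀ j → Σ (Point _) λ q → S q × (∀ i → weight μ j * q i ≈ weight μ j * toPoint (point μ j) i)
    choose j = pick j (at h j)
    p : Vector (Point _) (size μ)
    p j = proj₁ (choose j)

  hull-measure : ∀ (σ : VertexTuple n) {x} → hull σ x → Σ (Measure n) λ μ → μ ⊩ (_∈ σ) × total μ ≈ 1# × barycentre μ ≋ x
  hull-measure σ (k , c , p , on , c≥0 , Σc , x≋) = measure c (λ j → lookup σ (proj₁ (on j))) c≥0 ,
    ae (λ j → inj₂ (∈-lookup (proj₁ (on j)) σ)) , trans (sum-cong λ j → *-identityʳ (c j)) Σc ,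
    λ i → sym (trans (x≋ i) (sum-cong λ j → *-congˡ (proj₂ (on j) i)))

  vertex-hull : ∀ (σ : VertexTuple n) {v} → v ∈ σ → hull σ (toPoint v)
  vertex-hull σ {v} v∈ = conv-point (λ p → ∃[ i ] p ≋ vertex σ i) (toPoint v) (Any.index v∈ , λ i → reflexive (≡.cong (λ p → ι (lookup p i)) (lookup-index v∈)))

  toPoint-injective : ∀ (p q : LatticePoint n) → toPoint p ≋ toPoint q → p ≡ q
  toPoint-injective []       []       _ = ≡.refl
  toPoint-injective (x ∷ p) (y ∷ q) h = ≡.cong₂ _∷_ (ι-injective (h zero)) (toPoint-injective p q (h ∘ suc))

  mass-vertex : (ws : Vec (LatticePoint n) k) → AllPairs _≢_ ws → ∀ (c : Vector Carrier k) j →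
                sum (λ i → c i * δ (lookup ws j) (lookup ws i)) ≈ c j
  mass-vertex (w ∷ ws) (w≢ ∷ ws≢) c zero = trans
    (+-cong (trans (*-congˡ (δ-≡ {v = w} ≡.refl)) (*-identityʳ (c zero)))
      (sum-0 λ i → trans (*-congˡ (δ-≢ {v = w} (All.lookup w≢ (∈-lookup i ws) ∘ ≡.sym))) (zeroʳ (c (suc i)))))
    (+-identityʳ (c zero))
  mass-vertex (w ∷ ws) (w≢ ∷ ws≢) c (suc j) = trans
    (+-cong (trans (*-congˡ (δ-≢ {v = lookup ws j} {p = w} (All.lookup w≢ (∈-lookup j ws)))) (zeroʳ (c zero))) (mass-vertex ws ws≢ (c ∘ suc) j))
    (+-identityˡ (c (suc j)))

  module _ (T : OrientedTriangulation n) where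
    open OrientedTriangulation T

    -- Split the coefficients into positive and negative parts: two measures on the
    -- same simplex with the same total and barycentre.
    independent : ∀ σ → Simplex σ → (c : Vector Carrier (suc n)) → sum c ≈ 0# →
                  combination c (vertex σ) ≋ (λ _ → 0#) → ∀ j → c j ≈ 0#
    independent σ S c Σc≈0 Σcσ≈0 j = trans (sym (difference j)) (trans (+-congʳ (begin
        pos j                     ≈⟨ sym (mass-vertex σ σ-distinct pos j) ⟩
        mass P (lookup σ j)       ≈⟨ unique S S P Q (everywhere-σ P-point) (everywhere-σ Q-point) P≅Q (lookup σ j) ⟩
        mass Q (lookup σ j)       ≈⟨ mass-vertex σ σ-distinct neg j ⟩
        neg j                     ∎)) (-‿inverseʳ (neg j)))
      where
      σ-distinct = distinct (sorted S)
      parts : ∀ x → Dec (0# ≤ x) → Σ Carrier λ p → Σ Carrier λ q → 0# ≤ p × 0# ≤ q × p - q ≈ x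
      parts x (yes 0≤x) = x , 0# , 0≤x , ≤-refl , trans (+-congˡ -0#≈0#) (+-identityʳ x)
      parts x (no  0≰x) = 0# , - x , ≤-refl , x≤0⇒0≤-x (≰⇒≥ 0≰x) , trans (+-identityˡ _) (-‿involutive x)
      pos neg : Vector Carrier (suc n)
      pos i = proj₁ (parts (c i) (0# ≤? c i))
      neg i = proj₁ (proj₂ (parts (c i) (0# ≤? c i)))
      difference : ∀ i → pos i - neg i ≈ c i
      difference i = proj₂ (proj₂ (proj₂ (proj₂ (parts (c i) (0# ≤? c i)))))
      P Q : Measure n
      P = measure pos (lookup σ) (λ i → proj₁ (proj₂ (proj₂ (parts (c i) (0# ≤? c i)))))
      Q = measure neg (lookup σ) (λ i → proj₁ (proj₂ (proj₂ (proj₂ (parts (c i) (0# ≤? c i))))))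
      P-point : ∀ i → point P i ∈ σ
      P-point i = ∈-lookup i σ
      Q-point : ∀ i → point Q i ∈ σ
      Q-point i = ∈-lookup i σ
      everywhere-σ : ∀ {κ : Measure n} → (∀ i → point κ i ∈ σ) → κ ⊩ (_∈ σ)
      everywhere-σ h = ae λ i → inj₂ (h i)
      equal : ∀ (g : Vector Carrier (suc n)) → sum (λ i → c i * g i) ≈ 0# → sum (λ i → pos i * g i) ≈ sum (λ i → neg i * g i)
      equal g Σ≈0 = x∙y⁻¹≈ε⇒x≈y _ _ (begin
        sum (λ i → pos i * g i) - sum (λ i → neg i * g i)     ≈⟨ +-congˡ (sym (sum-neg (λ i → neg i * g i))) ⟩
        sum (λ i → pos i * g i) + sum (λ i → - (neg i * g i)) ≈⟨ sym (∑-distrib-+ (λ i → pos i * g i) (λ i → - (neg i * g i))) ⟩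
        sum (λ i → pos i * g i - neg i * g i)                 ≈⟨ sum-cong (λ i → trans
          (solve 3 (λ p q g → p :* g :- q :* g := (p :- q) :* g) refl (pos i) (neg i) (g i)) (*-congʳ (difference i))) ⟩
        sum (λ i → c i * g i)                                 ≈⟨ Σ≈0 ⟩
        0# ∎)
      P≅Q : P ≅ Q
      P≅Q = equal (λ _ → 1#) (trans (sum-cong λ i → *-identityʳ (c i)) Σc≈0) , λ m → equal (λ i → vertex σ i m) (Σcσ≈0 m)

    has-vertex : ∀ v → ∃[ σ ] Simplex σ × v ∈ σ
    has-vertex v with cover (λ _ → 0#)
    ... | σ@(w ∷ _) , S , _ = translate (v ⊖ w) σ , periodic (v ⊖ w) S , here (≡.sym (returns w v))
      where
      returns : ∀ {m} (w v : LatticePoint m) → w ⊕ (v ⊖ w) ≡ v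
      returns w v = ≡.trans (Vecₚ.zipWith-comm ℤₚ.+-comm w (v ⊖ w)) (⊖-⊕ v w)

    covers : ∀ x → ∃[ σ ] Simplex σ × hull σ x
    covers x with cover x
    ... | σ , S , c , c≥0 , Σc , bar = σ , S , suc n , c , vertex σ , (λ j → j , λ _ → refl) , c≥0 , Σc , λ m → sym (bar m)

    does⇒ : ∀ {A : Set} (a? : Dec A) → does a? ≡ true → A
    does⇒ (yes a) _ = a

    common : VertexTuple n → VertexTuple n → Subset (suc n)
    common σ τ = Vec.tabulate (λ i → does (lookup σ i ∈? τ))

    ∈-common⁺ : ∀ σ τ i → lookup σ i ∈ τ → i Subset.∈ common σ τ
    ∈-common⁺ σ τ i h = Vecₚ.lookup⇒[]= i (common σ τ) (≡.trans (Vecₚ.lookup∘tabulate (λ i → does (lookup σ i ∈? τ)) i) (dec-true (lookup σ i ∈? τ) h))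

    ∈-common⁻ : ∀ σ τ i → i Subset.∈ common σ τ → lookup σ i ∈ τ
    ∈-common⁻ σ τ i h = does⇒ (lookup σ i ∈? τ) (≡.trans (≡.sym (Vecₚ.lookup∘tabulate (λ i → does (lookup σ i ∈? τ)) i)) (Vecₚ.[]=⇒lookup h))

    Shared : VertexTuple n → VertexTuple n → Pred (Point n) 0ℓ
    Shared σ τ p = ∃[ i ] i Subset.∈ common σ τ × p ≋ vertex σ i

    -- A point of both hulls has a measure on σ and one on τ. By `unique` their masses agree, so the
    -- first is carried by the common vertices.
    common-face : ∀ σ τ → Simplex σ → Simplex τ →
                  (hull σ ∩ hull τ) ≐ conv (Shared σ τ)
    common-face σ τ S S′ = (λ {x} → to x) , (λ {x} → from x)
      where
      to : ∀ x → (hull σ ∩ hull τ) x → conv (Shared σ τ) x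
      to x (x∈σ , x∈τ) with hull-measure σ x∈σ | hull-measure τ x∈τ
      ... | μ , μ∈σ , t , b | ν , ν∈τ , t′ , b′ = conv-measure (Shared σ τ) μ (⊩-zip shared μ∈σ μ∈τ) t x (λ i → sym (b i))
        where
        μ∈τ : μ ⊩ (_∈ τ)
        μ∈τ = ⊩-transport ν μ (_∈? τ) (unique S′ S ν μ ν∈τ μ∈σ (trans t′ (sym t) , λ i → trans (b′ i) (sym (b i)))) ν∈τ
        shared : ∀ {p} → p ∈ σ → p ∈ τ → Shared σ τ (toPoint p)
        shared p∈σ p∈τ = Any.index p∈σ , ∈-common⁺ σ τ _ (≡.subst (_∈ τ) (lookup-index p∈σ) p∈τ) ,
          λ m → reflexive (≡.cong (λ p → ι (lookup p m)) (lookup-index p∈σ))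
      from : ∀ x → conv (Shared σ τ) x → (hull σ ∩ hull τ) x
      from x h = conv-mono (Shared σ τ) (λ p → ∃[ i ] p ≋ vertex σ i) (λ { p (i , _ , e) → i , e }) x h , conv-mono (Shared σ τ) (λ p → ∃[ i ] p ≋ vertex τ i) (λ { p (i , i∈ , e) →
        Any.index (∈-common⁻ σ τ i i∈) , λ m → trans (e m) (reflexive (≡.cong (λ p → ι (lookup p m)) (lookup-index (∈-common⁻ σ τ i i∈)))) }) x h

    face-to-face : ∀ σ τ → Simplex σ → Simplex τ →
      (Σ (Subset (suc n)) λ s → (hull σ ∩ hull τ) ≐ conv (λ p → ∃[ i ] i Subset.∈ s × p ≋ vertex σ i)) ×
      (Σ (Subset (suc n)) λ s → (hull σ ∩ hull τ) ≐ conv (λ p → ∃[ i ] i Subset.∈ s × p ≋ vertex τ i))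
    face-to-face σ τ S S′ = (common σ τ , common-face σ τ S S′) ,
      common τ σ , (λ {x} h → proj₁ (common-face τ σ S′ S) {x} (swap h)) , (λ {x} h → swap (proj₂ (common-face τ σ S′ S) {x} h))

    translate-back : ∀ v {k} (ws : Vec (LatticePoint n) k) → Vec.map (_⊕ v) (Vec.map (_⊕ negate v) ws) ≡ ws
    translate-back v ws = ≡.trans (≡.sym (Vecₚ.map-∘ (_⊕ v) (_⊕ negate v) ws)) (≡.trans (Vecₚ.map-cong (λ w → cancel w v) ws) (Vecₚ.map-id ws))
      where
      cancel : ∀ {m} (w v : LatticePoint m) → (w ⊕ negate v) ⊕ v ≡ w
      cancel []      []      = ≡.refl
      cancel (w ∷ ws) (v ∷ vs) = ≡.cong₂ _∷_ (≡.cong Vec.head (⊖-⊕ (w ∷ []) (v ∷ []))) (cancel ws vs)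

    -- Some simplex has x as a vertex and so carries the point mass at x. By `unique` every measure
    -- on σ with total 1 and barycentre x is concentrated at x.
    lattice-hull : ∀ {σ} → Simplex σ → ∀ x → hull σ (toPoint x) → x ∈ σ
    lattice-hull {σ} S x x∈ with hull-measure σ x∈ | has-vertex x
    ... | μ , μ∈σ , t , b | τ , S′ , x∈τ = let j , p∈σ , p≡x = ⊩-∃ (total≉0 μ t) both in ≡.subst (_∈ σ) p≡x p∈σ
      where
      μ≅x : dirac x ≅ μ
      μ≅x = trans (∫-dirac x (λ _ → 1#)) (sym t) , λ i → trans (∫-dirac x (λ p → ι (lookup p i))) (sym (b i))
      both : μ ⊩ (λ p → p ∈ σ × p ≡ x)
      both = ⊩-zip _,_ μ∈σ (⊩-transport (dirac x) μ (_≟ₚ x)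
        (unique S′ S (dirac x) μ (ae λ _ → inj₂ x∈τ) μ∈σ μ≅x) (ae λ _ → inj₂ ≡.refl))

-- Supporting functionals and the failure of regularity

module NonRegularity (D : OrderedDomain) where
  open Lattice
  open Lemmas D
  open Measures D
  open Measure
  open Geometry D

  private
    variable
      k n : ℕ

  IsFace : Pred (Point n) 0ℓ → Pred (Point n) 0ℓ → Set
  IsFace {n} P F = Σ (Point n) λ a → Σ Carrier λ b → (∀ y → P y → ⟨ a , y ⟩ ≤ b) × F ≐ (P ∩ λ y → ⟨ a , y ⟩ ≈ b)

  lift : Point n → Carrier → Point (suc n)
  lift x h = h Vector.∷ x

  project : Pred (Point (suc n)) 0ℓ → Pred (Point n) 0ℓ
  project F x = ∃[ p ] F p × Vector.tail p ≋ x

  Graph : (LatticePoint n → Carrier) → Pred (Point (suc n)) 0ℓ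
  Graph f p = ∃[ x ] p ≋ lift (toPoint x) (f x)

  H : (LatticePoint n → Carrier) → Pred (Point (suc n)) 0ℓ
  H f = conv (Graph f)

  -- Three parallelograms a_i, a_{i+1}, b_{i+1}, b_i, arranged as a prism; the
  -- diagonals a_i b_{i+1} are edges of the triangulation.
  record TwistedPrism (T : OrientedTriangulation n) : Set where
    open OrientedTriangulation T
    field
      a b       : Fin 3 → LatticePoint n
      σ         : Fin 3 → VertexTuple n
      simplex   : ∀ i → Simplex (σ i)
      a∈        : ∀ i → a i ∈ σ i
      b∈        : ∀ i → b (next i) ∈ σ i
      a∉        : ∀ i → a (next i) ∉ σ i
      a≢b       : ∀ i → a i ≢ b (next i)
      prism     : ∀ i → a (next i) ⊕ b i ≡ a i ⊕ b (next i)

  ℓ : Point n → LatticePoint n → Carrier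
  ℓ a x = ⟨ a , toPoint x ⟩

  scale : ℤ → LatticePoint n → LatticePoint n
  scale k = Vec.map (k ℤ.*_)

  ℓ-scale : ∀ (a : Point n) k x → ℓ a (scale k x) ≈ ι k * ℓ a x
  ℓ-scale a k x = trans (sum-cong λ i → trans (*-congˡ (trans (reflexive (≡.cong ι (Vecₚ.lookup-map i (k ℤ.*_) x))) (ι-* k (lookup x i))))
    (solve 3 (λ a k x → a :* (k :* x) := k :* (a :* x)) refl (a i) (ι k) (ι (lookup x i))))
    (sym (*-distribˡ-sum (ι k) (λ i → a i * ι (lookup x i))))

  ℓ-⊕ : ∀ (a : Point n) x y → ℓ a (x ⊕ y) ≈ ℓ a x + ℓ a y
  ℓ-⊕ a x y = trans (sum-cong λ i → trans (*-congˡ (trans (reflexive (≡.cong ι (Vecₚ.lookup-zipWith ℤ._+_ i x y))) (ι-+ _ _)))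
    (distribˡ (a i) (ι (lookup x i)) (ι (lookup y i)))) (∑-distrib-+ (λ i → a i * ι (lookup x i)) (λ i → a i * ι (lookup y i)))

  -- A positive value at x would exceed C at a large multiple of x, and a negative one is positive
  -- at the opposite point.
  bounded⇒zero : ∀ (a : Point n) C → (∀ x → ℓ a x ≤ C) → ∀ x → ℓ a x ≈ 0#
  bounded⇒zero a C bound x = ≤-antisym (nonPos x) (≤-respʳ (trans (-‿cong (trans (ℓ-scale a -1ℤ x) minus)) (-‿involutive (ℓ a x)))
      (x≤0⇒0≤-x (nonPos (scale -1ℤ x))))
    where
    minus : ι -1ℤ * ℓ a x ≈ - ℓ a x
    minus = trans (*-congʳ (trans (ι-neg 1ℤ) (-‿cong ι-1))) (trans (sym (-‿distribˡ-* 1# (ℓ a x))) (-‿cong (*-identityˡ (ℓ a x))))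
    nonPos : ∀ x → ℓ a x ≤ 0#
    nonPos x with ℓ a x ≤? 0#
    ... | yes ≤0 = ≤0
    -- The extra 1 makes the excess over C strict, since the Archimedean bound is not.
    ... | no  ≰0 with archimedean (C + 1#) ≰0
    ...   | m , C+1≤ = contradiction (≤-respˡ (solve 2 (λ c o → :- c :+ (c :+ o) := o) refl C 1#) (≤-respʳ (-‿inverseˡ C)
              (+-mono-≤ (≤-refl { - C}) (≤-trans C+1≤ (≤-respˡ (ℓ-scale a (+ m) x) (bound (scale (+ m) x))))))) 1≰0

  module _ (T : OrientedTriangulation n) (f : LatticePoint n → Carrier) where
    open OrientedTriangulation T

    point-of : LatticePoint n → Point (suc n)
    point-of x = lift (toPoint x) (f x)

    -- The value at the lifted point (x , f x); here a 0 is the coefficient of the height.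
    E : Point (suc n) → LatticePoint n → Carrier
    E a x = ⟨ a , point-of x ⟩

    lifted∈H : ∀ x → H f (point-of x)
    lifted∈H x = conv-point (Graph f) (point-of x) (x , λ _ → refl)

    record Supports (σ : VertexTuple n) (a : Point (suc n)) (b : Carrier) : Set where
      field
        bound : ∀ x → E a x ≤ b
        on    : ∀ {x} → x ∈ σ → E a x ≈ b
        off   : ∀ x → E a x ≈ b → x ∈ σ
    open Supports

    facet-supports : ∀ {σ} → Simplex σ → (∃[ F ] IsFace (H f) F × hull σ ≐ project F) →
                     Σ (Point (suc n)) λ a → Σ Carrier λ b → Supports σ a b
    facet-supports {σ} S (F , (a , b , a≤b , F⊆ , ⊆F) , hull⊆ , ⊆hull) = a , b , record { bound = bound′ ; on = on′ _ ; off = off′ }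
      where
      bound′ : ∀ x → E a x ≤ b
      bound′ x = a≤b (point-of x) (lifted∈H x)
      off′ : ∀ x → E a x ≈ b → x ∈ σ
      off′ x E≈b = lattice-hull T S x (⊆hull {toPoint x} (point-of x , ⊆F {point-of x} (lifted∈H x , E≈b) , λ _ → refl))
      -- The point of F above x is a convex combination of lifted lattice points;
      -- those lie on F, hence over vertices of σ, hence over x alone.
      on′ : ∀ x → x ∈ σ → E a x ≈ b
      on′ x x∈ = conclude (proj₁ (F⊆ {y} y∈F))
        where
        above = hull⊆ {toPoint x} (vertex-hull σ x∈)
        y = proj₁ above
        y∈F = proj₁ (proj₂ above)
        y≋x = proj₂ (proj₂ above)
        conclude : H f y → E a x ≈ b
        conclude (k , c , p , graph , c≥0 , Σc , y≋) = ≡.subst (λ q → E a q ≈ b) (proj₂ (proj₂ found)) (proj₁ (proj₂ found))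
          where
          q : Vector (LatticePoint n) k
          q j = proj₁ (graph j)
          κ = measure c q c≥0
          total-κ : total κ ≈ 1#
          total-κ = trans (sym (sum≈total κ)) Σc
          y≈ : ∀ i → y i ≈ sum (λ j → c j * point-of (q j) i)
          y≈ i = trans (y≋ i) (sum-cong λ j → *-congˡ (proj₂ (graph j) i))
          ∫E : ∫ κ (E a) ≈ b
          ∫E = begin
            sum (λ j → c j * sum (λ i → a i * point-of (q j) i))
              ≈⟨ sum-cong (λ j → trans (*-distribˡ-sum (c j) (λ i → a i * point-of (q j) i))
                   (sum-cong λ i → solve 3 (λ c a p → c :* (a :* p) := a :* (c :* p)) refl (c j) (a i) (point-of (q j) i))) ⟩
            sum (λ j → sum (λ i → a i * (c j * point-of (q j) i)))
              ≈⟨ ∑-comm (λ j i → a i * (c j * point-of (q j) i)) ⟩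
            sum (λ i → sum (λ j → a i * (c j * point-of (q j) i)))
              ≈⟨ sum-cong (λ i → trans (sym (*-distribˡ-sum (a i) (λ j → c j * point-of (q j) i))) (*-congˡ (sym (y≈ i)))) ⟩
            ⟨ a , y ⟩
              ≈⟨ proj₂ (F⊆ {y} y∈F) ⟩
            b ∎
          -- The slack in the bound: it is nonnegative and has integral zero, so it vanishes
          -- wherever κ has weight.
          gap : LatticePoint n → Carrier
          gap x = b * 1# + - E a x
          ∫gap : ∫ κ gap ≈ 0#
          ∫gap = begin
            ∫ κ gap                                            ≈⟨ ∫-+ κ (λ _ → b * 1#) (λ x → - E a x) ⟩
            ∫ κ (λ _ → b * 1#) + ∫ κ (λ x → - E a x)           ≈⟨ +-cong (∫-* κ b (λ _ → 1#)) (∫-neg κ (E a)) ⟩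
            b * total κ - ∫ κ (E a)                            ≈⟨ +-cong (trans (*-congˡ total-κ) (*-identityʳ b)) (-‿cong ∫E) ⟩
            b - b                                              ≈⟨ -‿inverseʳ b ⟩
            0#                                                 ∎
          κ-on : κ ⊩ (λ x → E a x ≈ b)
          κ-on = ⊩-map (λ {x} g≈0 → sym (trans (sym (*-identityʳ b)) (x∙y⁻¹≈ε⇒x≈y (b * 1#) (E a x) g≈0)))
            (∫-nonNeg-zero κ gap (everywhere κ λ x → x≤y⇒0≤y-x (≤-respʳ (sym (*-identityʳ b)) (bound′ x))) ∫gap)
          x≅κ : dirac x ≅ κ
          x≅κ = trans (∫-dirac x (λ _ → 1#)) (sym total-κ) ,
            λ i → trans (∫-dirac x (λ p → ι (lookup p i))) (trans (sym (y≋x i)) (y≈ (suc i)))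
          κ-x : κ ⊩ (_≡ x)
          κ-x = ⊩-transport (dirac x) κ (_≟ₚ x) (unique S S (dirac x) κ (ae λ _ → inj₂ x∈) (⊩-map (λ {p} → off′ p) κ-on) x≅κ)
            (ae λ _ → inj₂ ≡.refl)
          found : ∃[ j ] E a (q j) ≈ b × q j ≡ x
          found = ⊩-∃ (total≉0 κ total-κ) (⊩-zip _,_ κ-on κ-x)

    -- Once the heights cancel, a bounded combination of affine functions is linear
    -- and bounded on the lattice, hence zero.
    heights-cancel : ∀ a b α β s t → 0# ≤ s → 0# ≤ t → s * a zero + t * α zero ≈ 0# →
                     (∀ x → E a x ≤ b) → (∀ x → E α x ≤ β) → ∀ x → s * E a x + t * E α x ≈ 0#
    heights-cancel a b α β s t 0≤s 0≤t h≈0 ≤b ≤β x = trans (combine x) (bounded⇒zero γ (s * b + t * β)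
        (λ x → ≤-respˡ (combine x) (+-mono-≤ (*-monoˡ-≤ 0≤s (≤b x)) (*-monoˡ-≤ 0≤t (≤β x)))) x)
      where
      γ : Point n
      γ i = s * a (suc i) + t * α (suc i)
      combine : ∀ x → s * E a x + t * E α x ≈ ℓ γ x
      combine x = begin
        s * (a zero * f x + L) + t * (α zero * f x + Λ)
          ≈⟨ solve 7 (λ s t a α f l λ′ → s :* (a :* f :+ l) :+ t :* (α :* f :+ λ′) := (s :* a :+ t :* α) :* f :+ (s :* l :+ t :* λ′))
               refl s t (a zero) (α zero) (f x) L Λ ⟩
        (s * a zero + t * α zero) * f x + (s * L + t * Λ)
          ≈⟨ trans (+-congʳ (trans (*-congʳ h≈0) (zeroˡ (f x)))) (+-identityˡ _) ⟩
        s * L + t * Λ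
          ≈⟨ +-cong (*-distribˡ-sum s (λ i → a (suc i) * ι (lookup x i))) (*-distribˡ-sum t (λ i → α (suc i) * ι (lookup x i))) ⟩
        sum (λ i → s * (a (suc i) * ι (lookup x i))) + sum (λ i → t * (α (suc i) * ι (lookup x i)))
          ≈⟨ sym (∑-distrib-+ (λ i → s * (a (suc i) * ι (lookup x i))) (λ i → t * (α (suc i) * ι (lookup x i)))) ⟩
        sum (λ i → s * (a (suc i) * ι (lookup x i)) + t * (α (suc i) * ι (lookup x i)))
          ≈⟨ sum-cong (λ i → solve 5 (λ s t a α x → s :* (a :* x) :+ t :* (α :* x) := (s :* a :+ t :* α) :* x) refl
               s t (a (suc i)) (α (suc i)) (ι (lookup x i))) ⟩
        ℓ γ x ∎
        where
        L = ℓ (Vector.tail a) x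
        Λ = ℓ (Vector.tail α) x

    -- Without a height coefficient the functional is linear and bounded on the lattice, hence zero.
    -- Its face would then contain every lifted point, also the one over x.
    not-vertical : ∀ {σ a b} → Supports σ a b → ∀ {w x} → w ∈ σ → x ∉ σ → ¬ a zero ≈ 0#
    not-vertical {σ} {a} {b} sup {w} {x} w∈ x∉ a₀≈0 = x∉ (off sup x (trans (E≈0 x) (trans (sym (E≈0 w)) (on sup w∈))))
      where
      E≈ℓ : ∀ x → E a x ≈ ℓ (Vector.tail a) x
      E≈ℓ x = trans (+-congʳ (trans (*-congʳ a₀≈0) (zeroˡ (f x)))) (+-identityˡ _)
      E≈0 : ∀ x → E a x ≈ 0#
      E≈0 x = trans (E≈ℓ x) (bounded⇒zero (Vector.tail a) b (λ x → ≤-respˡ (E≈ℓ x) (bound sup x)) x)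

    -- A facet below and a facet above confine f between two parallel affine
    -- functions, and then any functional takes equal values on the vertices of σ.
    same-side : (∀ x → IsFace (H f) (_≋ point-of x)) → ∀ {σ τ a b α β} → Supports σ a b → Supports τ α β →
                ¬ a zero ≈ 0# → ¬ α zero ≈ 0# → a zero ≤ 0# → 0# ≤ α zero →
                ∀ {w w′} → w ∈ σ → w′ ∈ σ → w ≡ w′
    same-side exposed {σ} {τ} {a} {b} {α} {β} sup sup′ a₀≉0 α₀≉0 a₀≤0 0≤α₀ {w} {w′} w∈ w′∈ with exposed w
    ... | e , ε , e≤ε , ⊆e , e⊆ = ≡.sym (toPoint-injective w′ w λ i → e⊆ {point-of w′} (lifted∈H w′ , trans (sym same) at-w) (suc i))
      where
      -a₀≉0 : ¬ - a zero ≈ 0#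
      -a₀≉0 z = a₀≉0 (trans (sym (-‿involutive (a zero))) (trans (-‿cong z) -0#≈0#))
      at-w : E e w ≈ ε
      at-w = proj₂ (⊆e {point-of w} (λ _ → refl))
      bound-e : ∀ x → E e x ≤ ε
      bound-e x = e≤ε (point-of x) (lifted∈H x)
      carry : ∀ {s t g g′ h h′} → ¬ t ≈ 0# → g ≈ g′ → s * g + t * h ≈ 0# → s * g′ + t * h′ ≈ 0# → h ≈ h′
      carry {s} {t} t≉0 g≈g′ z z′ = *-cancelˡ-nonZero t≉0 (+-cancelˡ (s * _) _ _ (trans z (trans (sym z′) (+-congʳ (*-congˡ (sym g≈g′))))))
      E-σ : E a w ≈ E a w′
      E-σ = trans (on sup w∈) (sym (on sup w′∈))
      opposite : α zero * a zero + (- a zero) * α zero ≈ 0#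
      opposite = trans (solve 2 (λ a α → α :* a :+ (:- a) :* α := con 0ℤ) refl (a zero) (α zero)) ι-0
      E′-σ : E α w ≈ E α w′
      E′-σ = carry -a₀≉0 E-σ (parallel w) (parallel w′)
        where
        parallel : ∀ x → α zero * E a x + (- a zero) * E α x ≈ 0#
        parallel = heights-cancel a b α β (α zero) (- a zero) 0≤α₀ (x≤0⇒0≤-x a₀≤0) opposite (bound sup) (bound sup′)
      same : E e w ≈ E e w′
      -- With nonnegative coefficients heights cancel only against a slope of the opposite sign: the
      -- lower facet serves when `e zero` is nonnegative, the upper one otherwise.
      same with ≤-total 0# (e zero)
      ... | inj₁ 0≤e = carry -a₀≉0 E-σ (flat w) (flat w′)
        where
        flat : ∀ x → e zero * E a x + (- a zero) * E e x ≈ 0#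
        flat = heights-cancel a b e ε (e zero) (- a zero) 0≤e (x≤0⇒0≤-x a₀≤0)
          (trans (solve 2 (λ a e → e :* a :+ (:- a) :* e := con 0ℤ) refl (a zero) (e zero)) ι-0) (bound sup) bound-e
      ... | inj₂ e≤0 = carry α₀≉0 E′-σ (flat w) (flat w′)
        where
        flat : ∀ x → (- e zero) * E α x + α zero * E e x ≈ 0#
        flat = heights-cancel α β e ε (- e zero) (α zero) (x≤0⇒0≤-x e≤0) 0≤α₀
          (trans (solve 2 (λ α e → (:- e) :* α :+ α :* e := con 0ℤ) refl (α zero) (e zero)) ι-0) (bound sup′) bound-e

    module _ (P : TwistedPrism T) (exposed : ∀ x → IsFace (H f) (_≋ point-of x))
             (facets : ∀ σ → Simplex σ → ∃[ F ] IsFace (H f) F × hull σ ≐ project F) where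
      open TwistedPrism P

      private
        functional : ∀ i → Σ (Point (suc n)) λ c → Σ Carrier λ d → Supports (σ i) c d
        functional i = facet-supports (simplex i) (facets (σ i) (simplex i))
        c : Fin 3 → Point (suc n)
        c i = proj₁ (functional i)
        d : Fin 3 → Carrier
        d i = proj₁ (proj₂ (functional i))
        sup : ∀ i → Supports (σ i) (c i) (d i)
        sup i = proj₂ (proj₂ (functional i))

        slope≉0 : ∀ i → ¬ c i zero ≈ 0#
        slope≉0 i = not-vertical (sup i) (a∈ i) (a∉ i)

        -- How much higher the lift is over the absent diagonal than over the one in σ i; its sign
        -- tells lower from upper facets.
        Δ : Fin 3 → Carrier
        Δ i = (f (a (next i)) + f (b i)) - (f (a i) + f (b (next i)))

        E-pair : ∀ i p q → E (c i) p + E (c i) q ≈ c i zero * (f p + f q) + ℓ (Vector.tail (c i)) (p ⊕ q)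
        E-pair i p q = trans (solve 5 (λ c x y l m → (c :* x :+ l) :+ (c :* y :+ m) := c :* (x :+ y) :+ (l :+ m)) refl
          (c i zero) (f p) (f q) (ℓ (Vector.tail (c i)) p) (ℓ (Vector.tail (c i)) q)) (+-congˡ (sym (ℓ-⊕ (Vector.tail (c i)) p q)))

        -- The two diagonals have the same sum, so the linear parts cancel; at both ends of the
        -- diagonal in σ i the functional attains its bound.
        cΔ : ∀ i → c i zero * Δ i ≈ (E (c i) (a (next i)) + E (c i) (b i)) - (d i + d i)
        cΔ i = sym (begin
          (E (c i) (a (next i)) + E (c i) (b i)) - (d i + d i)
            ≈⟨ +-cong (E-pair i _ _) (-‿cong (trans (+-cong (sym (on (sup i) (a∈ i))) (sym (on (sup i) (b∈ i)))) (E-pair i _ _))) ⟩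
          (c i zero * (f (a (next i)) + f (b i)) + ℓ C (a (next i) ⊕ b i)) - (c i zero * (f (a i) + f (b (next i))) + ℓ C (a i ⊕ b (next i)))
            ≈⟨ +-congʳ (+-congˡ (reflexive (≡.cong (ℓ C) (prism i)))) ⟩
          (c i zero * (f (a (next i)) + f (b i)) + ℓ C (a i ⊕ b (next i))) - (c i zero * (f (a i) + f (b (next i))) + ℓ C (a i ⊕ b (next i)))
            ≈⟨ solve 4 (λ c x y l → (c :* x :+ l) :- (c :* y :+ l) := c :* (x :- y)) refl (c i zero)
                 (f (a (next i)) + f (b i)) (f (a i) + f (b (next i))) (ℓ C (a i ⊕ b (next i))) ⟩
          c i zero * Δ i ∎)
          where C = Vector.tail (c i)

        cΔ≤0 : ∀ i → c i zero * Δ i ≤ 0#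
        cΔ≤0 i = ≤-respˡ (sym (cΔ i)) (≤-respʳ (-‿inverseʳ (d i + d i))
          (+-mono-≤ (+-mono-≤ (bound (sup i) (a (next i))) (bound (sup i) (b i))) ≤-refl))

        -- Otherwise the slacks at the two ends of the absent diagonal, being nonnegative, would
        -- both vanish and `a (next i)` would be a vertex of σ i.
        Δ≉0 : ∀ i → ¬ Δ i ≈ 0#
        Δ≉0 i Δ≈0 = a∉ i (off (sup i) (a (next i)) (sym (x∙y⁻¹≈ε⇒x≈y _ _ (proj₁ (+-nonNeg-zero
          (x≤y⇒0≤y-x (bound (sup i) (a (next i)))) (x≤y⇒0≤y-x (bound (sup i) (b i))) (begin
            (d i - E (c i) (a (next i))) + (d i - E (c i) (b i))
              ≈⟨ solve 3 (λ d x y → (d :- x) :+ (d :- y) := :- ((x :+ y) :- (d :+ d))) refl (d i) (E (c i) (a (next i))) (E (c i) (b i)) ⟩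
            - ((E (c i) (a (next i)) + E (c i) (b i)) - (d i + d i))
              ≈⟨ -‿cong (trans (sym (cΔ i)) (trans (*-congˡ Δ≈0) (zeroʳ (c i zero)))) ⟩
            - 0#
              ≈⟨ -0#≈0# ⟩
            0# ∎))))))

        -- Around the prism each of the six heights enters once with either sign.
        ΣΔ : Δ zero + (Δ (suc zero) + Δ (suc (suc zero))) ≈ 0#
        ΣΔ = trans (solve 6 (λ x y z u v w → ((y :+ u) :- (x :+ v)) :+ (((z :+ v) :- (y :+ w)) :+ ((x :+ w) :- (z :+ u))) := con 0ℤ) refl
          (f (a zero)) (f (a (suc zero))) (f (a (suc (suc zero)))) (f (b zero)) (f (b (suc zero))) (f (b (suc (suc zero))))) ι-0

        vanishing : ∀ i → 0# ≤ c i zero * Δ i → ⊥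
        vanishing i 0≤cΔ = Sum.[ slope≉0 i , Δ≉0 i ]′ (zero-product (≤-antisym (cΔ≤0 i) 0≤cΔ))

        Δ-nonNeg : ∀ i → c i zero ≤ 0# → 0# ≤ Δ i
        Δ-nonNeg i c≤0 = Sum.[ (λ 0≤Δ → 0≤Δ)
          , (λ Δ≤0 → contradiction (≤-respʳ (solve 2 (λ c x → (:- c) :* (:- x) := c :* x) refl (c i zero) (Δ i))
              (*-nonNeg (x≤0⇒0≤-x c≤0) (x≤0⇒0≤-x Δ≤0))) (vanishing i)) ]′ (≤-total 0# (Δ i))

        -Δ-nonNeg : ∀ i → 0# ≤ c i zero → 0# ≤ - Δ i
        -Δ-nonNeg i 0≤c = Sum.[ (λ 0≤Δ → contradiction (*-nonNeg 0≤c 0≤Δ) (vanishing i)) , x≤0⇒0≤-x ]′ (≤-total 0# (Δ i))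

        -- A lower and an upper facet together would identify all vertices of σ i, but `a i` and
        -- `b (next i)` differ.
        one-side : ∀ i j → c i zero ≤ 0# → 0# ≤ c j zero → ⊥
        one-side i j c≤0 0≤c = a≢b i (same-side exposed (sup i) (sup j) (slope≉0 i) (slope≉0 j) c≤0 0≤c (a∈ i) (b∈ i))

        all-below : c zero zero ≤ 0# → ⊥
        all-below c≤0 = Δ≉0 zero (proj₁ (+-nonNeg-zero (below zero) (+-nonNeg (below (suc zero)) (below (suc (suc zero)))) ΣΔ))
          where
          below : ∀ j → 0# ≤ Δ j
          below j = Sum.[ Δ-nonNeg j , (λ 0≤cⱼ → contradiction 0≤cⱼ (one-side zero j c≤0)) ]′ (≤-total (c j zero) 0#)

        all-above : 0# ≤ c zero zero → ⊥
        all-above 0≤c = Δ≉0 zero (trans (sym (-‿involutive (Δ zero))) (trans (-‿cong (proj₁ (+-nonNeg-zero (above zero)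
          (+-nonNeg (above (suc zero)) (above (suc (suc zero)))) (trans (solve 3 (λ x y z → :- x :+ (:- y :+ :- z) := :- (x :+ (y :+ z))) refl
            (Δ zero) (Δ (suc zero)) (Δ (suc (suc zero)))) (trans (-‿cong ΣΔ) -0#≈0#))))) -0#≈0#))
          where
          above : ∀ j → 0# ≤ - Δ j
          above j = Sum.[ -Δ-nonNeg j , (λ cⱼ≤0 → contradiction 0≤c (one-side j zero cⱼ≤0)) ]′ (≤-total 0# (c j zero))

      contradictory : ⊥
      contradictory = Sum.[ all-below , all-above ]′ (≤-total (c zero zero) 0#)

-- The triangulations in dimension 5 and above

module Tower (D : OrderedDomain) where
  open Lattice
  open Cells
  open Measures D
  open Product D
  open Birkhoff D
  open NonRegularity D

  private
    variable
      n : ℕ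

  -- Turning at `p i` puts the lower copy of `p i` and the upper copy of `p (next i)` into one
  -- staircase. It also contains the upper copy of `p i`, so with the lower copy of `p (next i)` in
  -- it, `p (next i)` would precede or equal `p i`, against the cycle.
  ⊏-cycle⇒TwistedPrism : (T : OrientedTriangulation n) → let open OrientedTriangulation T in
    (p : Fin 3 → LatticePoint n) (σ : Fin 3 → VertexTuple n) → (∀ i → Simplex (σ i)) →
    (∀ i → p i ∈ σ i) → (∀ i → p (next i) ∈ σ i) → (∀ i → p i ⊏ p (next i)) → TwistedPrism (T ×ᴸ)
  ⊏-cycle⇒TwistedPrism T p σ S p∈ q∈ p⊏q = record
    { a       = λ i → 0ℤ ∷ p i
    ; b       = λ i → 1ℤ ∷ p i
    ; σ       = λ i → stair 0ℤ (turn-at i) (σ i)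
    ; simplex = λ i → σ i , 0ℤ , turn-at i , S i , ≡.refl
    ; a∈      = λ i → proj₁ (stair-turn 0ℤ (σ i) (p∈ i))
    ; b∈      = λ i → stair-top {_⊏_ = _⊏_} ⊏-asym 0ℤ (sorted (S i)) (p∈ i) (q∈ i) (p⊏q i)
    ; a∉      = λ i q₀∈ → downhill i (stair-climb _⊏_ 0ℤ (turn-at i) (sorted (S i)) q₀∈
                  (proj₂ (stair-turn 0ℤ (σ i) (p∈ i))) (z<suc[z] 0ℤ))
    ; a≢b     = λ i → λ ()
    ; prism   = λ i → ≡.cong (1ℤ ∷_) (Vecₚ.zipWith-comm ℤₚ.+-comm (p (next i)) (p i))
    }
    where
    open OrientedTriangulation T
    turn-at = λ i → Any.index (p∈ i)
    downhill : ∀ i → ¬ (p (next i) ≡ p i ⊎ p (next i) ⊏ p i)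
    downhill i (inj₁ q≡p) = ⊏-asym (p⊏q i) (≡.subst₂ _⊏_ (≡.sym q≡p) q≡p (p⊏q i))
    downhill i (inj₂ q⊏p) = ⊏-asym (p⊏q i) q⊏p

  -- The prism stays on the lower level, on staircases that turn at the last vertex; absence of a
  -- vertex is read off from the base.
  TwistedPrism-×ᴸ : (T : OrientedTriangulation n) → TwistedPrism T → TwistedPrism (T ×ᴸ)
  TwistedPrism-×ᴸ {n} T P = record
    { a       = λ i → 0ℤ ∷ a i
    ; b       = λ i → 0ℤ ∷ b i
    ; σ       = λ i → stair 0ℤ (fromℕ n) (σ i)
    ; simplex = λ i → σ i , 0ℤ , fromℕ n , simplex i , ≡.refl
    ; a∈      = λ i → stair-bottom 0ℤ (σ i) (a∈ i)
    ; b∈      = λ i → stair-bottom 0ℤ (σ i) (b∈ i)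
    ; a∉      = λ i → a∉ i ∘ stair-tail 0ℤ (fromℕ n) (σ i)
    ; a≢b     = λ i → a≢b i ∘ Vecₚ.∷-injectiveʳ
    ; prism   = λ i → ≡.cong (0ℤ ∷_) (prism i)
    }
    where open TwistedPrism P

  twisted : ∀ k → Σ (OrientedTriangulation (k ℕ.+ 5)) TwistedPrism
  twisted zero    = birkhoff ×ᴸ , ⊏-cycle⇒TwistedPrism birkhoff even (λ i → translate origin (cell (even-cell i)))
    (λ i → origin , even-cell i , ≡.refl) (proj₁ ∘ even∈) (proj₂ ∘ even∈) cyclic
  twisted (suc k) = proj₁ (twisted k) ×ᴸ , TwistedPrism-×ᴸ (proj₁ (twisted k)) (proj₂ (twisted k))

-- Passage to the real numbers

module _ (em : ExcludedMiddle 0ℓ) where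
  open Measures (RealField.ℝ-orderedDomain em) using (OrientedTriangulation)
  open Geometry (RealField.ℝ-orderedDomain em)
    using (independent; has-vertex; covers; face-to-face; translate-back)
  open NonRegularity (RealField.ℝ-orderedDomain em) using (TwistedPrism; contradictory)

  periodicTriangulation : ∀ {n} → OrientedTriangulation n → PeriodicTriangulation n
  periodicTriangulation T = record
    { simplices    = Simplex
    ; independent  = independent T
    ; vertices     = λ v → let σ , S , v∈ = has-vertex T v in σ , S , Any.index v∈ , ≡.sym (lookup-index v∈)
    ; covers       = covers T
    ; face-to-face = face-to-face T
    ; periodic-⊆   = λ v σ S → translate v σ , periodic v S , (λ h → h) , (λ h → h)
    ; periodic-⊇   = λ v τ S → translate (Lattice.negate v) τ , periodic (Lattice.negate v) S ,
        (λ {x} → ≡.subst (λ σ → Defs.hull σ x → Defs.hull τ x) (≡.sym (translate-back T v τ)) (λ h → h)) ,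
        (λ {x} → ≡.subst (λ σ → Defs.hull τ x → Defs.hull σ x) (≡.sym (translate-back T v τ)) (λ h → h))
    }
    where open OrientedTriangulation T

  TwistedPrism⇒¬Regular : ∀ {n} (T : OrientedTriangulation n) → TwistedPrism T → ¬ Regular (periodicTriangulation T)
  TwistedPrism⇒¬Regular T P (f , exposed , facets , _) = contradictory T f P exposed
    λ σ S → let F , (face , _) , hull≐ = facets σ S in F , face , hull≐

theorem7p4 : ExcludedMiddle 0ℓ → ∀ (n : ℕ) → n ≥ 5 → Σ (PeriodicTriangulation n) λ T → ¬ Regular T
theorem7p4 em n n≥5 = ≡.subst (λ n → Σ (PeriodicTriangulation n) λ T → ¬ Regular T) (ℕₚ.m∸n+n≡m n≥5)
  (periodicTriangulation em (proj₁ T) , TwistedPrism⇒¬Regular em (proj₁ T) (proj₂ T))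
  where T = Tower.twisted (RealField.ℝ-orderedDomain em) (n ℕ.∸ 5)
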